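{- A matroid is in $\mathcal{P}_{1,q}$ iff it contains no minor isomorphic to any of the matroids $U_{2,4}$, $M(K_4)$, $M(K_{2,3})$ and $M^*(K_{2,3})$.
   Context: $\mathcal{P}_{1,q}$ is the class of matroids representable over the finite field $\mathbb{F}_q=GF(q)$ that have pathwidth at most $1$. For a matroid $M$ with ground set $E(M)$ and rank function $r_M$, $\lambda_M(X) = r_M(X)+r_M(E(M)-X)-r_M(E(M))$ (no "$+1$"), the width of an ordering $(e_1,\ldots,e_n)$ of $E(M)$ is $\max_i\lambda_M(\{e_1,\ldots,e_i\})$, and the pathwidth is the minimum width over all orderings. $M(H)$ denotes the cycle matroid of a graph $H$ and $M^*$ the dual matroid. -}

module Defs where

open import Level using (0ℓ)
open import Function using (_∘_)
open import Data.Bool using (Bool; true; false; _∧_; _∨_; not)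
open import Data.Nat using (ℕ; zero; suc; _+_; _∸_; _≤_; _⊔_; _⊓_; _<ᵇ_)
open import Data.Fin using (Fin; toℕ; _≟_; #_)
open import Data.Fin.Subset using (Subset; _∪_; _∩_; _⊆_; ∣_∣; ∁; ⊤; ⁅_⁆; _∈_; _∉_)
open import Data.Fin.Permutation using (Permutation′; _⟨$⟩ˡ_)
open import Data.Vec using (Vec; lookup; tabulate; _∷_; [])
open import Data.List using (List; foldr; map; upTo)
open import Data.Product using (Σ; _×_; _,_; proj₁; proj₂)
open import Relation.Nullary using (¬_)
open import Relation.Nullary.Decidable using (⌊_⌋)
open import Relation.Binary.PropositionalEquality using (_≡_)
open import Algebra.Bundles using (CommutativeRing)

anyFin : ∀ {n} → (Fin n → Bool) → Bool
anyFin {zero}  f = false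
anyFin {suc n} f = f Data.Fin.zero ∨ anyFin (f ∘ Data.Fin.suc)

countFin : ∀ {n} → (Fin n → Bool) → ℕ
countFin {zero}  f = 0
countFin {suc n} f = (if′ (f Data.Fin.zero)) + countFin (f ∘ Data.Fin.suc)
  where
  if′ : Bool → ℕ
  if′ true  = 1
  if′ false = 0

record Matroid (n : ℕ) : Set where
  field
    rank      : Subset n → ℕ
    rank-≤    : ∀ X → rank X ≤ ∣ X ∣
    rank-mono : ∀ {X Y} → X ⊆ Y → rank X ≤ rank Y
    rank-sub  : ∀ X Y → rank (X ∪ Y) + rank (X ∩ Y) ≤ rank X + rank Y

RankFn : ℕ → Set
RankFn n = Subset n → ℕ

Indep : ∀ {n} → RankFn n → Subset n → Set
Indep r X = r X ≡ ∣ X ∣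

dual : ∀ {n} → RankFn n → RankFn n
dual r X = ∣ X ∣ + r (∁ X) ∸ r ⊤

uniform : (k n : ℕ) → RankFn n
uniform k n X = ∣ X ∣ ⊓ k

Graph : ℕ → ℕ → Set
Graph v e = Fin e → Fin v × Fin v

module _ {v e : ℕ} (G : Graph v e) (X : Subset e) where

  step : Subset v → Subset v
  step S = tabulate λ w → lookup S w ∨ anyFin λ k → lookup X k ∧
             ((lookup S (proj₁ (G k)) ∧ ⌊ w ≟ proj₂ (G k) ⌋) ∨
              (lookup S (proj₂ (G k)) ∧ ⌊ w ≟ proj₁ (G k) ⌋))

  iter : ℕ → Subset v → Subset v
  iter zero    S = S
  iter (suc m) S = step (iter m S)

  reach : Fin v → Subset v
  reach u = iter v ⁅ u ⁆

  connected : Fin v → Fin v → Bool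
  connected u w = lookup (reach u) w

  -- number of connected components of (V, X): count the least vertex of each
  components : ℕ
  components = countFin λ j → not (anyFin λ i → (toℕ i <ᵇ toℕ j) ∧ connected i j)

cycleRank : ∀ {v e} → Graph v e → RankFn e
cycleRank {v} G X = v ∸ components G X

K4 : Graph 4 6
K4 = lookup ((# 0 , # 1) ∷ (# 0 , # 2) ∷ (# 0 , # 3) ∷
             (# 1 , # 2) ∷ (# 1 , # 3) ∷ (# 2 , # 3) ∷ [])

K23 : Graph 5 6
K23 = lookup ((# 0 , # 2) ∷ (# 0 , # 3) ∷ (# 0 , # 4) ∷
              (# 1 , # 2) ∷ (# 1 , # 3) ∷ (# 1 , # 4) ∷ [])

U24 MK4 MK23 MK23* : Σ ℕ RankFn
U24   = 4 , uniform 2 4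
MK4   = 6 , cycleRank K4
MK23  = 6 , cycleRank K23
MK23* = 6 , dual (cycleRank K23)

-- Minors: N (on Fin m) is isomorphic to a minor M / C \ D of M (on Fin n),
-- where D = E(M) - C - φ(E(N)), via the injection φ : E(N) → E(M) - C.
-- Rank in M / C \ D:  r(Y) = r_M(Y ∪ C) - r_M(C).

image : ∀ {m n} → (Fin m → Fin n) → Subset m → Subset n
image φ X = tabulate λ j → anyFin λ i → lookup X i ∧ ⌊ φ i ≟ j ⌋

HasMinor : ∀ {n} → RankFn n → Σ ℕ RankFn → Set
HasMinor {n} rM (m , rN) =
  Σ (Subset n) λ C → Σ (Fin m → Fin n) λ φ →
    (∀ i j → φ i ≡ φ j → i ≡ j) ×
    (∀ i → φ i ∉ C) ×
    (∀ X → rN X ≡ rM (image φ X ∪ C) ∸ rM C)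

conn : ∀ {n} → RankFn n → Subset n → ℕ
conn r X = r X + r (∁ X) ∸ r ⊤

-- ordering (e_1,…,e_n) given by a permutation σ (e_{k+1} = σ k);
-- prefix i = {e_1,…,e_i}
prefix : ∀ {n} → Permutation′ n → ℕ → Subset n
prefix σ i = tabulate λ j → toℕ (σ ⟨$⟩ˡ j) <ᵇ i

width : ∀ {n} → RankFn n → Permutation′ n → ℕ
width {n} r σ = foldr _⊔_ 0 (map (λ i → conn r (prefix σ (suc i))) (upTo n))

PathwidthAtMost : ∀ {n} → ℕ → RankFn n → Set
PathwidthAtMost {n} k r = Σ (Permutation′ n) λ σ → width r σ ≤ k

record Field : Set₁ where
  field
    commRing : CommutativeRing 0ℓ 0ℓ
  open CommutativeRing commRing public
  field
    0≉1 : ¬ (0# ≈ 1#)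
    inv : ∀ x → ¬ (x ≈ 0#) → Σ Carrier λ y → x * y ≈ 1#

HasOrder : Field → ℕ → Set
HasOrder F q = Σ (Fin q → Carrier) λ e →
    (∀ i j → e i ≈ e j → i ≡ j) × (∀ x → Σ (Fin q) λ i → e i ≈ x)
  where open Field F using (Carrier; _≈_)

module _ (F : Field) where
  open Field F using (Carrier; _≈_; 0#; _*_) renaming (_+_ to _+F_)

  ∑ : ∀ {n} → (Fin n → Carrier) → Carrier
  ∑ {zero}  f = 0#
  ∑ {suc n} f = f Data.Fin.zero +F ∑ (f ∘ Data.Fin.suc)

  LinIndep : ∀ {n d} → (Fin n → Fin d → Carrier) → Subset n → Set
  LinIndep {n} {d} v X = ∀ (c : Fin n → Carrier) →
      (∀ i → i ∉ X → c i ≈ 0#) →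
      (∀ k → ∑ (λ i → c i * v i k) ≈ 0#) →
      ∀ i → i ∈ X → c i ≈ 0#

  Representable : ∀ {n} → RankFn n → Set
  Representable {n} r = Σ ℕ λ d → Σ (Fin n → Fin d → Carrier) λ v →
      ∀ X → (Indep r X → LinIndep v X) × (LinIndep v X → Indep r X)

-- the class P_{1,q} (with GF(q) given as a field F of order q)
InP1 : ∀ {n} → Field → Matroid n → Set
InP1 F M = Representable F (Matroid.rank M) × PathwidthAtMost 1 (Matroid.rank M)

{-# OPTIONS --safe #-}
-- The connectivity λ(X) = r(X) + r(E − X) − r(E) does not grow in minors.  In each
-- obstruction all sets of some size k have λ ≥ 2, and every ordering of M has a
-- prefix that meets the ground set of a given minor in exactly k elements, so a
-- matroid of pathwidth at most 1 has no such minor.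
--
-- Conversely, a narrow ordering is built by induction on the number of elements
-- that are neither loops nor coloops.  Across a separation, orderings are
-- concatenated.  If e and f are parallel (or, dually, in series), e is inserted
-- next to f in an ordering of M \ e.  This fails only if f is the link between the
-- set X of its predecessors and the set Y of its successors; then either X or Y
-- is independent, so that its elements may be rearranged, or contracting parts of
-- X and Y leaves M*(K₂,₃).  If no two elements are parallel or in series, then an
-- ordering of M / e begins with a pair x, x′ parallel in M / e, and the first
-- component it completes ends with such a pair y, y′.  So {e,x,x′} and {e,y,y′}
-- are lines of M, and an element g joining them yields M(K₄) or U₂,₄.
--
-- Hence a matroid without the obstructions reduces to loops by deleting coloops
-- and by undoing parallel and series extensions, all of which preserve
-- representability over any field.
module Submission where

open import Defs
open import Data.Bool using (Bool; true; false; _∧_; _∨_; not; T; T?; if_then_else_)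
open import Data.Bool.ListAction using (all)
open import Data.Bool.Properties using (T-≡; T-∧; T-∨; ∨-identityʳ)
open import Data.Empty using (⊥-elim)
open import Data.Fin using (Fin; toℕ; _≟_; opposite)
open import Data.Fin.Patterns using (0F; 1F; 2F; 3F; 4F; 5F)
open import Data.Fin.Permutation using (Permutation′; permutation; _⟨$⟩ˡ_; _⟨$⟩ʳ_; inverseʳ)
open import Data.Fin.Properties using (all?; any?; injective⇒≤; opposite-involutive; toℕ-injective; toℕ<n)
open import Data.Fin.Subset using (Subset)
import Data.Fin.Subset as Sub
open import Data.Fin.Subset.Properties using (anySubset?)
import Data.Fin.Subset.Properties as SubP
open import Data.List using (List; []; _∷_; _++_; filterᵇ; foldr; length; map; take; upTo)
import Data.List as List
open import Data.List.Membership.Propositional using (_∈_)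
open import Data.List.Membership.Propositional.Properties using (∈-++⁺ˡ; ∈-++⁺ʳ; ∈-lookup; ∈-map⁺; ∈-map⁻; ∈-upTo⁺; ∈-upTo⁻)
open import Data.List.Relation.Unary.All using (All; []; _∷_)
import Data.List.Relation.Unary.All as All
import Data.List.Relation.Unary.All.Properties as AllP
open import Data.List.Relation.Unary.AllPairs using ([]; _∷_)
open import Data.List.Relation.Unary.Any using (here; there; index)
import Data.List.Relation.Unary.Any.Properties as AnyP
open import Data.List.Relation.Unary.Unique.Propositional using (Unique)
open import Data.Maybe using (Maybe; just; nothing)
open import Data.Nat using (ℕ; zero; suc; _+_; _∸_; _≤_; _<_; _⊓_; _⊔_; _<ᵇ_; _≡ᵇ_; _≤ᵇ_; _<?_; _≤?_; z≤n; s≤s)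
open import Data.Nat.Induction using (<-wellFounded)
open import Data.Nat.Properties hiding (_≟_)
open import Data.Nat.Tactic.RingSolver using (solve-∀)
open import Data.Product using (Σ; ∃; _×_; _,_; proj₁; proj₂)
open import Data.Sum using (_⊎_; inj₁; inj₂; [_,_]′; map₂)
open import Data.Unit using (⊤; tt)
open import Data.Vec using ([]; _∷_; lookup; tabulate)
import Data.Vec.Properties as VecP
open import Data.Vec.Properties using (lookup∘tabulate; lookup-zipWith)
open import Function using (_∘_)
open import Function.Bundles using (_⇔_; mk⇔; module Equivalence)
open import Induction.WellFounded using (Acc; acc)
open import Relation.Binary.PropositionalEquality using (_≡_; _≢_; refl; sym; trans; cong; cong₂; subst; module ≡-Reasoning)
open import Relation.Nullary using (¬_; Dec; yes; no; ¬?; _×-dec_; _⊎-dec_)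
open import Relation.Nullary.Decidable using (⌊_⌋; decidable-stable; fromWitness; toWitness)

-- Sets, matroids and a checker for rank inequalities

-- That a matroid without the obstructions has a parallel or a series pair as soon as some element
-- is neither a loop nor a coloop is itself a consequence of the existence of orderings, applied to
-- a one-element contraction. So the last case of the induction constructs nothing: it contradicts
-- the exclusion of U₂,₄ and M(K₄), and representability has to wait for it. Contraction is used
-- there because a pair that is parallel in M / e is a line through e in M, and two lines through a
-- common point are the skeleton of M(K₄).
--
-- Closure is never defined. That S spans x is written `r (S ∪ ⁅ x ⁆) ≤ r S`, and that it does not
-- is the strict inequality the other way. Every exchange argument then becomes a sum of a few
-- instances of submodularity and monotonicity, which can be stored as a certificate and verified by
-- evaluation on truth tables. The mathematics lies in the choice of the sets; truncated
-- subtractions are first removed by adding the subtracted ranks back.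

P : ℕ → Set
P n = Fin n → Bool

infixl 6 _∪_
infixl 7 _∩_ _∖_
infix 4 _⊆_ _≐_

∅ 𝟙 : ∀ {n} → P n
∅ _ = false
𝟙 _ = true

_∪_ _∩_ _∖_ : ∀ {n} → P n → P n → P n
(X ∪ Y) i = X i ∨ Y i
(X ∩ Y) i = X i ∧ Y i
(X ∖ Y) i = X i ∧ not (Y i)

∁ : ∀ {n} → P n → P n
∁ X i = not (X i)

⁅_⁆ : ∀ {n} → Fin n → P n
⁅ x ⁆ i = ⌊ x ≟ i ⌋

_⊆_ : ∀ {n} → P n → P n → Set
X ⊆ Y = ∀ i → T (X i) → T (Y i)

-- Functions cannot be identified pointwise without extensionality, so equality of sets is mutual
-- inclusion; ranks respect it because they are monotone.
_≐_ : ∀ {n} → P n → P n → Set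
X ≐ Y = X ⊆ Y × Y ⊆ X

1≰0 : ¬ 1 ≤ 0
1≰0 ()

∨⁺ : ∀ {a b} → T a ⊎ T b → T (a ∨ b)
∨⁺ = Equivalence.from T-∨

∨⁻ : ∀ {a b} → T (a ∨ b) → T a ⊎ T b
∨⁻ = Equivalence.to T-∨

∧⁺ : ∀ {a b} → T a × T b → T (a ∧ b)
∧⁺ = Equivalence.from T-∧

∧⁻ : ∀ {a b} → T (a ∧ b) → T a × T b
∧⁻ = Equivalence.to T-∧

T⇒≡ : ∀ {b} → T b → b ≡ true
T⇒≡ = Equivalence.to T-≡

≡⇒T : ∀ {b} → b ≡ true → T b
≡⇒T = Equivalence.from T-≡

T-not : ∀ {b} → ¬ T b → T (not b)
T-not {true}  ¬b = ⊥-elim (¬b tt)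
T-not {false} _  = tt

not-T : ∀ {b} → T (not b) → ¬ T b
not-T {false} _ ()

module _ {n : ℕ} where

  ∈-⁅⁆ : (x : Fin n) → T (⁅ x ⁆ x)
  ∈-⁅⁆ x = fromWitness refl

  ⁅⁆-⊆ : ∀ (X : P n) {x} → T (X x) → ⁅ x ⁆ ⊆ X
  ⁅⁆-⊆ X {x} x∈X i x≡i = subst (T ∘ X) (toWitness x≡i) x∈X

  ⁅⁆-⊆∁ : ∀ (X : P n) {x} → ¬ T (X x) → ⁅ x ⁆ ⊆ ∁ X
  ⁅⁆-⊆∁ X x∉X = ⁅⁆-⊆ (∁ X) (T-not x∉X)

  ≢-⊆∁ : ∀ {x y : Fin n} → x ≢ y → ⁅ x ⁆ ⊆ ∁ ⁅ y ⁆
  ≢-⊆∁ {x} {y} x≢y = ⁅⁆-⊆∁ ⁅ y ⁆ (λ y≡x → x≢y (sym (toWitness y≡x)))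

card : ∀ {n} → P n → ℕ
card {zero}  X = 0
card {suc n} X = (if X Fin.zero then 1 else 0) + card (X ∘ Fin.suc)

card-modular : ∀ {n} (X Y : P n) → card (X ∪ Y) + card (X ∩ Y) ≡ card X + card Y
card-modular {zero}  X Y = refl
card-modular {suc n} X Y with X Fin.zero | Y Fin.zero | card-modular (X ∘ Fin.suc) (Y ∘ Fin.suc)
... | true  | true  | ih = cong suc (trans (+-suc _ _) (trans (cong suc ih) (sym (+-suc _ _))))
... | true  | false | ih = cong suc ih
... | false | true  | ih = trans (cong suc ih) (sym (+-suc _ _))
... | false | false | ih = ih

card-mono : ∀ {n} {X Y : P n} → X ⊆ Y → card X ≤ card Y
card-mono {zero}          X⊆Y = z≤n
card-mono {suc n} {X} {Y} X⊆Y with X Fin.zero | Y Fin.zero | X⊆Y Fin.zero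
... | true  | true  | _ = s≤s (card-mono (X⊆Y ∘ Fin.suc))
... | true  | false | p = ⊥-elim (p tt)
... | false | true  | _ = m≤n⇒m≤1+n (card-mono (X⊆Y ∘ Fin.suc))
... | false | false | _ = card-mono (X⊆Y ∘ Fin.suc)

card-∅ : ∀ {n} → card {n} ∅ ≡ 0
card-∅ {zero}  = refl
card-∅ {suc n} = card-∅ {n}

card-cong : ∀ {n} {X Y : P n} → (∀ i → X i ≡ Y i) → card X ≡ card Y
card-cong {zero}  eq = refl
card-cong {suc n} eq = cong₂ (λ b k → (if b then 1 else 0) + k) (eq Fin.zero) (card-cong (eq ∘ Fin.suc))

does-suc : ∀ {n} (x i : Fin n) → ⌊ Fin.suc x ≟ Fin.suc i ⌋ ≡ ⌊ x ≟ i ⌋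
does-suc x i with x ≟ i
... | yes _ = refl
... | no  _ = refl

card-⁅⁆ : ∀ {n} (x : Fin n) → card ⁅ x ⁆ ≡ 1
card-⁅⁆ {suc n} Fin.zero    = cong suc (card-∅ {n})
card-⁅⁆ {suc n} (Fin.suc x) = trans (card-cong (λ i → does-suc x i)) (card-⁅⁆ x)

-- The axioms of `Matroid` over Boolean-valued functions: set operations reduce pointwise, so the
-- rank functions of minors and duals can be written down directly.
record Mat (n : ℕ) : Set where
  field
    r      : P n → ℕ
    r≤card : ∀ X → r X ≤ card X
    mono   : ∀ {X Y} → X ⊆ Y → r X ≤ r Y
    submod : ∀ X Y → r (X ∪ Y) + r (X ∩ Y) ≤ r X + r Y

  r∅ : r ∅ ≡ 0
  r∅ = n≤0⇒n≡0 (≤-trans (r≤card ∅) (≤-reflexive (card-∅ {n})))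

  r1 : ∀ x → r ⁅ x ⁆ ≤ 1
  r1 x = ≤-trans (r≤card ⁅ x ⁆) (≤-reflexive (card-⁅⁆ x))

-- A checker for linear inequalities between ranks of Boolean combinations of
-- given sets: the hypotheses, the negated goal (hypothesis 0) and the listed
-- further steps are added up to a contradiction, where sets count as equal if
-- their truth tables agree on the rows allowed by the given inclusions.

infixl 6 _||_
infixl 7 _&&_
infix  8 #_ ~_
infixl 5 _⊕_
infix  3 _≼_

data SetE : Set where
  #_        : ℕ → SetE
  ∅ᵉ 𝟙ᵉ     : SetE
  _||_ _&&_ : SetE → SetE → SetE
  ~_        : SetE → SetE

s0 s1 s2 s3 s4 s5 s6 s7 s8 s9 s10 s11 s12 : SetE
s0 = # 0
s1 = # 1
s2 = # 2
s3 = # 3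
s4 = # 4
s5 = # 5
s6 = # 6
s7 = # 7
s8 = # 8
s9 = # 9
s10 = # 10
s11 = # 11
s12 = # 12

data LinE : Set where
  rk  : SetE → LinE
  lit : ℕ → LinE
  _⊕_ : LinE → LinE → LinE

record Ineq : Set where
  constructor _≼_
  field lhs rhs : LinE
open Ineq

data Step : Set where
  hyp     : ℕ → Step
  sub mon : SetE → SetE → Step

-- Serves twice: as the memberships of one element in the given sets, and as the truth table of one
-- set expression over all such patterns.
Row : Set
Row = List Bool

at : Row → ℕ → Bool
at []       _       = false
at (b ∷ _)  zero    = b
at (_ ∷ bs) (suc k) = at bs k

evalB : SetE → Row → Bool
evalB (# k)    w = at w k
evalB ∅ᵉ       w = false
evalB 𝟙ᵉ       w = true
evalB (a || b) w = evalB a w ∨ evalB b w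
evalB (a && b) w = evalB a w ∧ evalB b w
evalB (~ a)    w = not (evalB a w)

rows : ℕ → List Row
rows zero    = [] ∷ []
rows (suc k) = map (true ∷_) (rows k) ++ map (false ∷_) (rows k)

∈-rows : ∀ w → w ∈ rows (length w)
∈-rows []          = here refl
∈-rows (true ∷ w)  = ∈-++⁺ˡ (∈-map⁺ (true ∷_) (∈-rows w))
∈-rows (false ∷ w) = ∈-++⁺ʳ (map (true ∷_) (rows (length w))) (∈-map⁺ (false ∷_) (∈-rows w))

_⇒ᵇ_ : Bool → Bool → Bool
true  ⇒ᵇ b = b
false ⇒ᵇ _ = true

⇒ᵇ-intro : ∀ {a b} → (T a → T b) → T (a ⇒ᵇ b)
⇒ᵇ-intro {true}  f = f tt
⇒ᵇ-intro {false} _ = tt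

⇒ᵇ-elim : ∀ {a b} → T (a ⇒ᵇ b) → T a → T b
⇒ᵇ-elim {true} p _ = p

Constraints : Set
Constraints = List (SetE × SetE)

allowed : Constraints → Row → Bool
allowed []             w = true
allowed ((a , b) ∷ cs) w = (evalB a w ⇒ᵇ evalB b w) ∧ allowed cs w

validRows : Constraints → ℕ → List Row
validRows cs k = filterᵇ (allowed cs) (rows k)

∈-filterᵇ : ∀ {A : Set} (p : A → Bool) {x xs} → x ∈ xs → T (p x) → x ∈ filterᵇ p xs
∈-filterᵇ p {x} (here refl) px with p x
... | true = here refl
∈-filterᵇ p {x} {y ∷ xs} (there x∈) px with p y
... | true  = there (∈-filterᵇ p x∈ px)
... | false = ∈-filterᵇ p x∈ px

table : List Row → SetE → Row
table ws a = map (evalB a) ws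

_⊑ᵇ_ : Row → Row → Bool
(a ∷ as) ⊑ᵇ (b ∷ bs) = (a ⇒ᵇ b) ∧ (as ⊑ᵇ bs)
-- Both arguments are tables over the same rows, so only two empty lists arrive here.
_        ⊑ᵇ _        = true

⊑-sound : ∀ ws a b → T (table ws a ⊑ᵇ table ws b) → ∀ {w} → w ∈ ws → T (evalB a w) → T (evalB b w)
⊑-sound (w ∷ ws) a b p (here refl) = ⇒ᵇ-elim (proj₁ (∧⁻ p))
⊑-sound (w ∷ ws) a b p (there w∈)  = ⊑-sound ws a b (proj₂ (∧⁻ {evalB a w ⇒ᵇ evalB b w} p)) w∈

Tabled : Set
Tabled = SetE × Row

remove : Tabled → List Tabled → Maybe (List Tabled)
remove t []       = nothing
remove t (u ∷ us) with (proj₂ t ⊑ᵇ proj₂ u) ∧ (proj₂ u ⊑ᵇ proj₂ t)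
... | true  = just us
... | false with remove t us
...   | just vs = just (u ∷ vs)
...   | nothing = nothing

covered : List Tabled → List Tabled → Bool
covered []       us = true
covered (t ∷ ts) us with all not (proj₂ t)
... | true  = covered ts us
... | false with remove t us
...   | just vs = covered ts vs
...   | nothing = false

const : LinE → ℕ
const (rk _)  = 0
const (lit c) = c
const (a ⊕ b) = const a + const b

ranks : LinE → List SetE
ranks (rk s)  = s ∷ []
ranks (lit _) = []
ranks (a ⊕ b) = ranks a ++ ranks b

lookupIneq : List Ineq → ℕ → Ineq
lookupIneq []       _       = lit 0 ≼ lit 0
lookupIneq (h ∷ _)  zero    = h
lookupIneq (_ ∷ hs) (suc k) = lookupIneq hs k

stepIneq : List Ineq → Step → Ineq
stepIneq hs (hyp k)   = lookupIneq hs k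
stepIneq hs (sub a b) = rk (a || b) ⊕ rk (a && b) ≼ rk a ⊕ rk b
stepIneq hs (mon a b) = rk a ≼ rk b

validStep : List Row → Step → Bool
validStep ws (hyp _)   = true
validStep ws (sub _ _) = true
validStep ws (mon a b) = table ws a ⊑ᵇ table ws b

sumAll : List Ineq → Ineq
sumAll []       = lit 0 ≼ lit 0
sumAll (h ∷ hs) = lhs h ⊕ lhs (sumAll hs) ≼ rhs h ⊕ rhs (sumAll hs)

-- Every hypothesis is counted once by `sumAll`; a step adds one more inequality, so coefficients
-- are expressed by repetition.
total : List Ineq → List Step → Ineq
total hs []       = sumAll hs
total hs (s ∷ ss) = lhs (stepIneq hs s) ⊕ lhs (total hs ss) ≼ rhs (stepIneq hs s) ⊕ rhs (total hs ss)

tabled : List Row → List SetE → List Tabled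
tabled ws = map (λ a → a , table ws a)

-- The inequality is impossible if each rank on its right is cancelled by one on its left and the
-- constant on the left is still larger.
contradictory : List Row → Ineq → Bool
contradictory ws (a ≼ b) = (const b <ᵇ const a) ∧ covered (tabled ws (ranks b)) (tabled ws (ranks a))

refutes : ℕ → Constraints → List Ineq → List Step → Bool
refutes k cs hs ss = let ws = validRows cs k in all (validStep ws) ss ∧ contradictory ws (total hs ss)

module _ {n : ℕ} where

  atS : List (P n) → ℕ → P n
  atS []      _       = ∅
  atS (X ∷ _) zero    = X
  atS (_ ∷ ρ) (suc k) = atS ρ k

  evalS : List (P n) → SetE → P n
  evalS ρ (# k)    = atS ρ k
  evalS ρ ∅ᵉ       = ∅
  evalS ρ 𝟙ᵉ       = 𝟙
  evalS ρ (a || b) = evalS ρ a ∪ evalS ρ b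
  evalS ρ (a && b) = evalS ρ a ∩ evalS ρ b
  evalS ρ (~ a)    = ∁ (evalS ρ a)

  Satisfied : List (P n) → Constraints → Set
  Satisfied ρ []             = ⊤
  Satisfied ρ ((a , b) ∷ cs) = evalS ρ a ⊆ evalS ρ b × Satisfied ρ cs

  rowAt : List (P n) → Fin n → Row
  rowAt ρ i = map (λ X → X i) ρ

  at-rowAt : ∀ ρ k i → at (rowAt ρ i) k ≡ atS ρ k i
  at-rowAt []      k       i = refl
  at-rowAt (X ∷ ρ) zero    i = refl
  at-rowAt (X ∷ ρ) (suc k) i = at-rowAt ρ k i

  evalB-rowAt : ∀ ρ a i → evalB a (rowAt ρ i) ≡ evalS ρ a i
  evalB-rowAt ρ (# k)    i = at-rowAt ρ k i
  evalB-rowAt ρ ∅ᵉ       i = refl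
  evalB-rowAt ρ 𝟙ᵉ       i = refl
  evalB-rowAt ρ (a || b) i = cong₂ _∨_ (evalB-rowAt ρ a i) (evalB-rowAt ρ b i)
  evalB-rowAt ρ (a && b) i = cong₂ _∧_ (evalB-rowAt ρ a i) (evalB-rowAt ρ b i)
  evalB-rowAt ρ (~ a)    i = cong not (evalB-rowAt ρ a i)

  rowAt-allowed : ∀ ρ cs → Satisfied ρ cs → ∀ i → T (allowed cs (rowAt ρ i))
  rowAt-allowed ρ []             _       i = tt
  rowAt-allowed ρ ((a , b) ∷ cs) (p , q) i = ∧⁺
    ( ⇒ᵇ-intro (λ t → subst T (sym (evalB-rowAt ρ b i)) (p i (subst T (evalB-rowAt ρ a i) t)))
    , rowAt-allowed ρ cs q i)

  -- The link between tables and sets: each element selects one allowed row, so whatever holds on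
  -- all allowed rows holds at every element.
  rowAt-valid : ∀ ρ cs → Satisfied ρ cs → ∀ i → rowAt ρ i ∈ validRows cs (length ρ)
  rowAt-valid ρ cs sat i = ∈-filterᵇ (allowed cs)
    (subst (λ k → rowAt ρ i ∈ rows k) (length-map ρ) (∈-rows (rowAt ρ i)))
    (rowAt-allowed ρ cs sat i)
    where
    length-map : ∀ ρ → length (rowAt ρ i) ≡ length ρ
    length-map []      = refl
    length-map (_ ∷ ρ) = cong suc (length-map ρ)

  module _ (ρ : List (P n)) (cs : Constraints) (sat : Satisfied ρ cs) where

    private ws = validRows cs (length ρ)

    ⊑⇒⊆ : ∀ a b → T (table ws a ⊑ᵇ table ws b) → evalS ρ a ⊆ evalS ρ b
    ⊑⇒⊆ a b p i t = subst T (evalB-rowAt ρ b i)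
      (⊑-sound ws a b p (rowAt-valid ρ cs sat i) (subst T (sym (evalB-rowAt ρ a i)) t))

    all-not⇒⊆∅ : ∀ a → T (all not (table ws a)) → evalS ρ a ⊆ ∅
    all-not⇒⊆∅ a p = ⊑⇒⊆ a ∅ᵉ (go ws p)
      where
      go : ∀ vs → T (all not (table vs a)) → T (table vs a ⊑ᵇ table vs ∅ᵉ)
      go []       _ = tt
      go (v ∷ vs) p with evalB a v
      ... | false = go vs p

    module _ (M : Mat n) where
      open Mat M

      value : LinE → ℕ
      value (rk s)  = r (evalS ρ s)
      value (lit c) = c
      value (a ⊕ b) = value a + value b

      Holds : Ineq → Set
      Holds (a ≼ b) = value a ≤ value b

      AllHold : List Ineq → Set
      AllHold []       = ⊤
      AllHold (h ∷ hs) = Holds h × AllHold hs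

      rankSum : List Tabled → ℕ
      rankSum []             = 0
      rankSum ((s , _) ∷ ts) = r (evalS ρ s) + rankSum ts

      rankSum-++ : ∀ xs ys → rankSum (tabled ws (xs ++ ys)) ≡ rankSum (tabled ws xs) + rankSum (tabled ws ys)
      rankSum-++ []       ys = refl
      rankSum-++ (x ∷ xs) ys = trans (cong (r (evalS ρ x) +_) (rankSum-++ xs ys)) (sym (+-assoc (r (evalS ρ x)) _ _))

      value-split : ∀ e → value e ≡ const e + rankSum (tabled ws (ranks e))
      value-split (rk s)  = sym (+-identityʳ _)
      value-split (lit c) = sym (+-identityʳ c)
      value-split (a ⊕ b) = trans (cong₂ _+_ (value-split a) (value-split b))
        (trans (interchange (const a) _ (const b) _)
               (cong (const a + const b +_) (sym (rankSum-++ (ranks a) (ranks b)))))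
        where
        interchange : ∀ a b c d → (a + b) + (c + d) ≡ (a + c) + (b + d)
        interchange a b c d = trans (+-assoc a b (c + d)) (trans (cong (a +_)
          (trans (sym (+-assoc b c d)) (trans (cong (_+ d) (+-comm b c)) (+-assoc c b d))))
          (sym (+-assoc a c (b + d))))

      ∈Tabled : Tabled → Set
      ∈Tabled (s , t) = t ≡ table ws s

      AllTabled : List Tabled → Set
      AllTabled []       = ⊤
      AllTabled (t ∷ ts) = ∈Tabled t × AllTabled ts

      allTabled : ∀ ss → AllTabled (tabled ws ss)
      allTabled []       = tt
      allTabled (s ∷ ss) = refl , allTabled ss

      remove-sound : ∀ t us vs → ∈Tabled t → AllTabled us → remove t us ≡ just vs →
                     AllTabled vs × r (evalS ρ (proj₁ t)) + rankSum vs ≤ rankSum us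
      remove-sound (s , t) ((u , t′) ∷ us) vs t-ok (u-ok , us-ok) eq
        with (t ⊑ᵇ t′) ∧ (t′ ⊑ᵇ t) in p
      remove-sound (s , t) ((u , t′) ∷ us) .us refl (refl , us-ok) refl | true =
        us-ok , +-monoˡ-≤ (rankSum us) (mono (⊑⇒⊆ s u (proj₁ (∧⁻ (≡⇒T p)))))
      ... | false with remove (s , t) us in q
      remove-sound (s , t) ((u , t′) ∷ us) ._ t-ok (u-ok , us-ok) refl | false | just vs
        with remove-sound (s , t) us vs t-ok us-ok q
      ... | vs-ok , le = (u-ok , vs-ok) , ≤-trans (≤-reflexive (swap (r (evalS ρ s)) (r (evalS ρ u)) _))
          (+-monoʳ-≤ (r (evalS ρ u)) le)
        where
        swap : ∀ a b c → a + (b + c) ≡ b + (a + c)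
        swap a b c = trans (sym (+-assoc a b c)) (trans (cong (_+ c) (+-comm a b)) (+-assoc b a c))

      covered-sound : ∀ ts us → AllTabled ts → AllTabled us → T (covered ts us) → rankSum ts ≤ rankSum us
      covered-sound []             us _ _ _ = z≤n
      covered-sound ((s , t) ∷ ts) us (refl , ts-ok) us-ok p with all not t in empty
      ... | true  = ≤-trans
        (+-monoˡ-≤ (rankSum ts) (≤-trans (mono (all-not⇒⊆∅ s (≡⇒T empty))) (≤-reflexive r∅)))
        (covered-sound ts us ts-ok us-ok p)
      ... | false with remove (s , t) us in q
      ...   | just vs with remove-sound (s , t) us vs refl us-ok q
      ...     | vs-ok , le = ≤-trans (+-monoʳ-≤ (r (evalS ρ s)) (covered-sound ts vs ts-ok vs-ok p)) le

      lookup-holds : ∀ hs k → AllHold hs → Holds (lookupIneq hs k)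
      lookup-holds []       k       _       = z≤n
      lookup-holds (h ∷ hs) zero    (p , _) = p
      lookup-holds (h ∷ hs) (suc k) (_ , q) = lookup-holds hs k q

      step-holds : ∀ hs s → AllHold hs → T (validStep ws s) → Holds (stepIneq hs s)
      step-holds hs (hyp k)   hs-hold _ = lookup-holds hs k hs-hold
      step-holds hs (sub a b) _       _ = submod (evalS ρ a) (evalS ρ b)
      step-holds hs (mon a b) _       p = mono (⊑⇒⊆ a b p)

      sumAll-holds : ∀ hs → AllHold hs → Holds (sumAll hs)
      sumAll-holds []       _       = z≤n
      sumAll-holds (h ∷ hs) (p , q) = +-mono-≤ p (sumAll-holds hs q)

      total-holds : ∀ hs ss → AllHold hs → T (all (validStep ws) ss) → Holds (total hs ss)
      total-holds hs []       hs-hold _ = sumAll-holds hs hs-hold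
      total-holds hs (s ∷ ss) hs-hold p = +-mono-≤
        (step-holds hs s hs-hold (proj₁ (∧⁻ p)))
        (total-holds hs ss hs-hold (proj₂ (∧⁻ {validStep ws s} p)))

      contradictory-sound : ∀ h → T (contradictory ws h) → ¬ Holds h
      contradictory-sound (a ≼ b) p h = <⇒≱
        (+-mono-<-≤ (<ᵇ⇒< (const b) (const a) (proj₁ (∧⁻ p)))
                    (covered-sound (tabled ws (ranks b)) (tabled ws (ranks a)) (allTabled (ranks b))
                        (allTabled (ranks a))
                       (proj₂ (∧⁻ {const b <ᵇ const a} p))))
        (≤-trans (≤-reflexive (sym (value-split a))) (≤-trans h (≤-reflexive (value-split b))))

      refutes-sound : ∀ hs ss → T (refutes (length ρ) cs hs ss) → ¬ AllHold hs
      refutes-sound hs ss p hs-hold = contradictory-sound (total hs ss)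
        (proj₂ (∧⁻ {all (validStep ws) ss} p))
        (total-holds hs ss hs-hold (proj₁ (∧⁻ p)))

  ⊆-by : (ρ : List (P n)) (cs : Constraints) (a b : SetE) →
         (table (validRows cs (length ρ)) a ⊑ᵇ table (validRows cs (length ρ)) b) ≡ true →
         Satisfied ρ cs → evalS ρ a ⊆ evalS ρ b
  ⊆-by ρ cs a b p sat = ⊑⇒⊆ ρ cs sat a b (≡⇒T p)

  ≐-by : (ρ : List (P n)) (cs : Constraints) (a b : SetE) →
         (table (validRows cs (length ρ)) a ⊑ᵇ table (validRows cs (length ρ)) b) ∧
         (table (validRows cs (length ρ)) b ⊑ᵇ table (validRows cs (length ρ)) a) ≡ true →
         Satisfied ρ cs → evalS ρ a ≐ evalS ρ b
  ≐-by ρ cs a b p sat = ⊑⇒⊆ ρ cs sat a b (proj₁ both) , ⊑⇒⊆ ρ cs sat b a (proj₂ both)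
    where
    ws   = validRows cs (length ρ)
    both = ∧⁻ {table ws a ⊑ᵇ table ws b} (≡⇒T p)

  -- The certificate `ss` is checked once and for all by computation, hence the `refl` at every use;
  -- only the inclusions `sat` and the hypotheses are proved on the spot. Over the naturals the
  -- negated goal reads `1 + rhs ≤ lhs`.
  ≤-by : (M : Mat n) (ρ : List (P n)) (cs : Constraints) (hs : List Ineq) (g : Ineq) (ss : List Step) →
         refutes (length ρ) cs ((lit 1 ⊕ rhs g ≼ lhs g) ∷ hs) ss ≡ true →
         (sat : Satisfied ρ cs) → AllHold ρ cs sat M hs → Holds ρ cs sat M g
  ≤-by M ρ cs hs g ss p sat hs-hold = ≮⇒≥ (λ g-fails →
    refutes-sound ρ cs sat M _ ss (≡⇒T p) (g-fails , hs-hold))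

-- Induction over sets and exact truncated subtraction

≗⇒≐ : ∀ {n} {X Y : P n} → (∀ i → X i ≡ Y i) → X ≐ Y
≗⇒≐ eq = (λ i → subst T (eq i)) , (λ i → subst T (sym (eq i)))

∈-set : ∀ {n} {X : P n} {x} → ⁅ x ⁆ ⊆ X → T (X x)
∈-set {x = x} p = p x (∈-⁅⁆ x)

cons : ∀ {n} → Bool → P n → P (suc n)
cons b X Fin.zero    = b
cons b X (Fin.suc i) = X i

cons-≐ : ∀ {n b} {X : P n} {Y : P (suc n)} → b ≡ Y Fin.zero → X ≐ Y ∘ Fin.suc → cons b X ≐ Y
cons-≐ refl (p , q) = (λ { Fin.zero t → t ; (Fin.suc i) → p i }) , (λ { Fin.zero t → t ; (Fin.suc i) → q i })

-- By induction on `n`: the positive elements are inserted first, zero last. `Q` must respect `≐`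
-- because a set assembled by insertions agrees with `S` only pointwise. The insertion step covers
-- elements already present, so its users split on membership.
set-induction : ∀ {n} (Q : P n → Set) → (∀ {X Y} → X ≐ Y → Q X → Q Y) →
                Q ∅ → (∀ S z → Q S → Q (S ∪ ⁅ z ⁆)) → ∀ S → Q S
set-induction {zero}  Q resp base ins S = resp ((λ ()) , (λ ())) base
set-induction {suc n} Q resp base ins S = add (S Fin.zero) refl
  (set-induction (Q ∘ cons false) (λ eq → resp (cons-≐ refl eq))
    (resp (≗⇒≐ λ { Fin.zero → refl ; (Fin.suc i) → refl }) base)
    (λ X z q → resp (≗⇒≐ λ { Fin.zero → refl ; (Fin.suc i) → cong (X i ∨_) (does-suc z i) }) (ins (cons false
        X) (Fin.suc z) q))
    (S ∘ Fin.suc))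
  where
  add : ∀ b → S Fin.zero ≡ b → Q (cons false (S ∘ Fin.suc)) → Q S
  add false eq q = resp (cons-≐ (sym eq) ((λ _ t → t) , (λ _ t → t))) q
  add true  eq q = resp (≗⇒≐ λ { Fin.zero → sym eq ; (Fin.suc i) → ∨-identityʳ (S (Fin.suc i)) }) (ins _ Fin.zero q)

∅⊆ : ∀ {n} (X : P n) → ∅ ⊆ X
∅⊆ X _ ()

⊆𝟙 : ∀ {n} (X : P n) → X ⊆ 𝟙
⊆𝟙 X _ _ = tt

⊆-refl : ∀ {n} (X : P n) → X ⊆ X
⊆-refl X _ t = t

⊆-trans : ∀ {n} {X Y Z : P n} → X ⊆ Y → Y ⊆ Z → X ⊆ Z
⊆-trans p q i t = q i (p i t)

≐-refl : ∀ {n} {X : P n} → X ≐ X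
≐-refl = (λ _ t → t) , (λ _ t → t)

≐-sym : ∀ {n} {X Y : P n} → X ≐ Y → Y ≐ X
≐-sym (p , q) = q , p

≐-trans : ∀ {n} {X Y Z : P n} → X ≐ Y → Y ≐ Z → X ≐ Z
≐-trans (p , q) (p′ , q′) = (λ i t → p′ i (p i t)) , (λ i t → q i (q′ i t))

-- Nothing is truncated, so adding `k + k` turns an inequality between ranks of a contraction into
-- one between ranks of the original matroid.
∸-sum : ∀ {k x y} → k ≤ x → k ≤ y → (x ∸ k) + (y ∸ k) + (k + k) ≡ x + y
∸-sum {k} {x} {y} kx ky = trans (interchange (x ∸ k) (y ∸ k) k) (cong₂ _+_ (m∸n+n≡m kx) (m∸n+n≡m ky))
  where
  interchange : ∀ p q k → p + q + (k + k) ≡ (p + k) + (q + k)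
  interchange = solve-∀

∸-submod : ∀ {a b c d k} → k ≤ a → k ≤ b → k ≤ c → k ≤ d → a + b ≤ c + d → (a ∸ k) + (b ∸ k) ≤ (c ∸ k) + (d ∸ k)
∸-submod {k = k} ka kb kc kd le = +-cancelʳ-≤ (k + k) _ _
  (≤-trans (≤-reflexive (∸-sum ka kb)) (≤-trans le (≤-reflexive (sym (∸-sum kc kd)))))

∸-narrow : ∀ {a b c k} → k ≤ a → k ≤ b → k ≤ c → (a ∸ k) + (b ∸ k) ≤ 1 + (c ∸ k) → a + b ≤ 1 + (c + k)
∸-narrow {c = c} {k} ka kb kc le = ≤-trans (≤-reflexive (sym (∸-sum ka kb)))
  (≤-trans (+-monoˡ-≤ (k + k) le) (≤-reflexive (cong suc (trans (sym (+-assoc (c ∸ k) k k)) (cong (_+ k)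
      (m∸n+n≡m kc))))))

∪-mono₂ : ∀ {n} {X X′ Y Y′ : P n} → X ⊆ X′ → Y ⊆ Y′ → X ∪ Y ⊆ X′ ∪ Y′
∪-mono₂ {X = X} {X′} {Y} {Y′} p q = ⊆-by (X ∷ X′ ∷ Y ∷ Y′ ∷ []) ((s0 , s1) ∷ (s2 , s3) ∷ []) (s0 || s2) (s1
    || s3) refl (p , q , tt)

card-≐ : ∀ {n} {X Y : P n} → X ≐ Y → card X ≡ card Y
card-≐ (p , q) = ≤-antisym (card-mono p) (card-mono q)

card-∖ : ∀ {n} (X Y : P n) → X ⊆ Y → card X + card (Y ∖ X) ≡ card Y
card-∖ {n} X Y X⊆Y = trans (sym (card-modular X (Y ∖ X))) (trans
  (cong₂ _+_
    (card-≐ (≐-by (X ∷ Y ∷ []) ((s0 , s1) ∷ []) (s0 || s1 && ~ s0) s1 refl (X⊆Y , tt)))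
    (trans (card-≐ {Y = ∅} (≐-by (X ∷ Y ∷ []) [] (s0 && (s1 && ~ s0)) ∅ᵉ refl tt)) (card-∅ {n})))
  (+-identityʳ (card Y)))

∪-congˡ : ∀ {n} {X Y : P n} Z → X ≐ Y → X ∪ Z ≐ Y ∪ Z
∪-congˡ {X = X} {Y} Z (p , q) =
  ≐-by (X ∷ Y ∷ Z ∷ []) ((s0 , s1) ∷ (s1 , s0) ∷ []) (s0 || s2) (s1 || s2) refl (p , q , tt)

∁-cong : ∀ {n} {X Y : P n} → X ≐ Y → ∁ X ≐ ∁ Y
∁-cong {X = X} {Y} (p , q) = ≐-by (X ∷ Y ∷ []) ((s1 , s0) ∷ (s0 , s1) ∷ []) (~ s0) (~ s1) refl (q , p , tt)

card-∁ : ∀ {n} (X : P n) → card X + card (∁ X) ≡ card (𝟙 {n})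
card-∁ X = trans (cong (card X +_) (card-≐ (≐-by (X ∷ []) [] (~ s0) (𝟙ᵉ && ~ s0) refl tt))) (card-∖ X 𝟙 (⊆𝟙 X))

-- Restriction, contraction, duality and separators

module _ {n : ℕ} (M : Mat n) where
  open Mat M

  r-cong : ∀ {X Y} → X ≐ Y → r X ≡ r Y
  r-cong (p , q) = ≤-antisym (mono p) (mono q)

  -- Deleted and contracted elements stay in the ground set, as loops.
  restrict : P n → Mat n
  restrict A = record
    { r      = λ X → r (X ∩ A)
    ; r≤card = λ X → ≤-trans (r≤card (X ∩ A)) (card-mono (⊆-by (X ∷ A ∷ []) [] (s0 && s1) s0 refl tt))
    ; mono   = λ {X} {Y} X⊆Y → mono (⊆-by (X ∷ Y ∷ A ∷ []) ((s0 , s1) ∷ []) (s0 && s2) (s1 && s2) refl (X⊆Y , tt))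
    ; submod = λ X Y → (≤-by M (X ∷ Y ∷ A ∷ []) [] []
      (rk ((s0 || s1) && s2) ⊕ rk (s0 && s1 && s2) ≼ rk (s0 && s2) ⊕ rk (s1 && s2))
      (sub (s0 && s2) (s1 && s2) ∷ []) refl tt tt)
    }

  contract : P n → Mat n
  contract C = record
    { r      = λ X → r (X ∪ C) ∸ r C
    ; r≤card = λ X → ≤-trans (m≤n+o⇒m∸n≤o _ (r C) (≤-by M (X ∷ C ∷ []) [] [] (rk (s0 || s1) ≼ rk s1 ⊕ rk s0)
      (sub s1 s0 ∷ []) refl tt tt)) (r≤card X)
    ; mono   = λ {X} {Y} X⊆Y → ∸-monoˡ-≤ (r C) (mono (⊆-by (X ∷ Y ∷ C ∷ []) ((s0 , s1) ∷ []) (s0 || s2) (s1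
        || s2) refl (X⊆Y , tt)))
    ; submod = λ X Y → ∸-submod (C≤ (X ∪ Y)) (C≤ (X ∩ Y)) (C≤ X) (C≤ Y)
        (≤-by M (X ∷ Y ∷ C ∷ []) [] []
          (rk (s0 || s1 || s2) ⊕ rk (s0 && s1 || s2) ≼ rk (s0 || s2) ⊕ rk (s1 || s2))
          (sub (s0 || s2) (s1 || s2) ∷ []) refl tt tt)
    }
    where
    C≤ : ∀ X → r C ≤ r (X ∪ C)
    C≤ X = ≤-by M (X ∷ C ∷ []) [] [] (rk s1 ≼ rk (s0 || s1)) (mon s1 (s0 || s1) ∷ []) refl tt tt

  -- Makes the subtraction in the dual rank exact.
  r𝟙≤card+r∁ : ∀ X → r 𝟙 ≤ card X + r (∁ X)
  r𝟙≤card+r∁ X = ≤-trans (≤-by M (X ∷ []) [] [] (rk 𝟙ᵉ ≼ rk s0 ⊕ rk (~ s0)) (sub s0 (~ s0) ∷ []) refl tt tt)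
      (+-monoˡ-≤ (r (∁ X)) (r≤card X))

  dualMat : Mat n
  dualMat = record
    { r      = λ X → card X + r (∁ X) ∸ r 𝟙
    ; r≤card = λ X → m≤n+o⇒m∸n≤o _ (r 𝟙) (≤-trans (+-monoʳ-≤ (card X) (mono (⊆𝟙 (∁ X)))) (≤-reflexive (+-comm
        (card X) (r 𝟙))))
    ; mono   = λ {X} {Y} X⊆Y → ∸-monoˡ-≤ (r 𝟙) (dual-mono X Y X⊆Y)
    ; submod = λ X Y → ∸-submod (r𝟙≤card+r∁ (X ∪ Y)) (r𝟙≤card+r∁ (X ∩ Y)) (r𝟙≤card+r∁ X) (r𝟙≤card+r∁ Y)
        (≤-trans (≤-reflexive (interchange (card (X ∪ Y)) _ _ _))
          (≤-trans (+-mono-≤ (≤-reflexive (card-modular X Y)) (≤-by M (X ∷ Y ∷ []) [] []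
            (rk (~ (s0 || s1)) ⊕ rk (~ (s0 && s1)) ≼ rk (~ s0) ⊕ rk (~ s1)) (sub (~ s0) (~ s1) ∷ []) refl tt
            tt))
            (≤-reflexive (interchange (card X) (card Y) _ _))))
    }
    where
    interchange : ∀ a b c d → a + b + (c + d) ≡ a + c + (b + d)
    interchange = solve-∀
    dual-mono : ∀ X Y → X ⊆ Y → card X + r (∁ X) ≤ card Y + r (∁ Y)
    dual-mono X Y X⊆Y = ≤-trans
      (+-monoʳ-≤ (card X) (≤-trans (≤-by M (X ∷ Y ∷ []) [] [] (rk (~ s0) ≼ rk (s1 && ~ s0) ⊕ rk (~ s1))
        (mon (~ s0) (~ s0 || ~ s1) ∷ sub (s1 && ~ s0) (~ s1) ∷ []) refl tt tt) (+-monoˡ-≤ (r (∁ Y)) (r≤card (Y ∖ X)))))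
      (≤-reflexive (trans (sym (+-assoc (card X) _ _)) (cong (_+ r (∁ Y)) (card-∖ X Y X⊆Y))))

  dual-rank : ∀ X → Mat.r dualMat X + r 𝟙 ≡ card X + r (∁ X)
  dual-rank X = m∸n+n≡m (r𝟙≤card+r∁ X)

  -- This is λ(X) ≤ 1 with the subtraction moved across, the form that the checker accepts.
  Narrow : P n → Set
  Narrow X = r X + r (∁ X) ≤ 1 + r 𝟙

  Narrow-resp : ∀ {X Y} → X ≐ Y → Narrow X → Narrow Y
  Narrow-resp {X} {Y} (p , q) h = ≤-by M (X ∷ Y ∷ []) ((s0 , s1) ∷ (s1 , s0) ∷ [])
    ((rk s0 ⊕ rk (~ s0) ≼ lit 1 ⊕ rk 𝟙ᵉ) ∷ []) (rk s1 ⊕ rk (~ s1) ≼ lit 1 ⊕ rk 𝟙ᵉ) [] refl (p , q , tt)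
    (h , tt)

  -- Neither a loop nor a coloop. Since minors keep the ground set `Fin n`, the number of active
  -- elements serves as the size of a matroid in the construction of orderings.
  Active : Fin n → Set
  Active x = 1 ≤ r ⁅ x ⁆ × r 𝟙 ≤ r (∁ ⁅ x ⁆)

  Active? : ∀ x → Dec (Active x)
  Active? x = (1 ≤? r ⁅ x ⁆) ×-dec (r 𝟙 ≤? r (∁ ⁅ x ⁆))

  inactive-split : ∀ {x} → ¬ Active x → r ⁅ x ⁆ ≤ 0 ⊎ r (∁ ⁅ x ⁆) < r 𝟙
  inactive-split {x} ¬a with 1 ≤? r ⁅ x ⁆ | r 𝟙 ≤? r (∁ ⁅ x ⁆)
  ... | no  ¬l | _      = inj₁ (≤-pred (≰⇒> ¬l))
  ... | yes _  | no ¬c  = inj₂ (≰⇒> ¬c)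
  ... | yes l  | yes c  = ⊥-elim (¬a (l , c))

  -- A loop changes no rank, and a coloop carries one unit of rank from the complement into the set;
  -- so λ remains 0 while `J` is built up.
  inactive-separator : ∀ J → (∀ {x} → T (J x) → ¬ Active x) → r J + r (∁ J) ≤ r 𝟙
  inactive-separator J inactive = set-induction (λ S → S ⊆ J → r S + r (∁ S) ≤ r 𝟙)
    (λ { {X} {Y} (p , q) h Y⊆J → let hX = h (⊆-trans p Y⊆J) in
         (≤-by M (X ∷ Y ∷ []) ((s0 , s1) ∷ (s1 , s0) ∷ []) ((rk s0 ⊕ rk (~ s0) ≼ rk 𝟙ᵉ) ∷ [])
           (rk s1 ⊕ rk (~ s1) ≼ rk 𝟙ᵉ) [] refl (p , q , tt) (hX , tt)) })
    (λ _ → (≤-by M [] [] [] (rk ∅ᵉ ⊕ rk (~ ∅ᵉ) ≼ rk 𝟙ᵉ) [] refl tt tt))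
    insert J (⊆-refl J)
    where
    insert : ∀ S z → (S ⊆ J → r S + r (∁ S) ≤ r 𝟙) → S ∪ ⁅ z ⁆ ⊆ J → r (S ∪ ⁅ z ⁆) + r (∁ (S ∪ ⁅ z ⁆)) ≤ r 𝟙
    insert S z ih S∪z⊆J with ih (⊆-trans (⊆-by (S ∷ ⁅ z ⁆ ∷ []) [] s0 (s0 || s1) refl tt) S∪z⊆J) | T? (S z)
    ... | h | yes z∈S = ≤-by M (S ∷ ⁅ z ⁆ ∷ []) ((s1 , s0) ∷ []) ((rk s0 ⊕ rk (~ s0) ≼ rk 𝟙ᵉ) ∷ [])
      (rk (s0 || s1) ⊕ rk (~ (s0 || s1)) ≼ rk 𝟙ᵉ) [] refl (⁅⁆-⊆ S z∈S , tt) (h , tt)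
    ... | h | no  z∉S with inactive-split (inactive (S∪z⊆J z (∨⁺ {S z} (inj₂ (∈-⁅⁆ z)))))
    ...   | inj₁ loop = ≤-by M (S ∷ ⁅ z ⁆ ∷ []) [] ((rk s1 ≼ lit 0) ∷ (rk s0 ⊕ rk (~ s0) ≼ rk 𝟙ᵉ) ∷ [])
      (rk (s0 || s1) ⊕ rk (~ (s0 || s1)) ≼ rk 𝟙ᵉ) (sub s1 s0 ∷ mon (~ (s0 || s1)) (~ s0) ∷ []) refl tt
      (loop , h , tt)
    ...   | inj₂ coloop = ≤-by M (S ∷ ⁅ z ⁆ ∷ []) ((s1 , ~ s0) ∷ []) ((lit 1 ⊕ rk (~ s1) ≼ rk 𝟙ᵉ) ∷
      (rk s0 ⊕ rk (~ s0) ≼ rk 𝟙ᵉ) ∷ (rk s1 ≼ lit 1) ∷ []) (rk (s0 || s1) ⊕ rk (~ (s0 || s1)) ≼ rk 𝟙ᵉ)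
      (sub (~ s1) (~ s0) ∷ sub s0 s1 ∷ []) refl (⁅⁆-⊆∁ S z∉S , tt) (coloop , h , Mat.r1 M z , tt)

  closed-under : ∀ K S → (∀ {s} → T (S s) → r (K ∪ ⁅ s ⁆) ≤ r K) → r (K ∪ S) ≤ r K
  closed-under K S closed = set-induction (λ X → X ⊆ S → r (K ∪ X) ≤ r K)
    (λ { {X} {Y} (p , q) h Y⊆S → let hX = h (⊆-trans p Y⊆S) in
         (≤-by M (X ∷ Y ∷ K ∷ []) ((s0 , s1) ∷ (s1 , s0) ∷ []) ((rk (s2 || s0) ≼ rk s2) ∷ [])
           (rk (s2 || s1) ≼ rk s2) [] refl (p , q , tt) (hX , tt)) })
    (λ _ → (≤-by M (K ∷ []) [] [] (rk (s0 || ∅ᵉ) ≼ rk s0) [] refl tt tt))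
    (λ X z ih X∪z⊆S → let
        h = ih (⊆-trans (⊆-by (X ∷ ⁅ z ⁆ ∷ []) [] s0 (s0 || s1) refl tt) X∪z⊆S)
        hz = closed (X∪z⊆S z (∨⁺ {X z} (inj₂ (∈-⁅⁆ z))))
      in (≤-by M (K ∷ X ∷ ⁅ z ⁆ ∷ []) [] ((rk (s0 || s1) ≼ rk s0) ∷ (rk (s0 || s2) ≼ rk s0) ∷ [])
        (rk (s0 || (s1 || s2)) ≼ rk s0) (sub (s0 || s1) (s0 || s2) ∷ mon s0 ((s0 || s1) && (s0 || s2)) ∷ [])
        refl tt (h , hz , tt)))
    S (⊆-refl S)

  -- Greedy choice: an element is taken unless it would make `f` spanned. An element once rejected
  -- stays rejected when `K` grows, so one pass suffices. By exchange the rejected elements are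
  -- parallel to `f` after contraction of `K ∪ Y`.
  maximal-avoiding : ∀ f Y K₀ S → r (K₀ ∪ Y) < r (K₀ ∪ Y ∪ ⁅ f ⁆) →
    ∃ λ K → K₀ ⊆ K × K ⊆ K₀ ∪ S × r (K ∪ Y) < r (K ∪ Y ∪ ⁅ f ⁆) ×
            (∀ {s} → T (S s) → ¬ T (K s) → r (K ∪ ⁅ s ⁆ ∪ Y ∪ ⁅ f ⁆) ≤ r (K ∪ ⁅ s ⁆ ∪ Y))
  maximal-avoiding f Y K₀ S base = set-induction Q resp
    (K₀ , ⊆-refl K₀ , (⊆-by (K₀ ∷ []) [] s0 (s0 || ∅ᵉ) refl tt) , base , λ ()) insert S
    where
    Q : P n → Set
    Q S = ∃ λ K → K₀ ⊆ K × K ⊆ K₀ ∪ S × r (K ∪ Y) < r (K ∪ Y ∪ ⁅ f ⁆) ×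
            (∀ {s} → T (S s) → ¬ T (K s) → r (K ∪ ⁅ s ⁆ ∪ Y ∪ ⁅ f ⁆) ≤ r (K ∪ ⁅ s ⁆ ∪ Y))
    resp : ∀ {S S′} → S ≐ S′ → Q S → Q S′
    resp {S} {S′} (p , q) (K , K₀⊆K , K⊆ , avoids , max) =
      K , K₀⊆K , (⊆-by (S ∷ S′ ∷ K ∷ K₀ ∷ []) ((s0 , s1) ∷ (s2 , s3 || s0) ∷ []) s2 (s3 || s1) refl (p , K⊆ ,
          tt)) , avoids , λ s∈ → max (q _ s∈)
    insert : ∀ S z → Q S → Q (S ∪ ⁅ z ⁆)
    insert S z (K , K₀⊆K , K⊆ , avoids , max) with r (K ∪ ⁅ z ⁆ ∪ Y) <? r (K ∪ ⁅ z ⁆ ∪ Y ∪ ⁅ f ⁆)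
    ... | yes avoids′ = K ∪ ⁅ z ⁆ , ⊆-trans K₀⊆K (⊆-by (K ∷ ⁅ z ⁆ ∷ []) [] s0 (s0 || s1) refl tt)
        , (⊆-by (K ∷ K₀ ∷ S ∷ ⁅ z ⁆ ∷ []) ((s0 , s1 || s2) ∷ []) (s0 || s3) (s1 || (s2 || s3)) refl (K⊆ ,
            tt)) , avoids′ , max′
      where
      max′ : ∀ {s} → T ((S ∪ ⁅ z ⁆) s) → ¬ T ((K ∪ ⁅ z ⁆) s) → r (K ∪ ⁅ z ⁆ ∪ ⁅ s ⁆ ∪ Y ∪ ⁅ f ⁆) ≤ r (K ∪ ⁅ z
          ⁆ ∪ ⁅ s ⁆ ∪ Y)
      max′ {s} s∈ s∉ with ∨⁻ {S s} s∈
      ... | inj₂ s≡z = ⊥-elim (s∉ (∨⁺ {K s} (inj₂ s≡z)))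
      ... | inj₁ s∈S with max s∈S (λ s∈K → s∉ (∨⁺ {K s} (inj₁ s∈K)))
      ...   | h = ≤-by M (K ∷ Y ∷ ⁅ z ⁆ ∷ ⁅ s ⁆ ∷ ⁅ f ⁆ ∷ []) []
        ((rk (s0 || s3 || s1 || s4) ≼ rk (s0 || s3 || s1)) ∷ [])
        (rk (s0 || s2 || s3 || s1 || s4) ≼ rk (s0 || s2 || s3 || s1))
        (sub (s0 || s3 || s1 || s4) (s0 || s2 || s3 || s1) ∷
        mon (s0 || s3 || s1) ((s0 || s3 || s1 || s4) && (s0 || s2 || s3 || s1)) ∷ []) refl tt (h , tt)
    ... | no spans = K , K₀⊆K , ⊆-trans K⊆ (⊆-by (K₀ ∷ S ∷ ⁅ z ⁆ ∷ []) [] (s0 || s1) (s0 || (s1 || s2)) refl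
        tt) , avoids , max′
      where
      max′ : ∀ {s} → T ((S ∪ ⁅ z ⁆) s) → ¬ T (K s) → r (K ∪ ⁅ s ⁆ ∪ Y ∪ ⁅ f ⁆) ≤ r (K ∪ ⁅ s ⁆ ∪ Y)
      max′ {s} s∈ s∉ with ∨⁻ {S s} s∈
      ... | inj₁ s∈S = max s∈S s∉
      ... | inj₂ z≡s with toWitness z≡s
      ...   | refl = ≮⇒≥ spans

-- Narrow orderings and parallel elements

-- The part of an ordering that leads from one set to another, with `L` at each set reached. The
-- added element may already be present; such idle steps are what deletions leave behind, and
-- `path⇒order` removes them.
data Path {n} (L : P n → Set) : P n → P n → Set where
  done : ∀ {X Y} → X ≐ Y → Path L X Y
  add : ∀ {X Y} z → L (X ∪ ⁅ z ⁆) → Path L (X ∪ ⁅ z ⁆) Y → Path L X Y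

Resp : ∀ {n} → (P n → Set) → Set
Resp L = ∀ {X Y} → X ≐ Y → L X → L Y

module _ {n : ℕ} {L : P n → Set} (resp : Resp L) where

  path-congˡ : ∀ {X Y Z} → X ≐ Y → Path L X Z → Path L Y Z
  path-congˡ eq (done eq′)   = done (≐-trans (≐-sym eq) eq′)
  path-congˡ eq (add z l p) = add z (resp (∪-congˡ ⁅ z ⁆ eq) l) (path-congˡ (∪-congˡ ⁅ z ⁆ eq) p)

  infixr 5 _▷_
  _▷_ : ∀ {X Y Z} → Path L X Y → Path L Y Z → Path L X Z
  done eq    ▷ q = path-congˡ (≐-sym eq) q
  add z l p ▷ q = add z l (p ▷ q)

  path-congʳ : ∀ {X Y Z} → Y ≐ Z → Path L X Y → Path L X Z
  path-congʳ eq p = p ▷ done eq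

  one-step : ∀ {X Y} z → X ∪ ⁅ z ⁆ ≐ Y → L Y → Path L X Y
  one-step z eq l = add z (resp (≐-sym eq) l) (done eq)

  -- Meant for sets of loops and coloops, where the order of insertion is irrelevant and none has to
  -- be chosen.
  any-order : ∀ W X → (∀ S → S ⊆ X → L (W ∪ S)) → Path L W (W ∪ X)
  any-order W X narrow = set-induction (λ S → S ⊆ X → Path L W (W ∪ S))
    (λ { {S} {S′} (p , q) h S′⊆X → path-congʳ
           (≐-by (W ∷ S ∷ S′ ∷ []) ((s1 , s2) ∷ (s2 , s1) ∷ []) (s0 || s1) (s0 || s2) refl (p , q , tt))
           (h (⊆-trans p S′⊆X)) })
    (λ _ → done (≐-by (W ∷ []) [] s0 (s0 || ∅ᵉ) refl tt))
    (λ S z ih S∪z⊆X → ih (⊆-trans (⊆-by (S ∷ ⁅ z ⁆ ∷ []) [] s0 (s0 || s1) refl tt) S∪z⊆X) ▷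
      one-step z (≐-by (W ∷ S ∷ ⁅ z ⁆ ∷ []) [] (s0 || s1 || s2) (s0 || (s1 || s2)) refl tt)
        (narrow (S ∪ ⁅ z ⁆) S∪z⊆X))
    X (⊆-refl X)

-- A step is sent to a path, not to a step, because `G` may swallow the new element.
map-path : ∀ {n} {L L′ : P n → Set} (G : P n → P n) → Resp L′ → (∀ {X Y} → X ≐ Y → G X ≐ G Y) →
           (∀ X z → L (X ∪ ⁅ z ⁆) → Path L′ (G X) (G (X ∪ ⁅ z ⁆))) →
           ∀ {X Y} → Path L X Y → Path L′ (G X) (G Y)
map-path G resp G-cong G-step (done eq) = done (G-cong eq)
map-path G resp G-cong G-step {X} (add z l p) = _▷_ resp (G-step X z l) (map-path G resp G-cong G-step p)

module _ {n : ℕ} (M : Mat n) where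
  open Mat M

  private
    resp : Resp (Narrow M)
    resp {X} {Y} = Narrow-resp M

  -- Each half runs through all of `𝟙`, the other side consisting of loops. Intersecting with `A`
  -- discards these; in the second half `A` is already complete and, having λ(A) = 0, adds nothing
  -- to the width.
  path-separated : ∀ A → r A + r (∁ A) ≤ r 𝟙 →
    Path (Narrow (restrict M A)) ∅ 𝟙 → Path (Narrow (restrict M (∁ A))) ∅ 𝟙 → Path (Narrow M) ∅ 𝟙
  path-separated A sep pA pB =
    _▷_ resp (path-congˡ resp (≐-by (A ∷ []) [] (∅ᵉ && s0) ∅ᵉ refl tt)
      (path-congʳ resp (≐-by (A ∷ []) [] (𝟙ᵉ && s0) (s0 || ∅ᵉ) refl tt)
        (map-path (_∩ A) resp (λ { {X} {Y} (p , q) → (≐-by (X ∷ Y ∷ A ∷ []) ((s0 , s1) ∷ (s1 , s0) ∷ []) (s0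
            && s2) (s1 && s2) refl (p , q , tt)) })
          stepA pA)))
      (path-congʳ resp (⊆𝟙 _ , (⊆-by (A ∷ []) [] 𝟙ᵉ (s0 || 𝟙ᵉ) refl tt))
        (map-path (A ∪_) resp (λ { {X} {Y} (p , q) → (≐-by (X ∷ Y ∷ A ∷ []) ((s0 , s1) ∷ (s1 , s0) ∷ []) (s2
            || s0) (s2 || s1) refl (p , q , tt)) })
          stepB pB))
    where
    stepA : ∀ X z → Narrow (restrict M A) (X ∪ ⁅ z ⁆) → Path (Narrow M) (X ∩ A) ((X ∪ ⁅ z ⁆) ∩ A)
    stepA X z l with T? (A z)
    ... | yes z∈A = one-step resp z
            (≐-by (X ∷ A ∷ ⁅ z ⁆ ∷ []) ((s2 , s1) ∷ []) (s0 && s1 || s2) ((s0 || s2) && s1) refl (⁅⁆-⊆ A z∈A , tt))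
            (≤-by M (A ∷ (X ∪ ⁅ z ⁆) ∷ []) [] ((rk s0 ⊕ rk (~ s0) ≼ rk 𝟙ᵉ) ∷
              (rk (s1 && s0) ⊕ rk (~ s1 && s0) ≼ lit 1 ⊕ rk (𝟙ᵉ && s0)) ∷ [])
              (rk (s1 && s0) ⊕ rk (~ (s1 && s0)) ≼ lit 1 ⊕ rk 𝟙ᵉ) (sub (~ s0) (~ s1 && s0) ∷ []) refl tt
              (sep , l , tt))
    ... | no  z∉A = done (≐-by (X ∷ A ∷ ⁅ z ⁆ ∷ []) ((s2 , ~ s1) ∷ []) (s0 && s1) ((s0 || s2) && s1) refl
        (⁅⁆-⊆∁ A z∉A , tt))
    stepB : ∀ X z → Narrow (restrict M (∁ A)) (X ∪ ⁅ z ⁆) → Path (Narrow M) (A ∪ X) (A ∪ (X ∪ ⁅ z ⁆))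
    stepB X z l = one-step resp z
      (≐-by (X ∷ A ∷ ⁅ z ⁆ ∷ []) [] (s1 || s0 || s2) (s1 || (s0 || s2)) refl tt)
      (≤-by M (A ∷ (X ∪ ⁅ z ⁆) ∷ []) [] ((rk s0 ⊕ rk (~ s0) ≼ rk 𝟙ᵉ) ∷
        (rk (s1 && ~ s0) ⊕ rk (~ s1 && ~ s0) ≼ lit 1 ⊕ rk (𝟙ᵉ && ~ s0)) ∷ [])
        (rk (s0 || s1) ⊕ rk (~ (s0 || s1)) ≼ lit 1 ⊕ rk 𝟙ᵉ) (sub s0 (s1 && ~ s0) ∷ []) refl tt
        (sep , l , tt))

  -- Loops and coloops always split off, and minors here are full of loops, so a separator is only
  -- forbidden to divide the active elements.
  Connected : Set
  Connected = ∀ A → r A + r (∁ A) ≤ r 𝟙 → ∀ {u v} → Active M u → Active M v → T (A u) → T (A v)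

  -- Contracting `K` makes `a` and `b` parallel when `X` and `Y` are skew. One cluster on each side,
  -- together with the pair `e`, `f`, provides the three parallel pairs of M*(K₂,₃), the triangle
  -- with doubled edges.
  record Cluster (X Y : P n) (f : Fin n) : Set where
    field
      K        : P n
      a b      : Fin n
      K⊆X      : K ⊆ X
      a∈X      : ⁅ a ⁆ ⊆ X
      b∈X      : ⁅ b ⁆ ⊆ X
      a≢b      : a ≢ b
      f-avoids : r (K ∪ Y) < r (K ∪ Y ∪ ⁅ f ⁆)
      a-spans  : r (K ∪ ⁅ a ⁆ ∪ Y ∪ ⁅ f ⁆) ≤ r (K ∪ ⁅ a ⁆ ∪ Y)
      b-spans  : r (K ∪ ⁅ b ⁆ ∪ Y ∪ ⁅ f ⁆) ≤ r (K ∪ ⁅ b ⁆ ∪ Y)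

  -- Inserting e next to its parallel element f keeps an ordering narrow unless f
  -- links the set X of its predecessors to the set Y of its successors.
  module _ (connected : Connected) {e f : Fin n} (f-active : Active M f) (e∥f : r (⁅ e ⁆ ∪ ⁅ f ⁆) ≤ 1) where

    -- By `skew` and `span`, deleting `e` and `f` leaves a direct sum of the restrictions to `X` and
    -- `Y` of full rank: only the parallel pair holds the two sides together.
    record Link (X Y : P n) : Set where
      field
        X⊆   : X ⊆ ∁ (⁅ e ⁆ ∪ ⁅ f ⁆ ∪ Y)
        Y⊆   : Y ⊆ ∁ (⁅ e ⁆ ∪ ⁅ f ⁆ ∪ X)
        𝟙⊆   : 𝟙 ⊆ X ∪ Y ∪ ⁅ e ⁆ ∪ ⁅ f ⁆
        skew : r X + r Y ≤ r 𝟙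
        span : r 𝟙 ≤ r (X ∪ Y)

    link-sym : ∀ {X Y} → Link X Y → Link Y X
    link-sym {X} {Y} k = record
      { X⊆ = k.Y⊆ ; Y⊆ = k.X⊆
      ; 𝟙⊆ = ⊆-by (X ∷ Y ∷ ⁅ e ⁆ ∷ ⁅ f ⁆ ∷ []) ((𝟙ᵉ , s0 || s1 || s2 || s3) ∷ []) 𝟙ᵉ (s1 || s0 || s2 || s3)
          refl (k.𝟙⊆ , tt)
      ; skew = ≤-trans (≤-reflexive (+-comm (r Y) (r X))) k.skew
      ; span = (≤-by M (X ∷ Y ∷ []) [] ((rk 𝟙ᵉ ≼ rk (s0 || s1)) ∷ []) (rk 𝟙ᵉ ≼ rk (s1 || s0)) [] refl tt
        (k.span , tt)) }
      where module k = Link k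

    -- The second alternative says that the restriction to `X` has only loops and coloops. The
    -- question that decides is whether the coloops of this restriction, together with `Y`, already
    -- span `f`.
    cluster : ∀ {X Y} → Link X Y → Cluster X Y f ⊎ (∀ S → S ⊆ X → r S + r (X ∖ S) ≤ r X)
    cluster {X} {Y} k = result
      where
      open Link k
      -- The coloops of the restriction to `X`.
      Z : P n
      Z x = X x ∧ ⌊ r (X ∖ ⁅ x ⁆) <? r X ⌋
      Z⊆X : Z ⊆ X
      Z⊆X x z∈ = proj₁ (∧⁻ z∈)
      Z-coloop : ∀ {x} → T (Z x) → r (X ∖ ⁅ x ⁆) < r X
      Z-coloop {x} x∈ = toWitness (proj₂ (∧⁻ {X x} x∈))
      Z-intro : ∀ {x} → T (X x) → r (X ∖ ⁅ x ⁆) < r X → T (Z x)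
      Z-intro x∈ lt = ∧⁺ (x∈ , fromWitness lt)

      separates : ∀ S → S ⊆ X → (∀ {x} → T (S x) → T (Z x) ⊎ r ⁅ x ⁆ ≤ 0) → r S + r (X ∖ S) ≤ r X
      separates S S⊆X splits = set-induction (λ W → W ⊆ S → r W + r (X ∖ W) ≤ r X)
        (λ { {W} {W′} (p , q) h W′⊆S → let hW = h (⊆-trans p W′⊆S) in
          (≤-by M (X ∷ W ∷ W′ ∷ []) ((s1 , s2) ∷ (s2 , s1) ∷ []) ((rk s1 ⊕ rk (s0 && ~ s1) ≼ rk s0) ∷ [])
            (rk s2 ⊕ rk (s0 && ~ s2) ≼ rk s0) [] refl (p , q , tt) (hW , tt)) })
        (λ _ → (≤-by M (X ∷ []) [] [] (rk ∅ᵉ ⊕ rk (s0 && ~ ∅ᵉ) ≼ rk s0) [] refl tt tt))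
        insert S (⊆-refl S)
        where
        insert : ∀ W z → (W ⊆ S → r W + r (X ∖ W) ≤ r X) → W ∪ ⁅ z ⁆ ⊆ S → r (W ∪ ⁅ z ⁆) + r (X ∖ (W ∪ ⁅ z ⁆)) ≤ r X
        insert W z ih W∪z⊆S with ih (⊆-trans (⊆-by (W ∷ ⁅ z ⁆ ∷ []) [] s0 (s0 || s1) refl tt) W∪z⊆S) | T? (W z)
        ... | h | yes z∈W = ≤-by M (X ∷ W ∷ ⁅ z ⁆ ∷ []) ((s2 , s1) ∷ [])
          ((rk s1 ⊕ rk (s0 && ~ s1) ≼ rk s0) ∷ []) (rk (s1 || s2) ⊕ rk (s0 && ~ (s1 || s2)) ≼ rk s0) [] refl
          (⁅⁆-⊆ W z∈W , tt) (h , tt)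
        ... | h | no  z∉W with W∪z⊆S z (∨⁺ {W z} (inj₂ (∈-⁅⁆ z)))
        ...   | z∈S with splits z∈S
        ...     | inj₁ z∈Z = let coloop = Z-coloop z∈Z in
                  (≤-by M (X ∷ W ∷ ⁅ z ⁆ ∷ []) ((s2 , ~ s1) ∷ []) ((lit 1 ⊕ rk (s0 && ~ s2) ≼ rk s0) ∷
                    (rk s1 ⊕ rk (s0 && ~ s1) ≼ rk s0) ∷ (rk s2 ≼ lit 1) ∷ [])
                    (rk (s1 || s2) ⊕ rk (s0 && ~ (s1 || s2)) ≼ rk s0) (sub (s0 && ~ s2) (s0 && ~ s1) ∷
                    sub s1 s2 ∷ []) refl (⁅⁆-⊆∁ W z∉W , tt) (coloop , h , Mat.r1 M z , tt))
        ...     | inj₂ loop = ≤-by M (X ∷ W ∷ ⁅ z ⁆ ∷ []) [] ((rk s2 ≼ lit 0) ∷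
          (rk s1 ⊕ rk (s0 && ~ s1) ≼ rk s0) ∷ []) (rk (s1 || s2) ⊕ rk (s0 && ~ (s1 || s2)) ≼ rk s0)
          (sub s2 s1 ∷ mon (s0 && ~ (s1 || s2)) (s0 && ~ s1) ∷ []) refl tt (loop , h , tt)

      result : Cluster X Y f ⊎ (∀ S → S ⊆ X → r S + r (X ∖ S) ≤ r X)
      result with r (Z ∪ Y) <? r (Z ∪ Y ∪ ⁅ f ⁆)
      ... | no spans = inj₂ λ S S⊆X → separates S S⊆X λ x∈S → splits (S⊆X _ x∈S)
        where
        Z-sep = separates Z Z⊆X inj₁
        -- As `Z` and `Y` span `f`, this set is a separator through `f`; connectedness leaves only
        -- inactive elements in `X ∖ Z`, and among them the coloops already lie in `Z`.
        A = Z ∪ Y ∪ ⁅ e ⁆ ∪ ⁅ f ⁆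
        spans′ = ≮⇒≥ spans
        A-sep : r A + r (∁ A) ≤ r 𝟙
        A-sep = ≤-by M (X ∷ Y ∷ Z ∷ ⁅ e ⁆ ∷ ⁅ f ⁆ ∷ []) ((s0 , ~ (s3 || s4 || s1)) ∷
          (𝟙ᵉ , s0 || s1 || s3 || s4) ∷ []) ((rk (s3 || s4) ≼ lit 1) ∷ (lit 1 ≼ rk s4) ∷
          (rk (s2 || s1 || s4) ≼ rk (s2 || s1)) ∷ (rk s2 ⊕ rk (s0 && ~ s2) ≼ rk s0) ∷
          (rk s0 ⊕ rk s1 ≼ rk 𝟙ᵉ) ∷ []) (rk (s2 || s1 || s3 || s4) ⊕ rk (~ (s2 || s1 || s3 || s4)) ≼ rk 𝟙ᵉ)
          (sub (s3 || s4) (s2 || s1 || s4) ∷ mon s4 ((s3 || s4) && (s2 || s1 || s4)) ∷ sub s2 s1 ∷ []) refl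
          (X⊆ , 𝟙⊆ , tt) (e∥f , proj₁ f-active , spans′ , Z-sep , skew , tt)
        splits : ∀ {x} → T (X x) → T (Z x) ⊎ r ⁅ x ⁆ ≤ 0
        splits {x} x∈X with T? (Z x)
        ... | yes x∈Z = inj₁ x∈Z
        ... | no  x∉Z with inactive-split M {x} (λ x-active → not-T
                (∈-set (⊆-by (X ∷ Y ∷ Z ∷ ⁅ x ⁆ ∷ ⁅ e ⁆ ∷ ⁅ f ⁆ ∷ []) ((s3 , s0) ∷ (s3 , ~ s2) ∷ (s0 , ~ (s4
                    || s5 || s1)) ∷ []) s3 (~ (s2 || s1 || s4 || s5)) refl (⁅⁆-⊆ X x∈X , ⁅⁆-⊆∁ Z x∉Z , X⊆ ,
                    tt)))
                (connected A A-sep f-active x-active (∈-set (⊆-by (Z ∷ Y ∷ ⁅ e ⁆ ∷ ⁅ f ⁆ ∷ []) [] s3 (s0 ||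
                    s1 || s2 || s3) refl tt))))
        ...   | inj₁ loop = inj₂ loop
        ...   | inj₂ coloop = ⊥-elim (x∉Z (Z-intro x∈X
                (≤-by M (X ∷ ⁅ x ⁆ ∷ []) ((s1 , s0) ∷ []) ((lit 1 ⊕ rk (~ s1) ≼ rk 𝟙ᵉ) ∷ [])
                  (lit 1 ⊕ rk (s0 && ~ s1) ≼ rk s0) (sub (~ s1) s0 ∷ []) refl (⁅⁆-⊆ X x∈X , tt)
                  (coloop , tt))))
      ... | yes avoids with maximal-avoiding M f Y Z X avoids
      ...   | K , Z⊆K , K⊆ZX , K-avoids , max with any? (λ a → T? (X a) ×-dec ¬? (T? (K a)))
      ...     | no none = ⊥-elim (<⇒≱ K-avoids
                (≤-by M (X ∷ Y ∷ K ∷ ⁅ f ⁆ ∷ []) ((s0 , s2) ∷ []) ((rk 𝟙ᵉ ≼ rk (s0 || s1)) ∷ [])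
                  (rk (s2 || s1 || s3) ≼ rk (s2 || s1)) (mon (s2 || s1 || s3) 𝟙ᵉ ∷
                  mon (s0 || s1) (s2 || s1) ∷ []) refl (X⊆K , tt) (span , tt)))
        where
        X⊆K : X ⊆ K
        X⊆K i i∈X = decidable-stable (T? (K i)) (λ i∉K → none (i , i∈X , i∉K))
      ...     | yes (a , a∈X , a∉K) with any? (λ b → T? (X b) ×-dec (¬? (T? (K b)) ×-dec ¬? (a ≟ b)))
      -- A single missing element is no coloop of the restriction to `X`, because `Z ⊆ K`. So `K`
      -- would span `X`, and `K ∪ Y` would span `f`. Starting the greedy choice at `Z` is what
      -- forces a second element.
      ...       | no only = ⊥-elim (<⇒≱ K-avoids
                  (≤-by M (X ∷ Y ∷ K ∷ ⁅ a ⁆ ∷ ⁅ f ⁆ ∷ []) ((s0 , s2 || s3) ∷ [])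
                    ((rk s0 ≼ rk (s0 && ~ s3)) ∷ (rk 𝟙ᵉ ≼ rk (s0 || s1)) ∷ [])
                    (rk (s2 || s1 || s4) ≼ rk (s2 || s1)) (sub s0 (s2 || s1) ∷
                    mon (s0 && ~ s3) (s0 && (s2 || s1)) ∷ mon (s2 || s1 || s4) 𝟙ᵉ ∷
                    mon (s0 || s1) (s0 || (s2 || s1)) ∷ []) refl (X⊆K∪a , tt) (a-spans , span , tt)))
        where
        X⊆K∪a : X ⊆ K ∪ ⁅ a ⁆
        X⊆K∪a i i∈X = decidable-stable (T? ((K ∪ ⁅ a ⁆) i)) (λ i∉ → only (i , i∈X
          , (λ i∈K → i∉ (∨⁺ {K i} (inj₁ i∈K)))
          , (λ a≡i → i∉ (∨⁺ {K i} (inj₂ (fromWitness a≡i))))))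
        a-spans : r X ≤ r (X ∖ ⁅ a ⁆)
        a-spans = ≮⇒≥ (λ lt → a∉K (Z⊆K a (Z-intro a∈X lt)))
      ...       | yes (b , b∈X , b∉K , a≢b) = inj₁ record
                  { K = K ; a = a ; b = b
                  ; K⊆X = ⊆-by (K ∷ X ∷ Z ∷ []) ((s0 , s2 || s1) ∷ (s2 , s1) ∷ []) s0 s1 refl (K⊆ZX , Z⊆X , tt)
                  ; a∈X = ⁅⁆-⊆ X a∈X ; b∈X = ⁅⁆-⊆ X b∈X ; a≢b = a≢b
                  ; f-avoids = K-avoids ; a-spans = max a∈X a∉K ; b-spans = max b∈X b∉K }

module _ {n : ℕ} (M : Mat n) (connected : Connected M) {e f : Fin n} (e≢f : e ≢ f)
         (f-active : Active M f) (e∥f : Mat.r M (⁅ e ⁆ ∪ ⁅ f ⁆) ≤ 1) where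
  open Mat M

  private
    L : P n → P n → Set
    L = Link M connected f-active e∥f

    N : P n → Set
    N = Narrow (restrict M (∁ ⁅ e ⁆))

    resp : Resp (Narrow M)
    resp {X} {Y} = Narrow-resp M

    f≠e : ⁅ f ⁆ ⊆ ∁ ⁅ e ⁆
    f≠e = ≢-⊆∁ (e≢f ∘ sym)

    f-rank = proj₁ f-active

    -- Behind `f` the element `e` adds no rank to a prefix, so every later prefix of the ordering of
    -- the deletion stays narrow.
    after : ∀ {X} → ⁅ f ⁆ ⊆ X → Path N X 𝟙 → Path (Narrow M) (X ∪ ⁅ e ⁆) 𝟙
    after {X} f∈X (done (_ , 𝟙⊆X)) = done (⊆𝟙 _ , (⊆-by (X ∷ ⁅ e ⁆ ∷ []) ((𝟙ᵉ , s0) ∷ []) 𝟙ᵉ (s0 || s1) refl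
        (𝟙⊆X , tt)))
    after {X} f∈X (add z l p) = _▷_ resp
      (one-step resp z (≐-by (X ∷ ⁅ e ⁆ ∷ ⁅ z ⁆ ∷ []) [] (s0 || s1 || s2) (s0 || s2 || s1) refl tt)
        (≤-by M (X ∷ ⁅ e ⁆ ∷ ⁅ z ⁆ ∷ ⁅ f ⁆ ∷ []) ((s3 , s0) ∷ (s3 , ~ s1) ∷ []) ((rk (s1 || s3) ≼ lit 1) ∷
          (lit 1 ≼ rk s3) ∷
          (rk ((s0 || s2) && ~ s1) ⊕ rk (~ (s0 || s2) && ~ s1) ≼ lit 1 ⊕ rk (𝟙ᵉ && ~ s1)) ∷ [])
          (rk (s0 || s2 || s1) ⊕ rk (~ (s0 || s2 || s1)) ≼ lit 1 ⊕ rk 𝟙ᵉ)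
          (sub (s1 || s3) ((s0 || s2) && ~ s1) ∷ mon (𝟙ᵉ && ~ s1) 𝟙ᵉ ∷ []) refl (f∈X , f≠e , tt)
          (e∥f , f-rank , l , tt)))
      (after (⊆-by (X ∷ ⁅ z ⁆ ∷ ⁅ f ⁆ ∷ []) ((s2 , s0) ∷ []) s2 (s0 || s1) refl (f∈X , tt)) p)

  Outcome : Set
  Outcome = Path (Narrow M) ∅ 𝟙 ⊎ (∃ λ X → ∃ λ Y → L X Y × Cluster M X Y f × Cluster M Y X f)

  private
    -- The moment at which `f` is about to be added. `X` may contain `e`, a loop of the deletion
    -- with an arbitrary place in the given ordering; the predecessors and successors that count are
    -- `X₀` and `Y₀`.
    module Insert (X : P n) (f∉X : ⁅ f ⁆ ⊆ ∁ X) (nX : N X) (nXf : N (X ∪ ⁅ f ⁆))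
                  (before : Path (Narrow M) ∅ (X ∖ ⁅ e ⁆)) (rest : Path N (X ∪ ⁅ f ⁆) 𝟙) where
      X₀ Y₀ : P n
      X₀ = X ∖ ⁅ e ⁆
      Y₀ = ∁ X ∖ ⁅ e ⁆ ∖ ⁅ f ⁆

      remaining : Path (Narrow M) (X ∪ ⁅ f ⁆ ∪ ⁅ e ⁆) 𝟙
      remaining = after (⊆-by (X ∷ ⁅ f ⁆ ∷ []) [] s1 (s0 || s1) refl tt) rest

      narrow-ef : Narrow M (X ∪ ⁅ f ⁆ ∪ ⁅ e ⁆)
      narrow-ef = ≤-by M (X ∷ ⁅ e ⁆ ∷ ⁅ f ⁆ ∷ []) ((s2 , ~ s1) ∷ []) ((rk (s1 || s2) ≼ lit 1) ∷
        (lit 1 ≼ rk s2) ∷ (rk ((s0 || s2) && ~ s1) ⊕ rk (~ (s0 || s2) && ~ s1) ≼ lit 1 ⊕ rk (𝟙ᵉ && ~ s1)) ∷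
        []) (rk (s0 || s2 || s1) ⊕ rk (~ (s0 || s2 || s1)) ≼ lit 1 ⊕ rk 𝟙ᵉ)
        (sub (s1 || s2) ((s0 || s2) && ~ s1) ∷ mon (𝟙ᵉ && ~ s1) 𝟙ᵉ ∷ []) refl (f≠e , tt)
        (e∥f , f-rank , nXf , tt)

      adjacent : Narrow M (X₀ ∪ ⁅ e ⁆) → Outcome
      adjacent l = inj₁ (_▷_ resp before (add e l (add f
        (Narrow-resp M (≐-by (X ∷ ⁅ e ⁆ ∷ ⁅ f ⁆ ∷ []) [] (s0 || s2 || s1) (s0 && ~ s1 || s1 || s2) refl tt) narrow-ef)
        (path-congˡ resp (≐-by (X ∷ ⁅ e ⁆ ∷ ⁅ f ⁆ ∷ []) [] (s0 || s2 || s1) (s0 && ~ s1 || s1 || s2) refl tt)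
            remaining))))

      -- For an `X₀` of loops and coloops: the pair moves to the front, `X₀` follows in any order,
      -- and the given ordering resumes. `last` is the mirror image, with the pair behind `Y₀`.
      first : (∀ S → S ⊆ X₀ → Narrow M (⁅ e ⁆ ∪ ⁅ f ⁆ ∪ S)) → Outcome
      first narrow = inj₁
        (add e (≤-by M (⁅ e ⁆ ∷ []) [] ((rk s0 ≼ lit 1) ∷ [])
          (rk (∅ᵉ || s0) ⊕ rk (~ (∅ᵉ || s0)) ≼ lit 1 ⊕ rk 𝟙ᵉ) (mon (~ (∅ᵉ || s0)) 𝟙ᵉ ∷ []) refl tt
          (Mat.r1 M e , tt))
        (add f (≤-by M (⁅ e ⁆ ∷ ⁅ f ⁆ ∷ []) [] ((rk (s0 || s1) ≼ lit 1) ∷ [])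
          (rk (∅ᵉ || s0 || s1) ⊕ rk (~ (∅ᵉ || s0 || s1)) ≼ lit 1 ⊕ rk 𝟙ᵉ) (mon (~ (∅ᵉ || s0 || s1)) 𝟙ᵉ ∷ [])
          refl tt (e∥f , tt))
        (path-congˡ resp (≐-by (⁅ e ⁆ ∷ ⁅ f ⁆ ∷ []) [] (s0 || s1) (∅ᵉ || s0 || s1) refl tt)
          (_▷_ resp (any-order resp (⁅ e ⁆ ∪ ⁅ f ⁆) X₀ narrow)
            (path-congˡ resp (≐-by (X ∷ ⁅ e ⁆ ∷ ⁅ f ⁆ ∷ []) [] (s0 || s2 || s1) (s1 || s2 || s0 && ~ s1) refl
                tt) remaining)))))

      last : (∀ S → S ⊆ Y₀ → Narrow M (X₀ ∪ S)) → Outcome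
      last narrow = inj₁ (_▷_ resp before (_▷_ resp (any-order resp X₀ Y₀ narrow)
        (add e (≤-by M (X ∷ ⁅ e ⁆ ∷ ⁅ f ⁆ ∷ []) [] ((rk s2 ≼ lit 1) ∷ [])
          (rk (s0 && ~ s1 || ~ s0 && ~ s1 && ~ s2 || s1) ⊕ rk (~ (s0 && ~ s1 || ~ s0 && ~ s1 && ~ s2 || s1)) ≼ lit 1 ⊕ rk 𝟙ᵉ)
          (mon (~ (s0 && ~ s1 || ~ s0 && ~ s1 && ~ s2 || s1)) s2 ∷
          mon (s0 && ~ s1 || ~ s0 && ~ s1 && ~ s2 || s1) 𝟙ᵉ ∷ []) refl tt (Mat.r1 M f , tt))
        (one-step resp f (⊆𝟙 _ , (⊆-by (X ∷ ⁅ e ⁆ ∷ ⁅ f ⁆ ∷ []) [] 𝟙ᵉ (s0 && ~ s1 || ~ s0 && ~ s1 && ~ s2 ||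
            s1 || s2) refl tt))
          (≤-by M [] [] [] (rk 𝟙ᵉ ⊕ rk (~ 𝟙ᵉ) ≼ lit 1 ⊕ rk 𝟙ᵉ) [] refl tt tt)))))

      linked : L X₀ Y₀ → Outcome
      linked k with cluster M connected f-active e∥f k | cluster M connected f-active e∥f (link-sym M
          connected f-active e∥f k)
      ... | inj₁ c   | inj₁ c′  = inj₂ (X₀ , Y₀ , k , c , c′)
      ... | inj₂ sep | _        = first λ S S⊆X₀ → let sepS = sep S S⊆X₀ ; skew = Link.skew k in
        (≤-by M (X ∷ S ∷ ⁅ e ⁆ ∷ ⁅ f ⁆ ∷ []) ((s1 , s0 && ~ s2) ∷ (s3 , ~ s0) ∷ [])
          ((rk (s2 || s3) ≼ lit 1) ∷ (rk s1 ⊕ rk (s0 && ~ s2 && ~ s1) ≼ rk (s0 && ~ s2)) ∷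
          (rk (s0 && ~ s2) ⊕ rk (~ s0 && ~ s2 && ~ s3) ≼ rk 𝟙ᵉ) ∷ [])
          (rk (s2 || s3 || s1) ⊕ rk (~ (s2 || s3 || s1)) ≼ lit 1 ⊕ rk 𝟙ᵉ) (sub (s2 || s3) s1 ∷
          sub (s0 && ~ s2 && ~ s1) (~ s0 && ~ s2 && ~ s3) ∷ []) refl (S⊆X₀ , f∉X , tt)
          (e∥f , sepS , skew , tt))
      ... | inj₁ _   | inj₂ sep = last λ S S⊆Y₀ → let sepS = sep S S⊆Y₀ ; skew = Link.skew k in
        (≤-by M (X ∷ S ∷ ⁅ e ⁆ ∷ ⁅ f ⁆ ∷ []) [] ((rk (s2 || s3) ≼ lit 1) ∷
          (rk s1 ⊕ rk (~ s0 && ~ s2 && ~ s3 && ~ s1) ≼ rk (~ s0 && ~ s2 && ~ s3)) ∷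
          (rk (s0 && ~ s2) ⊕ rk (~ s0 && ~ s2 && ~ s3) ≼ rk 𝟙ᵉ) ∷ [])
          (rk (s0 && ~ s2 || s1) ⊕ rk (~ (s0 && ~ s2 || s1)) ≼ lit 1 ⊕ rk 𝟙ᵉ)
          (sub (s2 || s3) (~ s0 && ~ s2 && ~ s3 && ~ s1) ∷ sub s1 (s0 && ~ s2) ∷
          mon (~ (s0 && ~ s2 || s1)) (s2 || s3 || ~ s0 && ~ s2 && ~ s3 && ~ s1) ∷ []) refl tt
          (e∥f , sepS , skew , tt))

      -- There is room for `e` directly before `f` if `X₀` spans `f`, if `Y₀` does, or if `X₀` is
      -- separated from `Y₀` and `f`. When all three fail, `f` is a link.
      insert : Outcome
      insert with r X₀ <? r (X₀ ∪ ⁅ f ⁆) | r Y₀ <? r (Y₀ ∪ ⁅ f ⁆) | r 𝟙 <? r X₀ + r (Y₀ ∪ ⁅ f ⁆)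
      ... | no in-X | _ | _ = let h = ≮⇒≥ in-X in adjacent
        (≤-by M (X ∷ ⁅ e ⁆ ∷ ⁅ f ⁆ ∷ []) [] ((rk (s0 && ~ s1 || s2) ≼ rk (s0 && ~ s1)) ∷
          (rk (s1 || s2) ≼ lit 1) ∷ (lit 1 ≼ rk s2) ∷
          (rk (s0 && ~ s1) ⊕ rk (~ s0 && ~ s1) ≼ lit 1 ⊕ rk (𝟙ᵉ && ~ s1)) ∷ [])
          (rk (s0 && ~ s1 || s1) ⊕ rk (~ (s0 && ~ s1 || s1)) ≼ lit 1 ⊕ rk 𝟙ᵉ)
          (sub (s0 && ~ s1 || s2) (s1 || s2) ∷ mon (𝟙ᵉ && ~ s1) 𝟙ᵉ ∷
          mon (s0 && ~ s1 || s1) (s0 && ~ s1 || s2 || (s1 || s2)) ∷ []) refl tt (h , e∥f , f-rank , nX , tt))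
      ... | yes _ | no in-Y | _ = let h = ≮⇒≥ in-Y in adjacent
        (≤-by M (X ∷ ⁅ e ⁆ ∷ ⁅ f ⁆ ∷ []) ((s2 , ~ s0) ∷ (s2 , ~ s1) ∷ [])
          ((rk (~ s0 && ~ s1 && ~ s2 || s2) ≼ rk (~ s0 && ~ s1 && ~ s2)) ∷ (rk (s1 || s2) ≼ lit 1) ∷
          (lit 1 ≼ rk s2) ∷
          (rk ((s0 || s2) && ~ s1) ⊕ rk (~ (s0 || s2) && ~ s1) ≼ lit 1 ⊕ rk (𝟙ᵉ && ~ s1)) ∷ [])
          (rk (s0 && ~ s1 || s1) ⊕ rk (~ (s0 && ~ s1 || s1)) ≼ lit 1 ⊕ rk 𝟙ᵉ)
          (sub (s1 || s2) ((s0 || s2) && ~ s1) ∷ mon (𝟙ᵉ && ~ s1) 𝟙ᵉ ∷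
          mon (s0 && ~ s1 || s1) (s1 || s2 || (s0 || s2) && ~ s1) ∷ []) refl (f∉X , f≠e , tt)
          (h , e∥f , f-rank , nXf , tt))
      ... | yes _ | yes _ | no separated = let h = ≮⇒≥ separated in adjacent
        (≤-by M (X ∷ ⁅ e ⁆ ∷ ⁅ f ⁆ ∷ []) ((s2 , ~ s0) ∷ (s2 , ~ s1) ∷ [])
          ((rk (s0 && ~ s1) ⊕ rk (~ s0 && ~ s1 && ~ s2 || s2) ≼ rk 𝟙ᵉ) ∷ (rk s1 ≼ lit 1) ∷ [])
          (rk (s0 && ~ s1 || s1) ⊕ rk (~ (s0 && ~ s1 || s1)) ≼ lit 1 ⊕ rk 𝟙ᵉ) (sub (s0 && ~ s1) s1 ∷ [])
          refl (f∉X , f≠e , tt) (h , Mat.r1 M e , tt))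
      ... | yes _ | yes f∉Y₀ | yes linking = linked record
        { X⊆ = ⊆-by (X ∷ ⁅ e ⁆ ∷ ⁅ f ⁆ ∷ []) ((s2 , ~ s0) ∷ []) (s0 && ~ s1) (~ (s1 || s2 || ~ s0 && ~ s1 &&
            ~ s2)) refl (f∉X , tt)
        ; Y⊆ = ⊆-by (X ∷ ⁅ e ⁆ ∷ ⁅ f ⁆ ∷ []) [] (~ s0 && ~ s1 && ~ s2) (~ (s1 || s2 || s0 && ~ s1)) refl tt
        ; 𝟙⊆ = ⊆-by (X ∷ ⁅ e ⁆ ∷ ⁅ f ⁆ ∷ []) [] 𝟙ᵉ (s0 && ~ s1 || ~ s0 && ~ s1 && ~ s2 || s1 || s2) refl tt
        ; skew = ≤-by M (X ∷ ⁅ e ⁆ ∷ ⁅ f ⁆ ∷ []) ((s2 , ~ s0) ∷ (s2 , ~ s1) ∷ [])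
          ((lit 1 ⊕ rk (~ s0 && ~ s1 && ~ s2) ≼ rk (~ s0 && ~ s1 && ~ s2 || s2)) ∷
          (rk (s0 && ~ s1) ⊕ rk (~ s0 && ~ s1) ≼ lit 1 ⊕ rk (𝟙ᵉ && ~ s1)) ∷ [])
          (rk (s0 && ~ s1) ⊕ rk (~ s0 && ~ s1 && ~ s2) ≼ rk 𝟙ᵉ) (mon (𝟙ᵉ && ~ s1) 𝟙ᵉ ∷ []) refl
          (f∉X , f≠e , tt) (f∉Y₀ , nX , tt)
        ; span = ≮⇒≥ (λ lt → <⇒≱ linking (unlinked lt)) }
        where
        -- If `X₀ ∪ Y₀` failed to span, the pair `e`, `f` would be a separator; connectedness would
        -- make `X₀` inactive, hence itself a separator.
        unlinked : r (X₀ ∪ Y₀) < r 𝟙 → r X₀ + r (Y₀ ∪ ⁅ f ⁆) ≤ r 𝟙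
        unlinked lt = ≤-by M (X ∷ ⁅ e ⁆ ∷ ⁅ f ⁆ ∷ []) ((s2 , ~ s0) ∷ [])
          ((rk (s0 && ~ s1) ⊕ rk (~ (s0 && ~ s1)) ≼ rk 𝟙ᵉ) ∷ [])
          (rk (s0 && ~ s1) ⊕ rk (~ s0 && ~ s1 && ~ s2 || s2) ≼ rk 𝟙ᵉ)
          (mon (~ s0 && ~ s1 && ~ s2 || s2) (~ (s0 && ~ s1)) ∷ []) refl (f∉X , tt) (sepX , tt)
          where
          sep : r (⁅ e ⁆ ∪ ⁅ f ⁆) + r (∁ (⁅ e ⁆ ∪ ⁅ f ⁆)) ≤ r 𝟙
          sep = ≤-by M (X ∷ ⁅ e ⁆ ∷ ⁅ f ⁆ ∷ []) ((s2 , ~ s0) ∷ []) ((rk (s1 || s2) ≼ lit 1) ∷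
            (lit 1 ⊕ rk (s0 && ~ s1 || ~ s0 && ~ s1 && ~ s2) ≼ rk 𝟙ᵉ) ∷ [])
            (rk (s1 || s2) ⊕ rk (~ (s1 || s2)) ≼ rk 𝟙ᵉ) [] refl (f∉X , tt) (e∥f , lt , tt)
          sepX : r X₀ + r (∁ X₀) ≤ r 𝟙
          sepX = inactive-separator M X₀ (λ {x} x∈X₀ x-active → not-T
            (∈-set (⊆-by (X ∷ ⁅ x ⁆ ∷ ⁅ e ⁆ ∷ ⁅ f ⁆ ∷ []) ((s1 , s0 && ~ s2) ∷ (s3 , ~ s0) ∷ []) s1 (~ (s2 ||
                s3)) refl (⁅⁆-⊆ X₀ x∈X₀ , f∉X , tt)))
            (connected _ sep f-active x-active (∈-set (⊆-by (⁅ e ⁆ ∷ ⁅ f ⁆ ∷ []) [] s1 (s0 || s1) refl tt))))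

    walk : ∀ {X} → ⁅ f ⁆ ⊆ ∁ X → N X → Path (Narrow M) ∅ (X ∖ ⁅ e ⁆) → Path N X 𝟙 → Outcome
    walk {X} f∉X nX before (done (_ , 𝟙⊆X)) = ⊥-elim (not-T (∈-set f∉X) (𝟙⊆X f tt))
    walk {X} f∉X nX before (add z l p) with z ≟ f
    ... | yes refl = Insert.insert X f∉X nX l before p
    ... | no z≢f with z ≟ e
    -- `e` is a loop of the deletion, so its place in the given ordering is forgotten.
    ...   | yes refl = walk (⊆-by (X ∷ ⁅ e ⁆ ∷ ⁅ f ⁆ ∷ []) ((s2 , ~ s0) ∷ (s2 , ~ s1) ∷ []) s2 (~ (s0 || s1))
        refl (f∉X , f≠e , tt)) l
              (path-congʳ resp (≐-by (X ∷ ⁅ e ⁆ ∷ []) [] (s0 && ~ s1) ((s0 || s1) && ~ s1) refl tt) before) p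
    ...   | no z≢e = walk (⊆-by (X ∷ ⁅ z ⁆ ∷ ⁅ f ⁆ ∷ []) ((s2 , ~ s0) ∷ (s2 , ~ s1) ∷ []) s2 (~ (s0 || s1))
        refl (f∉X , ≢-⊆∁ (z≢f ∘ sym) , tt)) l
              (_▷_ resp before (one-step resp z
                (≐-by (X ∷ ⁅ z ⁆ ∷ ⁅ e ⁆ ∷ []) ((s1 , ~ s2) ∷ []) (s0 && ~ s2 || s1) ((s0 || s1) && ~ s2)
                    refl (≢-⊆∁ z≢e , tt))
                (≤-by M (X ∷ ⁅ z ⁆ ∷ ⁅ e ⁆ ∷ ⁅ f ⁆ ∷ []) ((s3 , ~ s0) ∷ (s3 , ~ s1) ∷ (s3 , ~ s2) ∷ [])
                  ((rk (s2 || s3) ≼ lit 1) ∷ (lit 1 ≼ rk s3) ∷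
                  (rk ((s0 || s1) && ~ s2) ⊕ rk (~ (s0 || s1) && ~ s2) ≼ lit 1 ⊕ rk (𝟙ᵉ && ~ s2)) ∷ [])
                  (rk ((s0 || s1) && ~ s2) ⊕ rk (~ ((s0 || s1) && ~ s2)) ≼ lit 1 ⊕ rk 𝟙ᵉ)
                  (sub (s2 || s3) (~ (s0 || s1) && ~ s2) ∷ mon (𝟙ᵉ && ~ s2) 𝟙ᵉ ∷ []) refl
                  (f∉X , ≢-⊆∁ (z≢f ∘ sym) , f≠e , tt) (e∥f , f-rank , l , tt)))) p

  parallel-path : Path N ∅ 𝟙 → Outcome
  parallel-path = walk (λ _ _ → tt) (≤-by M (⁅ e ⁆ ∷ []) [] []
    (rk (∅ᵉ && ~ s0) ⊕ rk (~ ∅ᵉ && ~ s0) ≼ lit 1 ⊕ rk (𝟙ᵉ && ~ s0)) [] refl tt tt)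
    (done (≐-by (⁅ e ⁆ ∷ []) [] ∅ᵉ (∅ᵉ && ~ s0) refl tt))

-- Recognising small minors

anyFin⁻ : ∀ {n} (f : P n) → T (anyFin f) → ∃ λ i → T (f i)
anyFin⁻ {suc n} f t with ∨⁻ {f Fin.zero} t
... | inj₁ p = Fin.zero , p
... | inj₂ p with anyFin⁻ (f ∘ Fin.suc) p
...   | i , q = Fin.suc i , q

anyFin⁺ : ∀ {n} (f : P n) i → T (f i) → T (anyFin f)
anyFin⁺ f Fin.zero    t = ∨⁺ (inj₁ t)
anyFin⁺ f (Fin.suc i) t = ∨⁺ {f Fin.zero} (inj₂ (anyFin⁺ (f ∘ Fin.suc) i t))

module _ {m n : ℕ} (φ : Fin m → Fin n) where

  img : P m → P n
  img X j = anyFin λ i → X i ∧ ⌊ φ i ≟ j ⌋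

  ∈-img⁻ : ∀ X {j} → T (img X j) → ∃ λ i → T (X i) × φ i ≡ j
  ∈-img⁻ X {j} t with anyFin⁻ (λ i → X i ∧ ⌊ φ i ≟ j ⌋) t
  ... | i , p with ∧⁻ {X i} p
  ...   | i∈X , eq = i , i∈X , toWitness eq

  ∈-img⁺ : ∀ X {i} → T (X i) → T (img X (φ i))
  ∈-img⁺ X {i} i∈X = anyFin⁺ _ i (∧⁺ (i∈X , fromWitness refl))

  img-mono : ∀ {X Y} → X ⊆ Y → img X ⊆ img Y
  img-mono {X} {Y} p j t with ∈-img⁻ X t
  ... | i , i∈X , refl = ∈-img⁺ Y (p i i∈X)

  img-∪ : ∀ X Y → img (X ∪ Y) ⊆ img X ∪ img Y
  img-∪ X Y j t with ∈-img⁻ (X ∪ Y) t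
  ... | i , i∈ , refl with ∨⁻ {X i} i∈
  ...   | inj₁ p = ∨⁺ (inj₁ (∈-img⁺ X p))
  ...   | inj₂ p = ∨⁺ {img X (φ i)} (inj₂ (∈-img⁺ Y p))

  img-∩ : ∀ X Y → img (X ∩ Y) ⊆ img X ∩ img Y
  img-∩ X Y j t = ∧⁺
    (img-mono (⊆-by (X ∷ Y ∷ []) [] (s0 && s1) s0 refl tt) j t , img-mono (⊆-by (X ∷ Y ∷ []) [] (s0 && s1) s1
        refl tt) j t)

  img-∅ : ∀ j → ¬ T (img ∅ j)
  img-∅ j t with ∈-img⁻ ∅ {j} t
  ... | _ , () , _

  img-⁅⁆ : ∀ i → img ⁅ i ⁆ ⊆ ⁅ φ i ⁆
  img-⁅⁆ i j t with ∈-img⁻ ⁅ i ⁆ t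
  ... | k , i≡k , refl = fromWitness (cong φ (toWitness i≡k))

card-insert : ∀ {n} (S : P n) z → ¬ T (S z) → card (S ∪ ⁅ z ⁆) ≡ suc (card S)
card-insert {n} S z z∉S = trans (sym (+-identityʳ _)) (trans
  (cong (card (S ∪ ⁅ z ⁆) +_) (sym (trans (card-≐ {Y = ∅}
    ((⊆-by (S ∷ ⁅ z ⁆ ∷ []) ((s1 , ~ s0) ∷ []) (s0 && s1) ∅ᵉ refl (⁅⁆-⊆∁ S z∉S , tt)) , ∅⊆ (S ∩ ⁅ z ⁆))) (card-∅ {n}))))
  (trans (card-modular S ⁅ z ⁆) (trans (cong (card S +_) (card-⁅⁆ z)) (+-comm (card S) 1))))

module _ {m n : ℕ} (M : Mat n) (C : P n) (φ : Fin m → Fin n) where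
  open Mat M

  private
    R : P m → ℕ
    R X = r (img φ X ∪ C)

    C≤R : ∀ X → r C ≤ R X
    C≤R X = let I = img φ X in (≤-by M (C ∷ I ∷ []) [] [] (rk s0 ≼ rk (s1 || s0)) (mon s0 (s1 || s0) ∷ [])
      refl tt tt)

    R-mono : ∀ {X Y} → X ⊆ Y → R X ≤ R Y
    R-mono {X} {Y} p = let I = img φ X ; J = img φ Y ; I⊆J = img-mono φ p in
      (≤-by M (C ∷ I ∷ J ∷ []) ((s1 , s2) ∷ []) [] (rk (s1 || s0) ≼ rk (s2 || s0))
        (mon (s1 || s0) (s2 || s0) ∷ []) refl (I⊆J , tt) tt)

    R≤card : ∀ X → R X ≤ r C + card X
    R≤card = set-induction (λ S → R S ≤ r C + card S)
      (λ { (p , q) h → ≤-trans (R-mono q) (≤-trans h (+-monoʳ-≤ (r C) (card-mono p))) })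
      (let I = img φ ∅ ; I⊆∅ = λ j t → ⊥-elim (img-∅ φ j t) in ≤-trans (≤-by M (C ∷ I ∷ []) ((s1 , ∅ᵉ) ∷ [])
        [] (rk (s1 || s0) ≼ rk s0) [] refl (I⊆∅ , tt) tt) (m≤m+n (r C) _))
      insert
      where
      insert : ∀ S z → R S ≤ r C + card S → R (S ∪ ⁅ z ⁆) ≤ r C + card (S ∪ ⁅ z ⁆)
      insert S z h with T? (S z)
      ... | yes z∈S = ≤-trans (R-mono (⊆-by (S ∷ ⁅ z ⁆ ∷ []) ((s1 , s0) ∷ []) (s0 || s1) s0 refl (⁅⁆-⊆ S z∈S , tt)))
              (≤-trans h (+-monoʳ-≤ (r C) (card-mono (⊆-by (S ∷ ⁅ z ⁆ ∷ []) [] s0 (s0 || s1) refl tt))))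
      ... | no  z∉S = let I = img φ S ; J = img φ (S ∪ ⁅ z ⁆) ; w = φ z ; J⊆ = ⊆-trans (img-∪ φ S ⁅ z ⁆) (∪-mono₂ (⊆-refl (img φ S)) (img-⁅⁆ φ z)) in
              ≤-trans (≤-by M (C ∷ I ∷ J ∷ ⁅ w ⁆ ∷ []) ((s2 , s1 || s3) ∷ []) ((rk s3 ≼ lit 1) ∷ [])
                (rk (s2 || s0) ≼ lit 1 ⊕ rk (s1 || s0)) (sub s3 (s1 || s0) ∷
                mon (s2 || s0) (s3 || (s1 || s0)) ∷ []) refl (J⊆ , tt) (Mat.r1 M w , tt))
                (≤-trans (s≤s h) (≤-reflexive (trans (sym (+-suc (r C) _)) (cong (r C +_) (sym (card-insert S
                    z z∉S))))))

  -- Unlike `restrict` and `contract`, this changes the ground set, so that the result can be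
  -- compared with a fixed rank function.
  minor : Mat m
  minor = record
    { r      = λ X → R X ∸ r C
    ; r≤card = λ X → m≤n+o⇒m∸n≤o _ (r C) (R≤card X)
    ; mono   = λ p → ∸-monoˡ-≤ (r C) (R-mono p)
    ; submod = λ X Y → ∸-submod (C≤R (X ∪ Y)) (C≤R (X ∩ Y)) (C≤R X) (C≤R Y)
        (let I = img φ X ; J = img φ Y ; U = img φ (X ∪ Y) ; V = img φ (X ∩ Y) ; U⊆ = img-∪ φ X Y ; V⊆ = img-∩ φ X Y in
         (≤-by M (I ∷ J ∷ U ∷ V ∷ C ∷ []) ((s2 , s0 || s1) ∷ (s3 , s0 && s1) ∷ []) []
           (rk (s2 || s4) ⊕ rk (s3 || s4) ≼ rk (s0 || s4) ⊕ rk (s1 || s4))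
           (mon (s2 || s4) (s0 || s4 || (s1 || s4)) ∷ mon (s3 || s4) ((s0 || s4) && (s1 || s4)) ∷
           sub (s0 || s4) (s1 || s4) ∷ []) refl (U⊆ , V⊆ , tt) tt))
    }

-- Identifies a small minor from the ranks of a few of its sets, by evaluation on
-- all subsets.
module Bounds {m : ℕ} (N : Mat m) where
  open Mat N

  Facts : Set
  Facts = List (Subset m × ℕ)

  upper : Facts → P m → ℕ
  upper []             X = card X
  upper ((S , k) ∷ us) X = (k + card (X ∖ lookup S)) ⊓ upper us X

  lower : Facts → P m → ℕ
  lower []             X = 0
  lower ((S , k) ∷ ls) X = (k ∸ card (lookup S ∖ X)) ⊔ lower ls X

  -- If `S` has rank at most `k`, submodularity bounds the rank of `X` from below by way of `X ∪ S`
  -- and `X ∩ S`; this carries independence from some points of a known line or plane to others.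
  improve : Facts → (P m → ℕ) → P m → ℕ
  improve []             low X = low X
  improve ((S , k) ∷ us) low X = (low (X ∪ lookup S) + low (X ∩ lookup S) ∸ k) ⊔ improve us low X

  UpperFacts LowerFacts : Facts → Set
  UpperFacts = All (λ { (S , k) → r (lookup S) ≤ k })
  LowerFacts = All (λ { (S , k) → k ≤ r (lookup S) })

  r≤r+card∖ : ∀ X S → r X ≤ r S + card (X ∖ S)
  r≤r+card∖ X S = ≤-trans (≤-by N (X ∷ S ∷ []) [] [] (rk s0 ≼ rk s1 ⊕ rk (s0 && ~ s1)) (mon s0 (s0 || s1) ∷
    sub s1 (s0 && ~ s1) ∷ []) refl tt tt) (+-monoʳ-≤ (r S) (r≤card (X ∖ S)))

  upper-sound : ∀ {us} → UpperFacts us → ∀ X → r X ≤ upper us X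
  upper-sound []       X = r≤card X
  upper-sound (p ∷ ps) X = ⊓-glb (≤-trans (r≤r+card∖ X _) (+-monoˡ-≤ _ p)) (upper-sound ps X)

  lower-sound : ∀ {ls} → LowerFacts ls → ∀ X → lower ls X ≤ r X
  lower-sound []                   X = z≤n
  lower-sound {(S , k) ∷ _} (p ∷ ps) X = ⊔-lub
    (m≤n+o⇒m∸n≤o k _ (≤-trans p (≤-trans (r≤r+card∖ (lookup S) X) (≤-reflexive (+-comm (r X) _)))))
    (lower-sound ps X)

  improve-sound : ∀ {us} → UpperFacts us → ∀ {low} → (∀ X → low X ≤ r X) → ∀ X → improve us low X ≤ r X
  improve-sound []       low≤ X = low≤ X
  improve-sound {(S , k) ∷ _} (p ∷ ps) low≤ X = ⊔-lub
    (m≤n+o⇒m∸n≤o _ k (≤-trans (+-mono-≤ (low≤ (X ∪ lookup S)) (low≤ (X ∩ lookup S)))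
      (≤-trans (submod X (lookup S)) (≤-trans (+-monoʳ-≤ (r X) p) (≤-reflexive (+-comm (r X) k))))))
    (improve-sound ps low≤ X)

allSubsets : ∀ {m} → (Subset m → Bool) → Bool
allSubsets {zero}  f = f []
allSubsets {suc m} f = allSubsets (f ∘ (true ∷_)) ∧ allSubsets (f ∘ (false ∷_))

allSubsets-sound : ∀ {m} (f : Subset m → Bool) → T (allSubsets f) → ∀ X → T (f X)
allSubsets-sound f t []          = t
allSubsets-sound f t (true ∷ X)  = allSubsets-sound (f ∘ (true ∷_)) (proj₁ (∧⁻ t)) X
allSubsets-sound f t (false ∷ X) = allSubsets-sound (f ∘ (false ∷_))
  (proj₂ (∧⁻ {allSubsets (f ∘ (true ∷_))} t)) X

rankFn : ∀ {n} → Mat n → RankFn n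
rankFn M X = Mat.r M (lookup X)

Loopless : ∀ {m} → RankFn m → Set
Loopless ρ = ∀ i → 1 ≤ ρ Sub.⁅ i ⁆

lookup-⁅⁆ : ∀ {m} (i : Fin m) → lookup Sub.⁅ i ⁆ ≐ ⁅ i ⁆
lookup-⁅⁆ i = (λ j t → fromWitness (sym (SubP.x∈⁅y⁆⇒x≡y i (VecP.lookup⇒[]= j _ (T⇒≡ t)))))
            , λ j t → subst (T ∘ lookup Sub.⁅ i ⁆) (toWitness t) (≡⇒T (VecP.[]=⇒lookup (SubP.x∈⁅x⁆ i)))

lookup-∪ : ∀ {m} (X Y : Subset m) → lookup (X Sub.∪ Y) ≐ lookup X ∪ lookup Y
lookup-∪ X Y = ≗⇒≐ (λ i → lookup-zipWith _∨_ i X Y)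

image-img : ∀ {m n} (φ : Fin m → Fin n) X C → lookup (image φ X Sub.∪ tabulate C) ≐ img φ (lookup X) ∪ C
image-img φ X C = ≐-trans (lookup-∪ (image φ X) (tabulate C))
  (≗⇒≐ λ i → cong₂ _∨_ (lookup∘tabulate _ i) (lookup∘tabulate C i))

module _ {n : ℕ} (M : Mat n) (T₀ : Σ ℕ RankFn) (C : P n) (φ : Fin (proj₁ T₀) → Fin n) where

  -- An image lying in `C` would be a loop of the minor, and the target has none; so disjointness
  -- from `C` comes for free.
  minor-intro : (∀ i j → φ i ≡ φ j → i ≡ j) → Loopless (proj₂ T₀) →
                (∀ X → proj₂ T₀ X ≡ Mat.r (minor M C φ) (lookup X)) → HasMinor (rankFn M) T₀
  minor-intro inj loopless eq = tabulate C , φ , inj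
    , (λ i φi∈C → φi∉C i (subst T (lookup∘tabulate C (φ i)) (≡⇒T (VecP.[]=⇒lookup φi∈C))))
    , λ X → trans (eq X) (cong₂ _∸_ (sym (r-cong M (image-img φ X C))) (sym (r-cong M (≗⇒≐ (lookup∘tabulate C)))))
    where
    open Mat M
    φi∉C : ∀ i → ¬ T (C (φ i))
    φi∉C i φi∈C = <⇒≱ (≤-trans (loopless i) (≤-reflexive (eq Sub.⁅ i ⁆)))
      (m≤n+o⇒m∸n≤o _ (r C) (≤-trans
        (let I = img φ (lookup Sub.⁅ i ⁆) ; w = φ i ; I⊆ = ⊆-trans (img-mono φ (proj₁ (lookup-⁅⁆ i))) (img-⁅⁆ φ i) in
         (≤-by M (I ∷ C ∷ ⁅ w ⁆ ∷ []) ((s0 , s2) ∷ (s2 , s1) ∷ []) [] (rk (s0 || s1) ≼ rk s1) [] refl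
           (I⊆ , ⁅⁆-⊆ C φi∈C , tt) tt)) (m≤m+n (r C) 0)))

module _ {m n : ℕ} (M : Mat n) (C : P n) (φ : Fin m → Fin n) where
  open Mat M
  private
    N = minor M C φ
  open Bounds N

  determined : (ρ : RankFn m) → Facts → Facts → Bool
  determined ρ us ls = allSubsets λ X →
    -- Two rounds of `improve` settle every subset in the three recognitions below.
    (upper us (lookup X) ≤ᵇ ρ X) ∧ (ρ X ≤ᵇ improve us (improve us (lower ls)) (lookup X))

  determine : ∀ ρ us ls → determined ρ us ls ≡ true → UpperFacts us → LowerFacts ls →
              ∀ X → ρ X ≡ Mat.r N (lookup X)
  determine ρ us ls ok us-hold ls-hold X
    with ∧⁻ (allSubsets-sound _ (≡⇒T ok) X)
  ... | p , q = ≤-antisym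
    (≤-trans (≤ᵇ⇒≤ (ρ X) _ q) (improve-sound us-hold (improve-sound us-hold (lower-sound ls-hold)) (lookup X)))
    (≤-trans (upper-sound us-hold (lookup X)) (≤ᵇ⇒≤ _ (ρ X) p))

module _ {n : ℕ} (M : Mat n) (T₀ : Σ ℕ RankFn) (C : P n) (φ : Fin (proj₁ T₀) → Fin n) where
  open Mat M

  -- Two indices with the same image have rank at most 1 together, so only pairs that are parallel
  -- in the target need to be told apart by hand.
  injective-intro : (∀ X → proj₂ T₀ X ≡ Mat.r (minor M C φ) (lookup X)) →
                    (∀ i j → i ≡ j ⊎ (2 ≤ proj₂ T₀ (Sub.⁅ i ⁆ Sub.∪ Sub.⁅ j ⁆) ⊎ φ i ≢ φ j)) →
                    ∀ i j → φ i ≡ φ j → i ≡ j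
  injective-intro eq separated i j φi≡φj with separated i j
  ... | inj₁ i≡j          = i≡j
  ... | inj₂ (inj₂ φi≢φj) = ⊥-elim (φi≢φj φi≡φj)
  ... | inj₂ (inj₁ two)   = ⊥-elim (<⇒≱ (≤-trans two (≤-reflexive (eq _))) (m≤n+o⇒m∸n≤o _ (r C)
    (let I = img φ (lookup (Sub.⁅ i ⁆ Sub.∪ Sub.⁅ j ⁆)) ; w = φ i in
     (≤-by M (I ∷ C ∷ ⁅ w ⁆ ∷ []) ((s0 , s2) ∷ []) ((rk s2 ≼ lit 1) ∷ []) (rk (s0 || s1) ≼ rk s1 ⊕ lit 1)
       (sub s2 s1 ∷ mon (s0 || s1) (s2 || (s0 || s1)) ∷ []) refl (I⊆ , tt) (Mat.r1 M w , tt)))))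
    where
    I⊆ : img φ (lookup (Sub.⁅ i ⁆ Sub.∪ Sub.⁅ j ⁆)) ⊆ ⁅ φ i ⁆
    I⊆ k k∈ with img-∪ φ ⁅ i ⁆ ⁅ j ⁆ k (img-mono φ (⊆-trans (proj₁ (lookup-∪ Sub.⁅ i ⁆ Sub.⁅ j ⁆))
                   (∪-mono₂ (proj₁ (lookup-⁅⁆ i)) (proj₁ (lookup-⁅⁆ j)))) k k∈)
    ... | t with ∨⁻ {img φ ⁅ i ⁆ k} t
    ...   | inj₁ p = img-⁅⁆ φ i k p
    ...   | inj₂ p = subst (λ w → T (⁅ w ⁆ k)) (sym φi≡φj) (img-⁅⁆ φ j k p)

module _ {n : ℕ} (M : Mat n) where
  open Mat M

  U24-minor : ∀ C {a b c d} →
    r (C ∪ ⁅ a ⁆ ∪ ⁅ b ⁆ ∪ ⁅ c ⁆ ∪ ⁅ d ⁆) ≤ 2 + r C →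
    2 + r C ≤ r (C ∪ ⁅ a ⁆ ∪ ⁅ b ⁆) →
    2 + r C ≤ r (C ∪ ⁅ a ⁆ ∪ ⁅ c ⁆) →
    2 + r C ≤ r (C ∪ ⁅ a ⁆ ∪ ⁅ d ⁆) →
    2 + r C ≤ r (C ∪ ⁅ b ⁆ ∪ ⁅ c ⁆) →
    2 + r C ≤ r (C ∪ ⁅ b ⁆ ∪ ⁅ d ⁆) →
    2 + r C ≤ r (C ∪ ⁅ c ⁆ ∪ ⁅ d ⁆) →
    HasMinor (rankFn M) U24
  U24-minor C {a} {b} {c} {d} u0 l0 l1 l2 l3 l4 l5 = minor-intro M U24 C φ inj (λ i → toWitness {a? = all? λ
      i → 1 ≤? proj₂ U24 Sub.⁅ i ⁆} tt i) eq
    where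
    φ : Fin _ → Fin n
    φ = lookup (a ∷ b ∷ c ∷ d ∷ [])
    eq : ∀ X → proj₂ U24 X ≡ Mat.r (minor M C φ) (lookup X)
    eq = determine M C φ (proj₂ U24)
      (((true ∷ true ∷ true ∷ true ∷ []) , 2) ∷ [])
      (((true ∷ true ∷ false ∷ false ∷ []) , 2)
      ∷ ((true ∷ false ∷ true ∷ false ∷ []) , 2)
      ∷ ((true ∷ false ∷ false ∷ true ∷ []) , 2)
      ∷ ((false ∷ true ∷ true ∷ false ∷ []) , 2)
      ∷ ((false ∷ true ∷ false ∷ true ∷ []) , 2)
      ∷ ((false ∷ false ∷ true ∷ true ∷ []) , 2) ∷ [])
      refl
      (m≤n+o⇒m∸n≤o _ (r C) (≤-by M (C ∷ ⁅ a ⁆ ∷ ⁅ b ⁆ ∷ ⁅ c ⁆ ∷ ⁅ d ⁆ ∷ []) []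
        ((rk (s0 || s1 || s2 || s3 || s4) ≼ lit 2 ⊕ rk s0) ∷ [])
        (rk (s1 || (s2 || (s3 || (s4 || ∅ᵉ))) || s0) ≼ rk s0 ⊕ lit 2) [] refl tt (u0 , tt)) ∷ [])
      (m+n≤o⇒m≤o∸n 2 (≤-by M (C ∷ ⁅ a ⁆ ∷ ⁅ b ⁆ ∷ []) [] ((lit 2 ⊕ rk s0 ≼ rk (s0 || s1 || s2)) ∷ [])
        (lit 2 ⊕ rk s0 ≼ rk (s1 || (s2 || ∅ᵉ) || s0)) [] refl tt (l0 , tt))
      ∷ m+n≤o⇒m≤o∸n 2 (≤-by M (C ∷ ⁅ a ⁆ ∷ ⁅ c ⁆ ∷ []) [] ((lit 2 ⊕ rk s0 ≼ rk (s0 || s1 || s2)) ∷ [])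
        (lit 2 ⊕ rk s0 ≼ rk (s1 || (s2 || ∅ᵉ) || s0)) [] refl tt (l1 , tt))
      ∷ m+n≤o⇒m≤o∸n 2 (≤-by M (C ∷ ⁅ a ⁆ ∷ ⁅ d ⁆ ∷ []) [] ((lit 2 ⊕ rk s0 ≼ rk (s0 || s1 || s2)) ∷ [])
        (lit 2 ⊕ rk s0 ≼ rk (s1 || (s2 || ∅ᵉ) || s0)) [] refl tt (l2 , tt))
      ∷ m+n≤o⇒m≤o∸n 2 (≤-by M (C ∷ ⁅ b ⁆ ∷ ⁅ c ⁆ ∷ []) [] ((lit 2 ⊕ rk s0 ≼ rk (s0 || s1 || s2)) ∷ [])
        (lit 2 ⊕ rk s0 ≼ rk (s1 || (s2 || ∅ᵉ) || s0)) [] refl tt (l3 , tt))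
      ∷ m+n≤o⇒m≤o∸n 2 (≤-by M (C ∷ ⁅ b ⁆ ∷ ⁅ d ⁆ ∷ []) [] ((lit 2 ⊕ rk s0 ≼ rk (s0 || s1 || s2)) ∷ [])
        (lit 2 ⊕ rk s0 ≼ rk (s1 || (s2 || ∅ᵉ) || s0)) [] refl tt (l4 , tt))
      ∷ m+n≤o⇒m≤o∸n 2 (≤-by M (C ∷ ⁅ c ⁆ ∷ ⁅ d ⁆ ∷ []) [] ((lit 2 ⊕ rk s0 ≼ rk (s0 || s1 || s2)) ∷ [])
        (lit 2 ⊕ rk s0 ≼ rk (s1 || (s2 || ∅ᵉ) || s0)) [] refl tt (l5 , tt)) ∷ [])
    inj : ∀ i j → φ i ≡ φ j → i ≡ j
    inj = injective-intro M U24 C φ eq (λ i j → [ inj₁ , inj₂ ∘ inj₁ ]′ (toWitness {a? = all? λ i → all? λ j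
        → (i ≟ j) ⊎-dec (2 ≤? proj₂ U24 (Sub.⁅ i ⁆ Sub.∪ Sub.⁅ j ⁆))} tt i j))

  -- In the edge order of `K4` the elements `e`, `x`, `y`, `x′`, `y′`, `g` are the edges 01, 02, 03,
  -- 12, 13, 23, and the four upper bounds by 2 are the triangles.
  K4-minor : ∀ C {e x y x′ y′ g} →
    r (C ∪ ⁅ e ⁆ ∪ ⁅ x ⁆ ∪ ⁅ x′ ⁆) ≤ 2 + r C →
    r (C ∪ ⁅ e ⁆ ∪ ⁅ y ⁆ ∪ ⁅ y′ ⁆) ≤ 2 + r C →
    r (C ∪ ⁅ x ⁆ ∪ ⁅ y ⁆ ∪ ⁅ g ⁆) ≤ 2 + r C →
    r (C ∪ ⁅ x′ ⁆ ∪ ⁅ y′ ⁆ ∪ ⁅ g ⁆) ≤ 2 + r C →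
    r (C ∪ ⁅ e ⁆ ∪ ⁅ x ⁆ ∪ ⁅ y ⁆ ∪ ⁅ x′ ⁆ ∪ ⁅ y′ ⁆ ∪ ⁅ g ⁆) ≤ 3 + r C →
    3 + r C ≤ r (C ∪ ⁅ e ⁆ ∪ ⁅ x ⁆ ∪ ⁅ y ⁆) →
    3 + r C ≤ r (C ∪ ⁅ e ⁆ ∪ ⁅ x ⁆ ∪ ⁅ g ⁆) →
    3 + r C ≤ r (C ∪ ⁅ e ⁆ ∪ ⁅ y ⁆ ∪ ⁅ g ⁆) →
    2 + r C ≤ r (C ∪ ⁅ e ⁆ ∪ ⁅ x′ ⁆) →
    2 + r C ≤ r (C ∪ ⁅ x ⁆ ∪ ⁅ x′ ⁆) →
    2 + r C ≤ r (C ∪ ⁅ e ⁆ ∪ ⁅ y′ ⁆) →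
    2 + r C ≤ r (C ∪ ⁅ y ⁆ ∪ ⁅ y′ ⁆) →
    HasMinor (rankFn M) MK4
  K4-minor C {e} {x} {y} {x′} {y′} {g} u0 u1 u2 u3 u4 l0 l1 l2 l3 l4 l5 l6 = minor-intro M MK4 C φ inj (λ i →
      toWitness {a? = all? λ i → 1 ≤? proj₂ MK4 Sub.⁅ i ⁆} tt i) eq
    where
    φ : Fin _ → Fin n
    φ = lookup (e ∷ x ∷ y ∷ x′ ∷ y′ ∷ g ∷ [])
    eq : ∀ X → proj₂ MK4 X ≡ Mat.r (minor M C φ) (lookup X)
    eq = determine M C φ (proj₂ MK4)
      (((true ∷ true ∷ false ∷ true ∷ false ∷ false ∷ []) , 2)
      ∷ ((true ∷ false ∷ true ∷ false ∷ true ∷ false ∷ []) , 2)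
      ∷ ((false ∷ true ∷ true ∷ false ∷ false ∷ true ∷ []) , 2)
      ∷ ((false ∷ false ∷ false ∷ true ∷ true ∷ true ∷ []) , 2)
      ∷ ((true ∷ true ∷ true ∷ true ∷ true ∷ true ∷ []) , 3) ∷ [])
      (((true ∷ true ∷ true ∷ false ∷ false ∷ false ∷ []) , 3)
      ∷ ((true ∷ true ∷ false ∷ false ∷ false ∷ true ∷ []) , 3)
      ∷ ((true ∷ false ∷ true ∷ false ∷ false ∷ true ∷ []) , 3)
      ∷ ((true ∷ false ∷ false ∷ true ∷ false ∷ false ∷ []) , 2)
      ∷ ((false ∷ true ∷ false ∷ true ∷ false ∷ false ∷ []) , 2)
      ∷ ((true ∷ false ∷ false ∷ false ∷ true ∷ false ∷ []) , 2)
      ∷ ((false ∷ false ∷ true ∷ false ∷ true ∷ false ∷ []) , 2) ∷ [])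
      refl
      (m≤n+o⇒m∸n≤o _ (r C) (≤-by M (C ∷ ⁅ e ⁆ ∷ ⁅ x ⁆ ∷ ⁅ x′ ⁆ ∷ []) []
        ((rk (s0 || s1 || s2 || s3) ≼ lit 2 ⊕ rk s0) ∷ [])
        (rk (s1 || (s2 || (s3 || ∅ᵉ)) || s0) ≼ rk s0 ⊕ lit 2) [] refl tt (u0 , tt))
      ∷ m≤n+o⇒m∸n≤o _ (r C) (≤-by M (C ∷ ⁅ e ⁆ ∷ ⁅ y ⁆ ∷ ⁅ y′ ⁆ ∷ []) []
        ((rk (s0 || s1 || s2 || s3) ≼ lit 2 ⊕ rk s0) ∷ [])
        (rk (s1 || (s2 || (s3 || ∅ᵉ)) || s0) ≼ rk s0 ⊕ lit 2) [] refl tt (u1 , tt))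
      ∷ m≤n+o⇒m∸n≤o _ (r C) (≤-by M (C ∷ ⁅ x ⁆ ∷ ⁅ y ⁆ ∷ ⁅ g ⁆ ∷ []) []
        ((rk (s0 || s1 || s2 || s3) ≼ lit 2 ⊕ rk s0) ∷ [])
        (rk (s1 || (s2 || (s3 || ∅ᵉ)) || s0) ≼ rk s0 ⊕ lit 2) [] refl tt (u2 , tt))
      ∷ m≤n+o⇒m∸n≤o _ (r C) (≤-by M (C ∷ ⁅ x′ ⁆ ∷ ⁅ y′ ⁆ ∷ ⁅ g ⁆ ∷ []) []
        ((rk (s0 || s1 || s2 || s3) ≼ lit 2 ⊕ rk s0) ∷ [])
        (rk (s1 || (s2 || (s3 || ∅ᵉ)) || s0) ≼ rk s0 ⊕ lit 2) [] refl tt (u3 , tt))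
      ∷ m≤n+o⇒m∸n≤o _ (r C) (≤-by M (C ∷ ⁅ e ⁆ ∷ ⁅ x ⁆ ∷ ⁅ y ⁆ ∷ ⁅ x′ ⁆ ∷ ⁅ y′ ⁆ ∷ ⁅ g ⁆ ∷ []) []
        ((rk (s0 || s1 || s2 || s3 || s4 || s5 || s6) ≼ lit 3 ⊕ rk s0) ∷ [])
        (rk (s1 || (s2 || (s3 || (s4 || (s5 || (s6 || ∅ᵉ))))) || s0) ≼ rk s0 ⊕ lit 3) [] refl tt (u4 , tt)) ∷ [])
      (m+n≤o⇒m≤o∸n 3 (≤-by M (C ∷ ⁅ e ⁆ ∷ ⁅ x ⁆ ∷ ⁅ y ⁆ ∷ []) []
        ((lit 3 ⊕ rk s0 ≼ rk (s0 || s1 || s2 || s3)) ∷ [])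
        (lit 3 ⊕ rk s0 ≼ rk (s1 || (s2 || (s3 || ∅ᵉ)) || s0)) [] refl tt (l0 , tt))
      ∷ m+n≤o⇒m≤o∸n 3 (≤-by M (C ∷ ⁅ e ⁆ ∷ ⁅ x ⁆ ∷ ⁅ g ⁆ ∷ []) []
        ((lit 3 ⊕ rk s0 ≼ rk (s0 || s1 || s2 || s3)) ∷ [])
        (lit 3 ⊕ rk s0 ≼ rk (s1 || (s2 || (s3 || ∅ᵉ)) || s0)) [] refl tt (l1 , tt))
      ∷ m+n≤o⇒m≤o∸n 3 (≤-by M (C ∷ ⁅ e ⁆ ∷ ⁅ y ⁆ ∷ ⁅ g ⁆ ∷ []) []
        ((lit 3 ⊕ rk s0 ≼ rk (s0 || s1 || s2 || s3)) ∷ [])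
        (lit 3 ⊕ rk s0 ≼ rk (s1 || (s2 || (s3 || ∅ᵉ)) || s0)) [] refl tt (l2 , tt))
      ∷ m+n≤o⇒m≤o∸n 2 (≤-by M (C ∷ ⁅ e ⁆ ∷ ⁅ x′ ⁆ ∷ []) [] ((lit 2 ⊕ rk s0 ≼ rk (s0 || s1 || s2)) ∷ [])
        (lit 2 ⊕ rk s0 ≼ rk (s1 || (s2 || ∅ᵉ) || s0)) [] refl tt (l3 , tt))
      ∷ m+n≤o⇒m≤o∸n 2 (≤-by M (C ∷ ⁅ x ⁆ ∷ ⁅ x′ ⁆ ∷ []) [] ((lit 2 ⊕ rk s0 ≼ rk (s0 || s1 || s2)) ∷ [])
        (lit 2 ⊕ rk s0 ≼ rk (s1 || (s2 || ∅ᵉ) || s0)) [] refl tt (l4 , tt))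
      ∷ m+n≤o⇒m≤o∸n 2 (≤-by M (C ∷ ⁅ e ⁆ ∷ ⁅ y′ ⁆ ∷ []) [] ((lit 2 ⊕ rk s0 ≼ rk (s0 || s1 || s2)) ∷ [])
        (lit 2 ⊕ rk s0 ≼ rk (s1 || (s2 || ∅ᵉ) || s0)) [] refl tt (l5 , tt))
      ∷ m+n≤o⇒m≤o∸n 2 (≤-by M (C ∷ ⁅ y ⁆ ∷ ⁅ y′ ⁆ ∷ []) [] ((lit 2 ⊕ rk s0 ≼ rk (s0 || s1 || s2)) ∷ [])
        (lit 2 ⊕ rk s0 ≼ rk (s1 || (s2 || ∅ᵉ) || s0)) [] refl tt (l6 , tt)) ∷ [])
    inj : ∀ i j → φ i ≡ φ j → i ≡ j
    inj = injective-intro M MK4 C φ eq (λ i j → [ inj₁ , inj₂ ∘ inj₁ ]′ (toWitness {a? = all? λ i → all? λ j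
        → (i ≟ j) ⊎-dec (2 ≤? proj₂ MK4 (Sub.⁅ i ⁆ Sub.∪ Sub.⁅ j ⁆))} tt i j))

  -- The two edges of K₂,₃ at a vertex of degree two are in series, so the dual has three parallel
  -- pairs in rank 2; in the edge order of `K23` partners are three positions apart. Ranks cannot
  -- distinguish partners, hence the three inequations.
  K23*-minor : ∀ C {a c e b d f} →
    r (C ∪ ⁅ a ⁆ ∪ ⁅ b ⁆) ≤ 1 + r C →
    r (C ∪ ⁅ c ⁆ ∪ ⁅ d ⁆) ≤ 1 + r C →
    r (C ∪ ⁅ e ⁆ ∪ ⁅ f ⁆) ≤ 1 + r C →
    r (C ∪ ⁅ a ⁆ ∪ ⁅ b ⁆ ∪ ⁅ c ⁆ ∪ ⁅ d ⁆ ∪ ⁅ e ⁆ ∪ ⁅ f ⁆) ≤ 2 + r C →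
    2 + r C ≤ r (C ∪ ⁅ a ⁆ ∪ ⁅ c ⁆) →
    2 + r C ≤ r (C ∪ ⁅ a ⁆ ∪ ⁅ e ⁆) →
    2 + r C ≤ r (C ∪ ⁅ c ⁆ ∪ ⁅ e ⁆) →
    1 + r C ≤ r (C ∪ ⁅ b ⁆) →
    1 + r C ≤ r (C ∪ ⁅ d ⁆) →
    1 + r C ≤ r (C ∪ ⁅ f ⁆) →
    a ≢ b →
    c ≢ d →
    e ≢ f →
    HasMinor (rankFn M) MK23*
  K23*-minor C {a} {c} {e} {b} {d} {f} u0 u1 u2 u3 l0 l1 l2 l3 l4 l5 a≢b c≢d e≢f = minor-intro M MK23* C φ
      inj (λ i → toWitness {a? = all? λ i → 1 ≤? proj₂ MK23* Sub.⁅ i ⁆} tt i) eq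
    where
    φ : Fin _ → Fin n
    φ = lookup (a ∷ c ∷ e ∷ b ∷ d ∷ f ∷ [])
    eq : ∀ X → proj₂ MK23* X ≡ Mat.r (minor M C φ) (lookup X)
    eq = determine M C φ (proj₂ MK23*)
      (((true ∷ false ∷ false ∷ true ∷ false ∷ false ∷ []) , 1)
      ∷ ((false ∷ true ∷ false ∷ false ∷ true ∷ false ∷ []) , 1)
      ∷ ((false ∷ false ∷ true ∷ false ∷ false ∷ true ∷ []) , 1)
      ∷ ((true ∷ true ∷ true ∷ true ∷ true ∷ true ∷ []) , 2) ∷ [])
      (((true ∷ true ∷ false ∷ false ∷ false ∷ false ∷ []) , 2)
      ∷ ((true ∷ false ∷ true ∷ false ∷ false ∷ false ∷ []) , 2)
      ∷ ((false ∷ true ∷ true ∷ false ∷ false ∷ false ∷ []) , 2)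
      ∷ ((false ∷ false ∷ false ∷ true ∷ false ∷ false ∷ []) , 1)
      ∷ ((false ∷ false ∷ false ∷ false ∷ true ∷ false ∷ []) , 1)
      ∷ ((false ∷ false ∷ false ∷ false ∷ false ∷ true ∷ []) , 1) ∷ [])
      refl
      (m≤n+o⇒m∸n≤o _ (r C) (≤-by M (C ∷ ⁅ a ⁆ ∷ ⁅ b ⁆ ∷ []) [] ((rk (s0 || s1 || s2) ≼ lit 1 ⊕ rk s0) ∷ [])
        (rk (s1 || (s2 || ∅ᵉ) || s0) ≼ rk s0 ⊕ lit 1) [] refl tt (u0 , tt))
      ∷ m≤n+o⇒m∸n≤o _ (r C) (≤-by M (C ∷ ⁅ c ⁆ ∷ ⁅ d ⁆ ∷ []) [] ((rk (s0 || s1 || s2) ≼ lit 1 ⊕ rk s0) ∷ [])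
        (rk (s1 || (s2 || ∅ᵉ) || s0) ≼ rk s0 ⊕ lit 1) [] refl tt (u1 , tt))
      ∷ m≤n+o⇒m∸n≤o _ (r C) (≤-by M (C ∷ ⁅ e ⁆ ∷ ⁅ f ⁆ ∷ []) [] ((rk (s0 || s1 || s2) ≼ lit 1 ⊕ rk s0) ∷ [])
        (rk (s1 || (s2 || ∅ᵉ) || s0) ≼ rk s0 ⊕ lit 1) [] refl tt (u2 , tt))
      ∷ m≤n+o⇒m∸n≤o _ (r C) (≤-by M (C ∷ ⁅ a ⁆ ∷ ⁅ b ⁆ ∷ ⁅ c ⁆ ∷ ⁅ d ⁆ ∷ ⁅ e ⁆ ∷ ⁅ f ⁆ ∷ []) []
        ((rk (s0 || s1 || s2 || s3 || s4 || s5 || s6) ≼ lit 2 ⊕ rk s0) ∷ [])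
        (rk (s1 || (s3 || (s5 || (s2 || (s4 || (s6 || ∅ᵉ))))) || s0) ≼ rk s0 ⊕ lit 2) [] refl tt (u3 , tt)) ∷ [])
      (m+n≤o⇒m≤o∸n 2 (≤-by M (C ∷ ⁅ a ⁆ ∷ ⁅ c ⁆ ∷ []) [] ((lit 2 ⊕ rk s0 ≼ rk (s0 || s1 || s2)) ∷ [])
        (lit 2 ⊕ rk s0 ≼ rk (s1 || (s2 || ∅ᵉ) || s0)) [] refl tt (l0 , tt))
      ∷ m+n≤o⇒m≤o∸n 2 (≤-by M (C ∷ ⁅ a ⁆ ∷ ⁅ e ⁆ ∷ []) [] ((lit 2 ⊕ rk s0 ≼ rk (s0 || s1 || s2)) ∷ [])
        (lit 2 ⊕ rk s0 ≼ rk (s1 || (s2 || ∅ᵉ) || s0)) [] refl tt (l1 , tt))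
      ∷ m+n≤o⇒m≤o∸n 2 (≤-by M (C ∷ ⁅ c ⁆ ∷ ⁅ e ⁆ ∷ []) [] ((lit 2 ⊕ rk s0 ≼ rk (s0 || s1 || s2)) ∷ [])
        (lit 2 ⊕ rk s0 ≼ rk (s1 || (s2 || ∅ᵉ) || s0)) [] refl tt (l2 , tt))
      ∷ m+n≤o⇒m≤o∸n 1 (≤-by M (C ∷ ⁅ b ⁆ ∷ []) [] ((lit 1 ⊕ rk s0 ≼ rk (s0 || s1)) ∷ [])
        (lit 1 ⊕ rk s0 ≼ rk (s1 || ∅ᵉ || s0)) [] refl tt (l3 , tt))
      ∷ m+n≤o⇒m≤o∸n 1 (≤-by M (C ∷ ⁅ d ⁆ ∷ []) [] ((lit 1 ⊕ rk s0 ≼ rk (s0 || s1)) ∷ [])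
        (lit 1 ⊕ rk s0 ≼ rk (s1 || ∅ᵉ || s0)) [] refl tt (l4 , tt))
      ∷ m+n≤o⇒m≤o∸n 1 (≤-by M (C ∷ ⁅ f ⁆ ∷ []) [] ((lit 1 ⊕ rk s0 ≼ rk (s0 || s1)) ∷ [])
        (lit 1 ⊕ rk s0 ≼ rk (s1 || ∅ᵉ || s0)) [] refl tt (l5 , tt)) ∷ [])
    partner : Fin 6 → Fin 6
    partner = lookup (3F ∷ 4F ∷ 5F ∷ 0F ∷ 1F ∷ 2F ∷ [])
    partner-≢ : ∀ i → φ i ≢ φ (partner i)
    partner-≢ 0F = a≢b
    partner-≢ 1F = c≢d
    partner-≢ 2F = e≢f
    partner-≢ 3F = a≢b ∘ sym
    partner-≢ 4F = c≢d ∘ sym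
    partner-≢ 5F = e≢f ∘ sym
    separated : ∀ i j → i ≡ j ⊎ (2 ≤ proj₂ MK23* (Sub.⁅ i ⁆ Sub.∪ Sub.⁅ j ⁆) ⊎ partner i ≡ j)
    separated = toWitness {a? = all? λ i → all? λ j → (i ≟ j) ⊎-dec ((2 ≤? proj₂ MK23* (Sub.⁅ i ⁆ Sub.∪ Sub.⁅
        j ⁆)) ⊎-dec (partner i ≟ j))} tt
    inj : ∀ i j → φ i ≡ φ j → i ≡ j
    inj = injective-intro M MK23* C φ eq (λ i j → map₂ (map₂ λ { refl → partner-≢ i }) (separated i j))

-- Two clusters and M*(K₂,₃)

module _ {n : ℕ} (M : Mat n) (connected : Connected M) {e f : Fin n} (e≢f : e ≢ f)
         (e-active : Active M e) (f-active : Active M f) (e∥f : Mat.r M (⁅ e ⁆ ∪ ⁅ f ⁆) ≤ 1) where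
  open Mat M

  module _ {X Y : P n} (k : Link M connected f-active e∥f X Y) (A : Cluster M X Y f) where
    open Link k
    open Cluster A

    -- The defect r(S) + r(V) - r(S ∪ V) can only grow with the sets, and it vanishes for `X` and
    -- `Y`.
    skew-sum : ∀ {S V} → S ⊆ X → V ⊆ Y → r S + r V ≤ r (S ∪ V)
    skew-sum {S} {V} p q = ≤-by M (X ∷ Y ∷ S ∷ V ∷ []) ((s2 , s0) ∷ (s3 , s1) ∷ [])
      ((rk s0 ⊕ rk s1 ≼ rk 𝟙ᵉ) ∷ (rk 𝟙ᵉ ≼ rk (s0 || s1)) ∷ []) (rk s2 ⊕ rk s3 ≼ rk (s2 || s3))
      (sub s0 (s2 || s3) ∷ sub s1 (s0 || s3) ∷ mon s2 (s0 && (s2 || s3)) ∷ mon s3 (s1 && (s0 || s3)) ∷ [])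
      refl (p , q , tt) (skew , span , tt)

    -- After contraction of `K ∪ Y` both elements are parallel to `f`; since `X` and `Y` are skew,
    -- `Y` can then be dropped from the contraction.
    cluster-∥ : r (K ∪ ⁅ a ⁆ ∪ ⁅ b ⁆) ≤ 1 + r K
    cluster-∥ = ≤-by M (Y ∷ K ∷ ⁅ a ⁆ ∷ ⁅ b ⁆ ∷ []) []
      ((rk (s1 || s0 || s2 || s3) ≼ lit 1 ⊕ rk (s1 || s0)) ∷
      (rk (s1 || s2 || s3) ⊕ rk s0 ≼ rk (s1 || s2 || s3 || s0)) ∷ []) (rk (s1 || s2 || s3) ≼ lit 1 ⊕ rk s1)
      (sub s0 s1 ∷ []) refl tt (h₁ , h₂ , tt)
      where
      h₁ : r (K ∪ Y ∪ ⁅ a ⁆ ∪ ⁅ b ⁆) ≤ 1 + r (K ∪ Y)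
      h₁ = ≤-by M (Y ∷ K ∷ ⁅ a ⁆ ∷ ⁅ b ⁆ ∷ ⁅ f ⁆ ∷ []) [] ((lit 1 ⊕ rk (s1 || s0) ≼ rk (s1 || s0 || s4)) ∷
        (rk (s1 || s2 || s0 || s4) ≼ rk (s1 || s2 || s0)) ∷
        (rk (s1 || s3 || s0 || s4) ≼ rk (s1 || s3 || s0)) ∷ (rk s2 ≼ lit 1) ∷ (rk s3 ≼ lit 1) ∷ [])
        (rk (s1 || s0 || s2 || s3) ≼ lit 1 ⊕ rk (s1 || s0)) (sub (s1 || s0) s2 ∷ sub (s1 || s0) s3 ∷
        mon (s1 || s0 || s4) ((s1 || s2 || s0 || s4) && (s1 || s3 || s0 || s4)) ∷
        sub (s1 || s2 || s0 || s4) (s1 || s3 || s0 || s4) ∷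
        mon (s1 || s0 || s2 || s3) (s1 || s0 || s4 || (s1 || s0 || s2 || s3)) ∷ []) refl tt
        (f-avoids , a-spans , b-spans , Mat.r1 M a , Mat.r1 M b , tt)
      h₂ : r (K ∪ ⁅ a ⁆ ∪ ⁅ b ⁆) + r Y ≤ r (K ∪ ⁅ a ⁆ ∪ ⁅ b ⁆ ∪ Y)
      h₂ = skew-sum (⊆-by (X ∷ K ∷ ⁅ a ⁆ ∷ ⁅ b ⁆ ∷ []) ((s1 , s0) ∷ (s2 , s0) ∷ (s3 , s0) ∷ []) (s1 || s2 ||
          s3) s0 refl (K⊆X , a∈X , b∈X , tt)) (⊆-refl Y)

    cluster-a : 1 + r K ≤ r (K ∪ ⁅ a ⁆)
    cluster-a = ≤-by M (Y ∷ K ∷ ⁅ a ⁆ ∷ ⁅ f ⁆ ∷ []) [] ((lit 1 ⊕ rk (s1 || s0) ≼ rk (s1 || s0 || s3)) ∷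
      (rk (s1 || s2 || s0 || s3) ≼ rk (s1 || s2 || s0)) ∷ []) (lit 1 ⊕ rk s1 ≼ rk (s1 || s2))
      (sub (s1 || s0) (s1 || s2) ∷ mon (s1 || s0 || s3) (s1 || s2 || s0 || s3) ∷
      mon s1 ((s1 || s0) && (s1 || s2)) ∷ []) refl tt (f-avoids , a-spans , tt)

    cluster-b : 1 + r K ≤ r (K ∪ ⁅ b ⁆)
    cluster-b = ≤-by M (Y ∷ K ∷ ⁅ b ⁆ ∷ ⁅ f ⁆ ∷ []) [] ((lit 1 ⊕ rk (s1 || s0) ≼ rk (s1 || s0 || s3)) ∷
      (rk (s1 || s2 || s0 || s3) ≼ rk (s1 || s2 || s0)) ∷ []) (lit 1 ⊕ rk s1 ≼ rk (s1 || s2))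
      (sub (s1 || s0) (s1 || s2) ∷ mon (s1 || s0 || s3) (s1 || s2 || s0 || s3) ∷
      mon s1 ((s1 || s0) && (s1 || s2)) ∷ []) refl tt (f-avoids , b-spans , tt)


  module _ {X Y : P n} (k : Link M connected f-active e∥f X Y) (A : Cluster M X Y f) (B : Cluster M Y X f) where
    open Link k
    private
      module A = Cluster A
      module B = Cluster B
      K = A.K
      L = B.K
      a = A.a
      b = A.b
      c = B.a
      d = B.b
      k′ = link-sym M connected f-active e∥f k

      KL : r K + r L ≤ r (K ∪ L)
      KL = skew-sum k A A.K⊆X B.K⊆X

      KaLc : r (K ∪ ⁅ a ⁆) + r (L ∪ ⁅ c ⁆) ≤ r (K ∪ ⁅ a ⁆ ∪ (L ∪ ⁅ c ⁆))
      KaLc = let p = A.K⊆X ; q = A.a∈X ; p′ = B.K⊆X ; q′ = B.a∈X in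
        skew-sum k A (⊆-by (X ∷ K ∷ ⁅ a ⁆ ∷ []) ((s1 , s0) ∷ (s2 , s0) ∷ []) (s1 || s2) s0 refl (p , q , tt))
            (⊆-by (Y ∷ L ∷ ⁅ c ⁆ ∷ []) ((s1 , s0) ∷ (s2 , s0) ∷ []) (s1 || s2) s0 refl (p′ , q′ , tt))

      KLb : r (K ∪ ⁅ b ⁆) + r L ≤ r (K ∪ ⁅ b ⁆ ∪ L)
      KLb = let p = A.K⊆X ; q = A.b∈X in skew-sum k A (⊆-by (X ∷ K ∷ ⁅ b ⁆ ∷ []) ((s1 , s0) ∷ (s2 , s0) ∷ []) (s1 || s2) s0 refl (p , q , tt)) B.K⊆X

      KLd : r K + r (L ∪ ⁅ d ⁆) ≤ r (K ∪ (L ∪ ⁅ d ⁆))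
      KLd = let p = B.K⊆X ; q = B.b∈X in skew-sum k A A.K⊆X (⊆-by (Y ∷ L ∷ ⁅ d ⁆ ∷ []) ((s1 , s0) ∷ (s2 , s0) ∷ []) (s1 || s2) s0 refl (p , q , tt))

      f-rank = proj₁ f-active
      e-rank = proj₁ e-active
      ab = cluster-∥ k A
      cd = cluster-∥ k′ B
      ka = cluster-a k A
      kb = cluster-b k A
      lc = cluster-a k′ B
      ld = cluster-b k′ B

      -- `f` is spanned by `K`, `a` and `Y`, and also by `L`, `c` and `X`. Submodularity applied to
      -- these two sets, each with `f`, has a union of rank r(X) + r(Y), and the sets asked for lie
      -- in the intersection.
      whole : r (K ∪ L ∪ ⁅ a ⁆ ∪ ⁅ c ⁆ ∪ ⁅ f ⁆) ≤ 2 + r (K ∪ L)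
      whole = let p = A.K⊆X ; q = A.a∈X ; p′ = B.K⊆X ; q′ = B.a∈X ; sa = A.a-spans ; sc = B.a-spans ; XY = skew-sum k A (⊆-refl X) (⊆-refl Y)
                  ra : r (K ∪ ⁅ a ⁆ ∪ Y ∪ ⁅ f ⁆) ≤ 1 + r K + r Y
                  ra = ≤-by M (Y ∷ K ∷ ⁅ a ⁆ ∷ ⁅ f ⁆ ∷ []) []
                    ((rk (s1 || s2 || s0 || s3) ≼ rk (s1 || s2 || s0)) ∷ (rk s2 ≼ lit 1) ∷ [])
                    (rk (s1 || s2 || s0 || s3) ≼ lit 1 ⊕ rk s1 ⊕ rk s0) (sub s2 (s1 || s0) ∷ sub s1 s0 ∷ [])
                    refl tt (sa , Mat.r1 M a , tt)
                  rc : r (L ∪ ⁅ c ⁆ ∪ X ∪ ⁅ f ⁆) ≤ 1 + r L + r X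
                  rc = ≤-by M (X ∷ L ∷ ⁅ c ⁆ ∷ ⁅ f ⁆ ∷ []) []
                    ((rk (s1 || s2 || s0 || s3) ≼ rk (s1 || s2 || s0)) ∷ (rk s2 ≼ lit 1) ∷ [])
                    (rk (s1 || s2 || s0 || s3) ≼ lit 1 ⊕ rk s1 ⊕ rk s0) (sub s2 (s1 || s0) ∷ sub s1 s0 ∷ [])
                    refl tt (sc , Mat.r1 M c , tt)
              in
        (≤-by M (X ∷ Y ∷ K ∷ L ∷ ⁅ a ⁆ ∷ ⁅ c ⁆ ∷ ⁅ f ⁆ ∷ []) ((s2 , s0) ∷ (s4 , s0) ∷ (s3 , s1) ∷
          (s5 , s1) ∷ []) ((rk s0 ⊕ rk s1 ≼ rk (s0 || s1)) ∷ (rk s2 ⊕ rk s3 ≼ rk (s2 || s3)) ∷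
          (rk (s2 || s4 || s1 || s6) ≼ lit 1 ⊕ rk s2 ⊕ rk s1) ∷
          (rk (s3 || s5 || s0 || s6) ≼ lit 1 ⊕ rk s3 ⊕ rk s0) ∷ [])
          (rk (s2 || s3 || s4 || s5 || s6) ≼ lit 2 ⊕ rk (s2 || s3))
          (mon (s0 || s1) (s0 || (s2 || s4 || s1 || s6)) ∷
          sub (s2 || s4 || s1 || s6) (s3 || s5 || s0 || s6) ∷
          mon (s2 || s3 || s4 || s5 || s6) ((s2 || s4 || s1 || s6) && (s3 || s5 || s0 || s6)) ∷ []) refl
          (p , q , p′ , q′ , tt) (XY , KL , ra , rc , tt))

      swap : ∀ S → r (S ∪ ⁅ f ⁆) ≤ r (S ∪ ⁅ e ⁆)
      swap S = ≤-by M (S ∷ ⁅ e ⁆ ∷ ⁅ f ⁆ ∷ []) [] ((rk (s1 || s2) ≼ lit 1) ∷ (lit 1 ≼ rk s1) ∷ [])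
        (rk (s0 || s2) ≼ rk (s0 || s1)) (sub (s1 || s2) (s0 || s1) ∷ mon s1 ((s1 || s2) && (s0 || s1)) ∷
        mon (s0 || s2) (s1 || s2 || (s0 || s2)) ∷ []) refl tt (e∥f , e-rank , tt)

      add-spanned : ∀ {S W x} → S ⊆ W → r (S ∪ ⁅ x ⁆) ≤ r S → r (W ∪ ⁅ x ⁆) ≤ r W
      add-spanned {S} {W} {x} p h = ≤-by M (S ∷ W ∷ ⁅ x ⁆ ∷ []) ((s0 , s1) ∷ []) ((rk (s0 || s2) ≼ rk s0) ∷
        []) (rk (s1 || s2) ≼ rk s1) (sub (s0 || s2) s1 ∷ mon s0 ((s0 || s2) && s1) ∷ []) refl (p , tt)
        (h , tt)

      all-six : r (K ∪ L ∪ ⁅ a ⁆ ∪ ⁅ b ⁆ ∪ ⁅ c ⁆ ∪ ⁅ d ⁆ ∪ ⁅ e ⁆ ∪ ⁅ f ⁆) ≤ 2 + r (K ∪ L)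
      all-six = ≤-trans
        (mono (⊆-by (K ∷ L ∷ ⁅ a ⁆ ∷ ⁅ b ⁆ ∷ ⁅ c ⁆ ∷ ⁅ d ⁆ ∷ ⁅ e ⁆ ∷ ⁅ f ⁆ ∷ []) [] (s0 || s1 || s2 || s3 ||
            s4 || s5 || s6 || s7) (s0 || s1 || s2 || s4 || s7 || s3 || s5 || s6) refl tt))
        (≤-trans (add-spanned {⁅ f ⁆} (⊆-by (K ∷ L ∷ ⁅ a ⁆ ∷ ⁅ b ⁆ ∷ ⁅ c ⁆ ∷ ⁅ d ⁆ ∷ ⁅ f ⁆ ∷ []) [] s6 (s0 ||
            s1 || s2 || s4 || s6 || s3 || s5) refl tt)
                   (≤-by M (⁅ e ⁆ ∷ ⁅ f ⁆ ∷ []) [] ((rk (s0 || s1) ≼ lit 1) ∷ (lit 1 ≼ rk s1) ∷ [])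
                     (rk (s1 || s0) ≼ rk s1) [] refl tt (e∥f , f-rank , tt)))
        (≤-trans (add-spanned {L ∪ ⁅ c ⁆} (⊆-by (K ∷ L ∷ ⁅ a ⁆ ∷ ⁅ b ⁆ ∷ ⁅ c ⁆ ∷ ⁅ f ⁆ ∷ []) [] (s1 || s4)
            (s0 || s1 || s2 || s4 || s5 || s3) refl tt) (≤-trans cd lc))
        (≤-trans (add-spanned {K ∪ ⁅ a ⁆} (⊆-by (K ∷ L ∷ ⁅ a ⁆ ∷ ⁅ c ⁆ ∷ ⁅ f ⁆ ∷ []) [] (s0 || s2) (s0 || s1
            || s2 || s3 || s4) refl tt) (≤-trans ab ka)) whole)))

      KaL : r (K ∪ ⁅ a ⁆) + r L ≤ r (K ∪ ⁅ a ⁆ ∪ L)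
      KaL = let p = A.K⊆X ; q = A.a∈X in skew-sum k A (⊆-by (X ∷ K ∷ ⁅ a ⁆ ∷ []) ((s1 , s0) ∷ (s2 , s0) ∷ []) (s1 || s2) s0 refl (p , q , tt)) B.K⊆X
      KLc : r K + r (L ∪ ⁅ c ⁆) ≤ r (K ∪ (L ∪ ⁅ c ⁆))
      KLc = let p = B.K⊆X ; q = B.a∈X in skew-sum k A A.K⊆X (⊆-by (Y ∷ L ∷ ⁅ c ⁆ ∷ []) ((s1 , s0) ∷ (s2 , s0) ∷ []) (s1 || s2) s0 refl (p , q , tt))

    -- Contracting `K ∪ L` leaves three parallel pairs. `a` and `c` stay apart because they come
    -- from skew sides; `f` is spanned neither by `X ∪ L` nor by `Y ∪ K`, which keeps it off `a` and
    -- `c`, and `e` can replace `f`.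
    clusters-K23* : HasMinor (rankFn M) MK23*
    clusters-K23* = K23*-minor M (K ∪ L) {a} {c} {e} {b} {d} {f}
      (≤-by M (K ∷ L ∷ ⁅ a ⁆ ∷ ⁅ b ⁆ ∷ []) [] ((rk (s0 || s2 || s3) ≼ lit 1 ⊕ rk s0) ∷ [])
        (rk (s0 || s1 || s2 || s3) ≼ lit 1 ⊕ rk (s0 || s1)) (sub (s0 || s2 || s3) (s0 || s1) ∷
        mon s0 ((s0 || s2 || s3) && (s0 || s1)) ∷ []) refl tt (ab , tt))
      (≤-by M (K ∷ L ∷ ⁅ c ⁆ ∷ ⁅ d ⁆ ∷ []) [] ((rk (s1 || s2 || s3) ≼ lit 1 ⊕ rk s1) ∷ [])
        (rk (s0 || s1 || s2 || s3) ≼ lit 1 ⊕ rk (s0 || s1)) (sub (s1 || s2 || s3) (s0 || s1) ∷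
        mon s1 ((s1 || s2 || s3) && (s0 || s1)) ∷ []) refl tt (cd , tt))
      (≤-by M (K ∷ L ∷ ⁅ e ⁆ ∷ ⁅ f ⁆ ∷ []) [] ((rk (s2 || s3) ≼ lit 1) ∷ [])
        (rk (s0 || s1 || s2 || s3) ≼ lit 1 ⊕ rk (s0 || s1)) (sub (s2 || s3) (s0 || s1) ∷ []) refl tt
        (e∥f , tt))
      all-six
      (≤-by M (K ∷ L ∷ ⁅ a ⁆ ∷ ⁅ c ⁆ ∷ []) []
        ((rk (s0 || s2) ⊕ rk (s1 || s3) ≼ rk (s0 || s2 || (s1 || s3))) ∷ (lit 1 ⊕ rk s0 ≼ rk (s0 || s2)) ∷
        (lit 1 ⊕ rk s1 ≼ rk (s1 || s3)) ∷ []) (lit 2 ⊕ rk (s0 || s1) ≼ rk (s0 || s1 || s2 || s3))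
        (sub s0 s1 ∷ []) refl tt (KaLc , ka , lc , tt))
      (≤-trans (let p = A.K⊆X ; q = A.a∈X ; av = B.f-avoids in
        (≤-by M (X ∷ K ∷ L ∷ ⁅ a ⁆ ∷ ⁅ f ⁆ ∷ []) ((s1 , s0) ∷ (s3 , s0) ∷ [])
          ((lit 1 ⊕ rk (s2 || s0) ≼ rk (s2 || s0 || s4)) ∷ (lit 1 ⊕ rk s1 ≼ rk (s1 || s3)) ∷
          (rk (s1 || s3) ⊕ rk s2 ≼ rk (s1 || s3 || s2)) ∷ [])
          (lit 2 ⊕ rk (s1 || s2) ≼ rk (s1 || s2 || s3 || s4)) (sub (s2 || s0) (s1 || s2 || s3 || s4) ∷
          sub s1 s2 ∷ mon (s1 || s3 || s2) ((s2 || s0) && (s1 || s2 || s3 || s4)) ∷ []) refl (p , q , tt)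
          (av , ka , KaL , tt))) (swap (K ∪ L ∪ ⁅ a ⁆)))
      (≤-trans (let p = B.K⊆X ; q = B.a∈X ; av = A.f-avoids in
        (≤-by M (Y ∷ K ∷ L ∷ ⁅ c ⁆ ∷ ⁅ f ⁆ ∷ []) ((s2 , s0) ∷ (s3 , s0) ∷ [])
          ((lit 1 ⊕ rk (s1 || s0) ≼ rk (s1 || s0 || s4)) ∷ (lit 1 ⊕ rk s2 ≼ rk (s2 || s3)) ∷
          (rk s1 ⊕ rk (s2 || s3) ≼ rk (s1 || (s2 || s3))) ∷ [])
          (lit 2 ⊕ rk (s1 || s2) ≼ rk (s1 || s2 || s3 || s4)) (sub (s1 || s0) (s1 || s2 || s3 || s4) ∷
          sub s2 s1 ∷ mon (s1 || (s2 || s3)) ((s1 || s0) && (s1 || s2 || s3 || s4)) ∷ []) refl (p , q , tt)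
          (av , lc , KLc , tt))) (swap (K ∪ L ∪ ⁅ c ⁆)))
      (≤-by M (K ∷ L ∷ ⁅ b ⁆ ∷ []) [] ((rk (s0 || s2) ⊕ rk s1 ≼ rk (s0 || s2 || s1)) ∷
        (lit 1 ⊕ rk s0 ≼ rk (s0 || s2)) ∷ []) (lit 1 ⊕ rk (s0 || s1) ≼ rk (s0 || s1 || s2)) (sub s1 s0 ∷ [])
        refl tt (KLb , kb , tt))
      (≤-by M (K ∷ L ∷ ⁅ d ⁆ ∷ []) [] ((rk s0 ⊕ rk (s1 || s2) ≼ rk (s0 || (s1 || s2))) ∷
        (lit 1 ⊕ rk s1 ≼ rk (s1 || s2)) ∷ []) (lit 1 ⊕ rk (s0 || s1) ≼ rk (s0 || s1 || s2)) (sub s0 s1 ∷ [])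
        refl tt (KLd , ld , tt))
      (let p = A.K⊆X ; av = B.f-avoids in (≤-by M (X ∷ K ∷ L ∷ ⁅ f ⁆ ∷ []) ((s1 , s0) ∷ [])
        ((lit 1 ⊕ rk (s2 || s0) ≼ rk (s2 || s0 || s3)) ∷ []) (lit 1 ⊕ rk (s1 || s2) ≼ rk (s1 || s2 || s3))
        (sub (s2 || s0) (s1 || s2 || s3) ∷ mon (s1 || s2) ((s2 || s0) && (s1 || s2 || s3)) ∷ []) refl
        (p , tt) (av , tt)))
      A.a≢b B.a≢b e≢f

-- Matroids without parallel or series pairs

module _ {n : ℕ} (M : Mat n) where
  open Mat M

  -- After contraction of B the lines {e,x,x′} and {e,y,y′} span a plane that contains g off both lines.
  record TwoLines (B : P n) (e x x′ y y′ g : Fin n) : Set where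
    field
      x-line : r (⁅ e ⁆ ∪ ⁅ x ⁆ ∪ ⁅ x′ ⁆) ≤ 2
      y-line : r (⁅ e ⁆ ∪ ⁅ y ⁆ ∪ ⁅ y′ ⁆) ≤ 2
      ex     : 2 ≤ r (⁅ e ⁆ ∪ ⁅ x ⁆)
      ex′    : 2 ≤ r (⁅ e ⁆ ∪ ⁅ x′ ⁆)
      xx′    : 2 ≤ r (⁅ x ⁆ ∪ ⁅ x′ ⁆)
      ey     : 2 ≤ r (⁅ e ⁆ ∪ ⁅ y ⁆)
      ey′    : 2 ≤ r (⁅ e ⁆ ∪ ⁅ y′ ⁆)
      yy′    : 2 ≤ r (⁅ y ⁆ ∪ ⁅ y′ ⁆)
      exy    : 3 + r B ≤ r (B ∪ ⁅ e ⁆ ∪ ⁅ x ⁆ ∪ ⁅ y ⁆)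
      exg    : 3 + r B ≤ r (B ∪ ⁅ e ⁆ ∪ ⁅ x ⁆ ∪ ⁅ g ⁆)
      eyg    : 3 + r B ≤ r (B ∪ ⁅ e ⁆ ∪ ⁅ y ⁆ ∪ ⁅ g ⁆)
      plane  : r (B ∪ ⁅ e ⁆ ∪ ⁅ x ⁆ ∪ ⁅ y ⁆ ∪ ⁅ g ⁆) ≤ 3 + r B

  module _ {B : P n} {e x x′ y y′ g : Fin n} (k : TwoLines B e x x′ y y′ g) where
    open TwoLines k

    flip-lines : TwoLines B e y y′ x x′ g
    flip-lines = record
      { x-line = y-line ; y-line = x-line ; ex = ey ; ex′ = ey′ ; xx′ = yy′ ; ey = ex ; ey′ = ex′ ; yy′ = xx′
          ; exg = eyg ; eyg = exg
      ; exy = ≤-by M (B ∷ ⁅ e ⁆ ∷ ⁅ x ⁆ ∷ ⁅ y ⁆ ∷ []) [] ((lit 3 ⊕ rk s0 ≼ rk (s0 || s1 || s2 || s3)) ∷ [])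
        (lit 3 ⊕ rk s0 ≼ rk (s0 || s1 || s3 || s2)) [] refl tt (exy , tt)
      ; plane = (≤-by M (B ∷ ⁅ e ⁆ ∷ ⁅ x ⁆ ∷ ⁅ y ⁆ ∷ ⁅ g ⁆ ∷ []) []
        ((rk (s0 || s1 || s2 || s3 || s4) ≼ lit 3 ⊕ rk s0) ∷ [])
        (rk (s0 || s1 || s3 || s2 || s4) ≼ lit 3 ⊕ rk s0) [] refl tt (plane , tt)) }

    x-closure : r (⁅ e ⁆ ∪ ⁅ x ⁆ ∪ ⁅ x′ ⁆) ≤ r (⁅ e ⁆ ∪ ⁅ x ⁆)
    x-closure = ≤-trans x-line ex

    x′-closure : r (⁅ e ⁆ ∪ ⁅ x ⁆ ∪ ⁅ x′ ⁆) ≤ r (⁅ e ⁆ ∪ ⁅ x′ ⁆)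
    x′-closure = ≤-trans x-line ex′

    xx′-closure : r (⁅ e ⁆ ∪ ⁅ x ⁆ ∪ ⁅ x′ ⁆) ≤ r (⁅ x ⁆ ∪ ⁅ x′ ⁆)
    xx′-closure = ≤-trans x-line xx′

    line-spans : ∀ S → r (S ∪ ⁅ e ⁆ ∪ ⁅ x ⁆) ≤ r (S ∪ ⁅ e ⁆ ∪ ⁅ x′ ⁆)
    line-spans S = ≤-by M (S ∷ ⁅ e ⁆ ∷ ⁅ x ⁆ ∷ ⁅ x′ ⁆ ∷ []) [] ((rk (s1 || s2 || s3) ≼ rk (s1 || s3)) ∷ [])
      (rk (s0 || s1 || s2) ≼ rk (s0 || s1 || s3)) (sub (s1 || s2 || s3) (s0 || s1 || s3) ∷
      mon (s1 || s3) ((s1 || s2 || s3) && (s0 || s1 || s3)) ∷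
      mon (s0 || s1 || s2) (s1 || s2 || s3 || (s0 || s1 || s2)) ∷ []) refl tt (x′-closure , tt)

    line-spans′ : ∀ S → r (S ∪ ⁅ e ⁆ ∪ ⁅ x′ ⁆) ≤ r (S ∪ ⁅ e ⁆ ∪ ⁅ x ⁆)
    line-spans′ S = ≤-by M (S ∷ ⁅ e ⁆ ∷ ⁅ x ⁆ ∷ ⁅ x′ ⁆ ∷ []) [] ((rk (s1 || s2 || s3) ≼ rk (s1 || s2)) ∷
      []) (rk (s0 || s1 || s3) ≼ rk (s0 || s1 || s2)) (sub (s1 || s2 || s3) (s0 || s1 || s2) ∷
      mon (s1 || s2) ((s1 || s2 || s3) && (s0 || s1 || s2)) ∷
      mon (s0 || s1 || s3) (s1 || s2 || s3 || (s0 || s1 || s3)) ∷ []) refl tt (x-closure , tt)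

    pair-spans : ∀ S → r (S ∪ ⁅ e ⁆ ∪ ⁅ x ⁆) ≤ r (S ∪ ⁅ x ⁆ ∪ ⁅ x′ ⁆)
    pair-spans S = ≤-by M (S ∷ ⁅ e ⁆ ∷ ⁅ x ⁆ ∷ ⁅ x′ ⁆ ∷ []) [] ((rk (s1 || s2 || s3) ≼ rk (s2 || s3)) ∷ [])
      (rk (s0 || s1 || s2) ≼ rk (s0 || s2 || s3)) (sub (s1 || s2 || s3) (s0 || s2 || s3) ∷
      mon (s2 || s3) ((s1 || s2 || s3) && (s0 || s2 || s3)) ∷
      mon (s0 || s1 || s2) (s1 || s2 || s3 || (s0 || s1 || s2)) ∷ []) refl tt (xx′-closure , tt)

    swap-x : TwoLines B e x′ x y y′ g
    swap-x = record
      { y-line = y-line ; ex = ex′ ; ex′ = ex ; ey = ey ; ey′ = ey′ ; yy′ = yy′ ; eyg = eyg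
      ; x-line = ≤-by M (⁅ e ⁆ ∷ ⁅ x ⁆ ∷ ⁅ x′ ⁆ ∷ []) [] ((rk (s0 || s1 || s2) ≼ lit 2) ∷ [])
        (rk (s0 || s2 || s1) ≼ lit 2) [] refl tt (x-line , tt)
      ; xx′    = ≤-by M (⁅ x ⁆ ∷ ⁅ x′ ⁆ ∷ []) [] ((lit 2 ≼ rk (s0 || s1)) ∷ []) (lit 2 ≼ rk (s1 || s0)) []
        refl tt (xx′ , tt)
      ; exy    = let h = line-spans (B ∪ ⁅ y ⁆) in (≤-by M (B ∷ ⁅ e ⁆ ∷ ⁅ x ⁆ ∷ ⁅ x′ ⁆ ∷ ⁅ y ⁆ ∷ []) []
        ((rk (s0 || s4 || s1 || s2) ≼ rk (s0 || s4 || s1 || s3)) ∷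
        (lit 3 ⊕ rk s0 ≼ rk (s0 || s1 || s2 || s4)) ∷ []) (lit 3 ⊕ rk s0 ≼ rk (s0 || s1 || s3 || s4)) []
        refl tt (h , exy , tt))
      ; exg    = let h = line-spans (B ∪ ⁅ g ⁆) in (≤-by M (B ∷ ⁅ e ⁆ ∷ ⁅ x ⁆ ∷ ⁅ x′ ⁆ ∷ ⁅ g ⁆ ∷ []) []
        ((rk (s0 || s4 || s1 || s2) ≼ rk (s0 || s4 || s1 || s3)) ∷
        (lit 3 ⊕ rk s0 ≼ rk (s0 || s1 || s2 || s4)) ∷ []) (lit 3 ⊕ rk s0 ≼ rk (s0 || s1 || s3 || s4)) []
        refl tt (h , exg , tt))
      ; plane  = let h = line-spans′ (B ∪ ⁅ y ⁆ ∪ ⁅ g ⁆) in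
          (≤-by M (B ∷ ⁅ e ⁆ ∷ ⁅ x ⁆ ∷ ⁅ x′ ⁆ ∷ ⁅ y ⁆ ∷ ⁅ g ⁆ ∷ []) []
            ((rk (s0 || s4 || s5 || s1 || s3) ≼ rk (s0 || s4 || s5 || s1 || s2)) ∷
            (rk (s0 || s1 || s2 || s4 || s5) ≼ lit 3 ⊕ rk s0) ∷ [])
            (rk (s0 || s1 || s3 || s4 || s5) ≼ lit 3 ⊕ rk s0) [] refl tt (h , plane , tt)) }

  swap-y : ∀ {B e x x′ y y′ g} → TwoLines B e x x′ y y′ g → TwoLines B e x x′ y′ y g
  swap-y k = flip-lines (swap-x (flip-lines k))

  module _ {B : P n} {e x x′ y y′ g : Fin n} (k : TwoLines B e x x′ y y′ g) where
    open TwoLines k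

    two-lines-K4 : r (B ∪ ⁅ x ⁆ ∪ ⁅ y ⁆ ∪ ⁅ g ⁆) ≤ 2 + r B → r (B ∪ ⁅ x′ ⁆ ∪ ⁅ y′ ⁆ ∪ ⁅ g ⁆) ≤ 2 + r B →
        HasMinor (rankFn M) MK4
    two-lines-K4 xyg x′y′g = K4-minor M B {e} {x} {y} {x′} {y′} {g}
      (≤-by M (B ∷ ⁅ e ⁆ ∷ ⁅ x ⁆ ∷ ⁅ x′ ⁆ ∷ []) [] ((rk (s1 || s2 || s3) ≼ lit 2) ∷ [])
        (rk (s0 || s1 || s2 || s3) ≼ lit 2 ⊕ rk s0) (sub (s1 || s2 || s3) s0 ∷ []) refl tt (x-line , tt))
      (≤-by M (B ∷ ⁅ e ⁆ ∷ ⁅ y ⁆ ∷ ⁅ y′ ⁆ ∷ []) [] ((rk (s1 || s2 || s3) ≼ lit 2) ∷ [])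
        (rk (s0 || s1 || s2 || s3) ≼ lit 2 ⊕ rk s0) (sub (s1 || s2 || s3) s0 ∷ []) refl tt (y-line , tt))
      xyg x′y′g all-six exy exg eyg
      (let h = line-spans k B in (≤-by M (B ∷ ⁅ e ⁆ ∷ ⁅ x ⁆ ∷ ⁅ x′ ⁆ ∷ ⁅ y ⁆ ∷ []) []
        ((rk (s0 || s1 || s2) ≼ rk (s0 || s1 || s3)) ∷ (lit 3 ⊕ rk s0 ≼ rk (s0 || s1 || s2 || s4)) ∷
        (rk s4 ≼ lit 1) ∷ []) (lit 2 ⊕ rk s0 ≼ rk (s0 || s1 || s3)) (sub (s0 || s1 || s2) s4 ∷ []) refl tt
        (h , exy , Mat.r1 M y , tt)))
      (let h = pair-spans k B in (≤-by M (B ∷ ⁅ e ⁆ ∷ ⁅ x ⁆ ∷ ⁅ x′ ⁆ ∷ ⁅ y ⁆ ∷ []) []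
        ((rk (s0 || s1 || s2) ≼ rk (s0 || s2 || s3)) ∷ (lit 3 ⊕ rk s0 ≼ rk (s0 || s1 || s2 || s4)) ∷
        (rk s4 ≼ lit 1) ∷ []) (lit 2 ⊕ rk s0 ≼ rk (s0 || s2 || s3)) (sub (s0 || s1 || s2) s4 ∷ []) refl tt
        (h , exy , Mat.r1 M y , tt)))
      (let h = line-spans (flip-lines k) B in (≤-by M (B ∷ ⁅ e ⁆ ∷ ⁅ y ⁆ ∷ ⁅ y′ ⁆ ∷ ⁅ x ⁆ ∷ []) []
        ((rk (s0 || s1 || s2) ≼ rk (s0 || s1 || s3)) ∷ (lit 3 ⊕ rk s0 ≼ rk (s0 || s1 || s4 || s2)) ∷
        (rk s4 ≼ lit 1) ∷ []) (lit 2 ⊕ rk s0 ≼ rk (s0 || s1 || s3)) (sub (s0 || s1 || s2) s4 ∷ []) refl tt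
        (h , exy , Mat.r1 M x , tt)))
      (let h = pair-spans (flip-lines k) B in (≤-by M (B ∷ ⁅ e ⁆ ∷ ⁅ y ⁆ ∷ ⁅ y′ ⁆ ∷ ⁅ x ⁆ ∷ []) []
        ((rk (s0 || s1 || s2) ≼ rk (s0 || s2 || s3)) ∷ (lit 3 ⊕ rk s0 ≼ rk (s0 || s1 || s4 || s2)) ∷
        (rk s4 ≼ lit 1) ∷ []) (lit 2 ⊕ rk s0 ≼ rk (s0 || s2 || s3)) (sub (s0 || s1 || s2) s4 ∷ []) refl tt
        (h , exy , Mat.r1 M x , tt)))
      where
      all-six : r (B ∪ ⁅ e ⁆ ∪ ⁅ x ⁆ ∪ ⁅ y ⁆ ∪ ⁅ x′ ⁆ ∪ ⁅ y′ ⁆ ∪ ⁅ g ⁆) ≤ 3 + r B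
      all-six = let h = x-closure k ; h′ = x-closure (flip-lines k) in
        (≤-by M (B ∷ ⁅ e ⁆ ∷ ⁅ x ⁆ ∷ ⁅ x′ ⁆ ∷ ⁅ y ⁆ ∷ ⁅ y′ ⁆ ∷ ⁅ g ⁆ ∷ []) []
          ((rk (s1 || s2 || s3) ≼ rk (s1 || s2)) ∷ (rk (s1 || s4 || s5) ≼ rk (s1 || s4)) ∷
          (rk (s0 || s1 || s2 || s4 || s6) ≼ lit 3 ⊕ rk s0) ∷ [])
          (rk (s0 || s1 || s2 || s4 || s3 || s5 || s6) ≼ lit 3 ⊕ rk s0)
          (sub (s1 || s2 || s3) (s0 || s1 || s2 || s4 || s6) ∷
          mon (s1 || s2) ((s1 || s2 || s3) && (s0 || s1 || s2 || s4 || s6)) ∷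
          sub (s1 || s4 || s5) (s0 || s1 || s2 || s4 || s6 || s3) ∷
          mon (s1 || s4) ((s1 || s4 || s5) && (s0 || s1 || s2 || s4 || s6 || s3)) ∷ []) refl tt
          (h , h′ , plane , tt))

    -- Contracting `g` as well projects the plane onto a line, on which `e`, `x`, `y` and `y′` have
    -- distinct images.
    two-lines-U24 : 3 + r B ≤ r (B ∪ ⁅ x ⁆ ∪ ⁅ y ⁆ ∪ ⁅ g ⁆) → 3 + r B ≤ r (B ∪ ⁅ x ⁆ ∪ ⁅ y′ ⁆ ∪ ⁅ g ⁆) →
        HasMinor (rankFn M) U24
    two-lines-U24 xyg xy′g = U24-minor M (B ∪ ⁅ g ⁆) {e} {x} {y} {y′}
      (let h = x-closure (flip-lines k) in
        (≤-by M (B ∷ ⁅ e ⁆ ∷ ⁅ x ⁆ ∷ ⁅ y ⁆ ∷ ⁅ y′ ⁆ ∷ ⁅ g ⁆ ∷ []) []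
          ((rk (s1 || s3 || s4) ≼ rk (s1 || s3)) ∷ (rk (s0 || s1 || s2 || s3 || s5) ≼ lit 3 ⊕ rk s0) ∷
          (lit 1 ⊕ rk s0 ≼ rk (s0 || s5)) ∷ [])
          (rk (s0 || s5 || s1 || s2 || s3 || s4) ≼ lit 2 ⊕ rk (s0 || s5))
          (sub (s1 || s3 || s4) (s0 || s1 || s2 || s3 || s5) ∷
          mon (s1 || s3) ((s1 || s3 || s4) && (s0 || s1 || s2 || s3 || s5)) ∷ []) refl tt
          (h , plane , g≥ , tt)))
      (≤-by M (B ∷ ⁅ e ⁆ ∷ ⁅ x ⁆ ∷ ⁅ g ⁆ ∷ []) [] ((lit 3 ⊕ rk s0 ≼ rk (s0 || s1 || s2 || s3)) ∷
        (rk s3 ≼ lit 1) ∷ []) (lit 2 ⊕ rk (s0 || s3) ≼ rk (s0 || s3 || s1 || s2)) (sub s0 s3 ∷ []) refl tt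
        (exg , Mat.r1 M g , tt))
      (≤-by M (B ∷ ⁅ e ⁆ ∷ ⁅ y ⁆ ∷ ⁅ g ⁆ ∷ []) [] ((lit 3 ⊕ rk s0 ≼ rk (s0 || s1 || s2 || s3)) ∷
        (rk s3 ≼ lit 1) ∷ []) (lit 2 ⊕ rk (s0 || s3) ≼ rk (s0 || s3 || s1 || s2)) (sub s0 s3 ∷ []) refl tt
        (eyg , Mat.r1 M g , tt))
      (let h = TwoLines.eyg (swap-y k) in (≤-by M (B ∷ ⁅ e ⁆ ∷ ⁅ y′ ⁆ ∷ ⁅ g ⁆ ∷ []) []
        ((lit 3 ⊕ rk s0 ≼ rk (s0 || s1 || s2 || s3)) ∷ (rk s3 ≼ lit 1) ∷ [])
        (lit 2 ⊕ rk (s0 || s3) ≼ rk (s0 || s3 || s1 || s2)) (sub s0 s3 ∷ []) refl tt (h , Mat.r1 M g , tt)))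
      (≤-by M (B ∷ ⁅ x ⁆ ∷ ⁅ y ⁆ ∷ ⁅ g ⁆ ∷ []) [] ((lit 3 ⊕ rk s0 ≼ rk (s0 || s1 || s2 || s3)) ∷
        (rk s3 ≼ lit 1) ∷ []) (lit 2 ⊕ rk (s0 || s3) ≼ rk (s0 || s3 || s1 || s2)) (sub s0 s3 ∷ []) refl tt
        (xyg , Mat.r1 M g , tt))
      (≤-by M (B ∷ ⁅ x ⁆ ∷ ⁅ y′ ⁆ ∷ ⁅ g ⁆ ∷ []) [] ((lit 3 ⊕ rk s0 ≼ rk (s0 || s1 || s2 || s3)) ∷
        (rk s3 ≼ lit 1) ∷ []) (lit 2 ⊕ rk (s0 || s3) ≼ rk (s0 || s3 || s1 || s2)) (sub s0 s3 ∷ []) refl tt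
        (xy′g , Mat.r1 M g , tt))
      (let h = pair-spans (flip-lines k) (B ∪ ⁅ g ⁆) in (≤-by M (B ∷ ⁅ e ⁆ ∷ ⁅ y ⁆ ∷ ⁅ y′ ⁆ ∷ ⁅ g ⁆ ∷ []) []
        ((rk (s0 || s4 || s1 || s2) ≼ rk (s0 || s4 || s2 || s3)) ∷
        (lit 3 ⊕ rk s0 ≼ rk (s0 || s1 || s2 || s4)) ∷ (rk s4 ≼ lit 1) ∷ [])
        (lit 2 ⊕ rk (s0 || s4) ≼ rk (s0 || s4 || s2 || s3)) (sub s0 s4 ∷ []) refl tt
        (h , eyg , Mat.r1 M g , tt)))
      where
      g≥ : 1 + r B ≤ r (B ∪ ⁅ g ⁆)
      g≥ = ≤-by M (B ∷ ⁅ e ⁆ ∷ ⁅ x ⁆ ∷ ⁅ g ⁆ ∷ []) [] ((lit 3 ⊕ rk s0 ≼ rk (s0 || s1 || s2 || s3)) ∷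
        (rk s1 ≼ lit 1) ∷ (rk s2 ≼ lit 1) ∷ []) (lit 1 ⊕ rk s0 ≼ rk (s0 || s3)) (sub s1 s2 ∷
        sub (s0 || s3) (s1 || s2) ∷ []) refl tt (exg , Mat.r1 M e , Mat.r1 M x , tt)

  -- There are two ways to match `x`, `x′` with `y`, `y′`. If in one of them both pairs are
  -- collinear with `g`, this is M(K₄). Otherwise each matching has a pair not collinear with `g`,
  -- and two pairs from different matchings share a point, so `two-lines-U24` applies after a
  -- symmetry.
  two-lines : ∀ {B e x x′ y y′ g} → TwoLines B e x x′ y y′ g → HasMinor (rankFn M) U24 ⊎ HasMinor (rankFn M) MK4
  two-lines {B} {e} {x} {x′} {y} {y′} {g} k =
    cases (collinear? x y) (collinear? x′ y′) (collinear? x y′) (collinear? x′ y)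
    where
    Collinear Free : Fin n → Fin n → Set
    Collinear u v = r (B ∪ ⁅ u ⁆ ∪ ⁅ v ⁆ ∪ ⁅ g ⁆) ≤ 2 + r B
    Free u v = 3 + r B ≤ r (B ∪ ⁅ u ⁆ ∪ ⁅ v ⁆ ∪ ⁅ g ⁆)
    collinear? : ∀ u v → Collinear u v ⊎ Free u v
    collinear? u v with r (B ∪ ⁅ u ⁆ ∪ ⁅ v ⁆ ∪ ⁅ g ⁆) ≤? 2 + r B
    ... | yes p = inj₁ p
    ... | no ¬p = inj₂ (≰⇒> ¬p)
    comm : ∀ {u v} → Free u v → Free v u
    comm {u} {v} h = ≤-by M (B ∷ ⁅ u ⁆ ∷ ⁅ v ⁆ ∷ ⁅ g ⁆ ∷ []) []
      ((lit 3 ⊕ rk s0 ≼ rk (s0 || s1 || s2 || s3)) ∷ []) (lit 3 ⊕ rk s0 ≼ rk (s0 || s2 || s1 || s3)) [] refl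
      tt (h , tt)
    cases : Collinear x y ⊎ Free x y → Collinear x′ y′ ⊎ Free x′ y′ → Collinear x y′ ⊎ Free x y′ → Collinear
        x′ y ⊎ Free x′ y →
            HasMinor (rankFn M) U24 ⊎ HasMinor (rankFn M) MK4
    cases (inj₁ p) (inj₁ q) _        _        = inj₂ (two-lines-K4 k p q)
    cases (inj₁ _) (inj₂ _) (inj₁ p) (inj₁ q) = inj₂ (two-lines-K4 (swap-y k) p q)
    cases (inj₂ _) _        (inj₁ p) (inj₁ q) = inj₂ (two-lines-K4 (swap-y k) p q)
    cases (inj₂ p) _        (inj₂ q) _        = inj₁ (two-lines-U24 k p q)
    cases (inj₂ p) _        (inj₁ _) (inj₂ q) = inj₁ (two-lines-U24 (flip-lines k) (comm p) (comm q))
    cases (inj₁ _) (inj₂ p) (inj₂ q) _        = inj₁ (two-lines-U24 (flip-lines (swap-y k)) (comm q) (comm p))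
    cases (inj₁ _) (inj₂ p) (inj₁ _) (inj₂ q) = inj₁ (two-lines-U24 (swap-x (swap-y k)) p q)

-- Orderings of a one-element contraction

module _ {n : ℕ} (M : Mat n) where
  open Mat M

  Simple Cosimple : Set
  Simple   = ∀ {x y} → Active M x → Active M y → x ≢ y → 2 ≤ r (⁅ x ⁆ ∪ ⁅ y ⁆)
  Cosimple = ∀ {x y} → Active M x → Active M y → x ≢ y → r 𝟙 ≤ r (∁ (⁅ x ⁆ ∪ ⁅ y ⁆))

  module _ (simple : Simple) (cosimple : Cosimple) {e : Fin n} (e-active : Active M e) where

    private
      I J : P n
      I i = not ⌊ Active? M i ⌋
      J   = I ∪ ⁅ e ⁆

      e-rank = proj₁ e-active

      e∉I : ⁅ e ⁆ ⊆ ∁ I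
      e∉I = ⁅⁆-⊆∁ I (λ t → not-T t (fromWitness e-active))

      I-sep : r I + r (∁ I) ≤ r 𝟙
      I-sep = inactive-separator M I (λ t a → not-T t (fromWitness a))

      active : ∀ {x} → ⁅ x ⁆ ⊆ ∁ J → Active M x
      active {x} p = decidable-stable (Active? M x) (λ ¬a → not-T (∈-set {X = ∁ I} (⊆-by (I ∷ ⁅ x ⁆ ∷ ⁅ e ⁆ ∷
          []) ((s1 , ~ (s0 || s2)) ∷ []) s1 (~ s0) refl (p , tt)))
        (T-not (λ t → ¬a (toWitness t))))

      e≢ : ∀ {x} → ⁅ x ⁆ ⊆ ∁ J → e ≢ x
      e≢ p refl = not-T (∈-set p) (∨⁺ {I e} (inj₂ (∈-⁅⁆ e)))

      distinct : ∀ {x y} {X : P n} → ⁅ x ⁆ ⊆ X → ⁅ y ⁆ ⊆ ∁ X → x ≢ y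
      distinct p q refl = not-T (∈-set q) (∈-set p)

      -- For X ∋ e this says λ(X) ≤ 1 in M / e.
      L : P n → Set
      L X = r (X ∪ ⁅ e ⁆) + r (∁ X ∪ ⁅ e ⁆) ≤ 2 + r 𝟙

      L-resp : Resp L
      L-resp {X} {Y} (p , q) h = ≤-by M (X ∷ Y ∷ ⁅ e ⁆ ∷ []) ((s0 , s1) ∷ (s1 , s0) ∷ [])
        ((rk (s0 || s2) ⊕ rk (~ s0 || s2) ≼ lit 2 ⊕ rk 𝟙ᵉ) ∷ [])
        (rk (s1 || s2) ⊕ rk (~ s1 || s2) ≼ lit 2 ⊕ rk 𝟙ᵉ) [] refl (p , q , tt) (h , tt)

      narrow⇒L : ∀ X → Narrow (contract M ⁅ e ⁆) X → L X
      narrow⇒L X h = ≤-trans (∸-narrow (e≤ X) (e≤ (∁ X)) (e≤ 𝟙) h) (≤-by M (⁅ e ⁆ ∷ []) []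
        ((rk s0 ≼ lit 1) ∷ []) (lit 1 ⊕ (rk (𝟙ᵉ || s0) ⊕ rk s0) ≼ lit 2 ⊕ rk 𝟙ᵉ) [] refl tt
        (Mat.r1 M e , tt))
        where
        e≤ : ∀ Y → r ⁅ e ⁆ ≤ r (Y ∪ ⁅ e ⁆)
        e≤ Y = ≤-by M (Y ∷ ⁅ e ⁆ ∷ []) [] [] (rk s1 ≼ rk (s0 || s1)) (mon s1 (s0 || s1) ∷ []) refl tt tt

    -- The element that completes the component either lies on the first line, which then has four
    -- points, or determines a second line.
    data Dense : Set where
      four-points : ∀ a b c d → r (⁅ a ⁆ ∪ ⁅ b ⁆ ∪ ⁅ c ⁆ ∪ ⁅ d ⁆) ≤ 2 →
        2 ≤ r (⁅ a ⁆ ∪ ⁅ b ⁆) → 2 ≤ r (⁅ a ⁆ ∪ ⁅ c ⁆) → 2 ≤ r (⁅ a ⁆ ∪ ⁅ d ⁆) →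
        2 ≤ r (⁅ b ⁆ ∪ ⁅ c ⁆) → 2 ≤ r (⁅ b ⁆ ∪ ⁅ d ⁆) → 2 ≤ r (⁅ c ⁆ ∪ ⁅ d ⁆) → Dense
      lines       : ∀ {B x x′ y y′ g} → TwoLines M B e x x′ y y′ g → Dense

    dense-minor : Dense → HasMinor (rankFn M) U24 ⊎ HasMinor (rankFn M) MK4
    dense-minor (lines k) = two-lines M k
    dense-minor (four-points a b c d abcd ab ac ad bc bd cd) = inj₁ (U24-minor M ∅ {a} {b} {c} {d}
      (≤-by M (⁅ a ⁆ ∷ ⁅ b ⁆ ∷ ⁅ c ⁆ ∷ ⁅ d ⁆ ∷ []) [] ((rk (s0 || s1 || s2 || s3) ≼ lit 2) ∷ [])
        (rk (∅ᵉ || s0 || s1 || s2 || s3) ≼ lit 2 ⊕ rk ∅ᵉ) [] refl tt (abcd , tt))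
      (pair a b ab) (pair a c ac) (pair a d ad) (pair b c bc) (pair b d bd) (pair c d cd))
      where
      pair : ∀ x y → 2 ≤ r (⁅ x ⁆ ∪ ⁅ y ⁆) → 2 + r ∅ ≤ r (∅ ∪ ⁅ x ⁆ ∪ ⁅ y ⁆)
      pair x y h = ≤-trans (+-monoʳ-≤ 2 (≤-reflexive r∅)) (≤-by M (⁅ x ⁆ ∷ ⁅ y ⁆ ∷ []) []
        ((lit 2 ≼ rk (s0 || s1)) ∷ []) (lit 2 ≼ rk (∅ᵉ || s0 || s1)) [] refl tt (h , tt))

    -- K joins x to the complement of X in M / e, without meeting x or e.
    record State (x : Fin n) (X : P n) : Set where
      field
        X⁻ K     : P n
        w        : Fin n
        X⊆       : X ⊆ X⁻ ∪ ⁅ w ⁆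
        X⁻⊆      : X⁻ ⊆ X
        w∈X      : ⁅ w ⁆ ⊆ X
        w∉X⁻     : ⁅ w ⁆ ⊆ ∁ X⁻
        J⊆X⁻     : J ⊆ X⁻
        K⊆X      : K ⊆ X
        narrow⁻  : L X⁻
        narrow   : L X
        wide     : 2 + r 𝟙 ≤ r (X ∪ ⁅ e ⁆) + r (∁ X ∪ ⁅ e ⁆)
        e-avoids : r K < r (K ∪ ⁅ e ⁆)
        x-avoids : r (K ∪ ⁅ e ⁆) < r (K ∪ ⁅ e ⁆ ∪ ⁅ x ⁆)
        x-spans  : r (K ∪ ∁ X ∪ ⁅ e ⁆ ∪ ⁅ x ⁆) ≤ r (K ∪ ∁ X ∪ ⁅ e ⁆)

    module _ {x x′ : Fin n} (x∉J : ⁅ x ⁆ ⊆ ∁ J) (x′∉J : ⁅ x′ ⁆ ⊆ ∁ J) (x≢x′ : x ≢ x′)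
             (x-line : r (⁅ e ⁆ ∪ ⁅ x ⁆ ∪ ⁅ x′ ⁆) ≤ 2) where

      -- Adding `y` lowers λ in M / e from 1 to 0, so `w` and `y` end the component and form the
      -- second line with `e`. If `y` is off the first line, let `B` be a maximal part of `K` that
      -- together with `y` and `e` does not span `x`; a further element of `K` makes it span `x` and
      -- serves as `g`.
      finish : ∀ {X} y → State x X → ⁅ x ⁆ ⊆ X → ⁅ x′ ⁆ ⊆ X → ⁅ y ⁆ ⊆ ∁ X →
               r (X ∪ ⁅ y ⁆ ∪ ⁅ e ⁆) + r (∁ (X ∪ ⁅ y ⁆) ∪ ⁅ e ⁆) ≤ 1 + r 𝟙 → Dense
      finish {X} y s x∈X x′∈X y∉X sep = result
        where
        open State s
        J⊆X : J ⊆ X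
        J⊆X = ⊆-trans J⊆X⁻ X⁻⊆
        y∉J : ⁅ y ⁆ ⊆ ∁ J
        y∉J = ⊆-by (X ∷ J ∷ ⁅ y ⁆ ∷ []) ((s2 , ~ s0) ∷ (s1 , s0) ∷ []) s2 (~ s1) refl (y∉X , J⊆X , tt)
        w∉J : ⁅ w ⁆ ⊆ ∁ J
        w∉J = ⊆-by (X⁻ ∷ J ∷ ⁅ w ⁆ ∷ []) ((s2 , ~ s0) ∷ (s1 , s0) ∷ []) s2 (~ s1) refl (w∉X⁻ , J⊆X⁻ , tt)
        e∈X⁻ : ⁅ e ⁆ ⊆ X⁻
        e∈X⁻ = ⊆-trans (⊆-by (I ∷ ⁅ e ⁆ ∷ []) [] s1 (s0 || s1) refl tt) J⊆X⁻
        ex = simple e-active (active x∉J) (e≢ x∉J)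
        ex′ = simple e-active (active x′∉J) (e≢ x′∉J)
        xx′ = simple (active x∉J) (active x′∉J) x≢x′
        ey = simple e-active (active y∉J) (e≢ y∉J)
        ew = simple e-active (active w∉J) (e≢ w∉J)
        w≢y = distinct w∈X y∉X
        yw = simple (active y∉J) (active w∉J) (w≢y ∘ sym)
        wy-cosimple = cosimple (active w∉J) (active y∉J) w≢y

        -- Submodularity is applied to X⁻ with the complement of X⁻ ∪ {w, y}, and to the complements
        -- of these two sets, each with `e` adjoined. One union lacks only `w` and `y` and has full
        -- rank, as they are not in series; the other is everything. The intersections are {e} and
        -- {e, w, y}.
        y-line : r (⁅ e ⁆ ∪ ⁅ y ⁆ ∪ ⁅ w ⁆) ≤ 2
        y-line = ≤-by M (X⁻ ∷ ⁅ w ⁆ ∷ ⁅ y ⁆ ∷ ⁅ e ⁆ ∷ []) ((s3 , s0) ∷ (s1 , ~ s0) ∷ (s2 , ~ (s0 || s1)) ∷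
          []) ((rk 𝟙ᵉ ≼ rk (~ (s1 || s2))) ∷ (lit 1 ≼ rk s3) ∷
          (rk (s0 || s3) ⊕ rk (~ s0 || s3) ≼ lit 2 ⊕ rk 𝟙ᵉ) ∷
          (rk (s0 || s1 || s2 || s3) ⊕ rk (~ (s0 || s1 || s2) || s3) ≼ lit 1 ⊕ rk 𝟙ᵉ) ∷ [])
          (rk (s3 || s2 || s1) ≼ lit 2) (sub (s0 || s3) (~ (s0 || s1 || s2) || s3) ∷
          sub (~ s0 || s3) (s0 || s1 || s2 || s3) ∷ []) refl (e∈X⁻ , w∉X⁻ , y∉ , tt)
          (wy-cosimple , e-rank , narrow⁻ , sep′ , tt)
          where
          y∉ : ⁅ y ⁆ ⊆ ∁ (X⁻ ∪ ⁅ w ⁆)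
          y∉ = ⊆-by (X ∷ X⁻ ∷ ⁅ w ⁆ ∷ ⁅ y ⁆ ∷ []) ((s3 , ~ s0) ∷ (s1 , s0) ∷ (s2 , s0) ∷ []) s3 (~ (s1 ||
              s2)) refl (y∉X , X⁻⊆ , w∈X , tt)
          sep′ : r (X⁻ ∪ ⁅ w ⁆ ∪ ⁅ y ⁆ ∪ ⁅ e ⁆) + r (∁ (X⁻ ∪ ⁅ w ⁆ ∪ ⁅ y ⁆) ∪ ⁅ e ⁆) ≤ 1 + r 𝟙
          sep′ = ≤-by M (X ∷ X⁻ ∷ ⁅ w ⁆ ∷ ⁅ y ⁆ ∷ ⁅ e ⁆ ∷ []) ((s0 , s1 || s2) ∷ (s1 , s0) ∷ (s2 , s0) ∷
            []) ((rk (s0 || s3 || s4) ⊕ rk (~ (s0 || s3) || s4) ≼ lit 1 ⊕ rk 𝟙ᵉ) ∷ [])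
            (rk (s1 || s2 || s3 || s4) ⊕ rk (~ (s1 || s2 || s3) || s4) ≼ lit 1 ⊕ rk 𝟙ᵉ) [] refl
            (X⊆ , X⁻⊆ , w∈X , tt) (sep , tt)

        -- In M / e the set `X` with `y` is a separator, so outside `X` only `y` can help `K` to
        -- span `x`.
        y-spans : r (K ∪ ⁅ y ⁆ ∪ ⁅ e ⁆ ∪ ⁅ x ⁆) ≤ r (K ∪ ⁅ y ⁆ ∪ ⁅ e ⁆)
        y-spans = ≤-by M (X ∷ K ∷ ⁅ x ⁆ ∷ ⁅ y ⁆ ∷ ⁅ e ⁆ ∷ []) ((s1 , s0) ∷ (s2 , s0) ∷ (s3 , ~ s0) ∷ [])
          ((lit 1 ≼ rk s4) ∷ (rk (s1 || ~ s0 || s4 || s2) ≼ rk (s1 || ~ s0 || s4)) ∷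
          (rk (s0 || s3 || s4) ⊕ rk (~ (s0 || s3) || s4) ≼ lit 1 ⊕ rk 𝟙ᵉ) ∷ [])
          (rk (s1 || s3 || s4 || s2) ≼ rk (s1 || s3 || s4)) (sub (s1 || ~ s0 || s4 || s2) (s0 || s3 || s4) ∷
          sub (~ (s0 || s3) || s4) (s1 || s3 || s4) ∷ []) refl (K⊆X , x∈X , y∉X , tt)
          (e-rank , x-spans , sep , tt)

        result : Dense
        result with r (⁅ e ⁆ ∪ ⁅ x ⁆ ∪ ⁅ y ⁆) ≤? 2
        ... | yes exy = four-points e x x′ y
              (≤-by M (⁅ e ⁆ ∷ ⁅ x ⁆ ∷ ⁅ x′ ⁆ ∷ ⁅ y ⁆ ∷ []) [] ((rk (s0 || s1 || s2) ≼ lit 2) ∷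
                (rk (s0 || s1 || s3) ≼ lit 2) ∷ (lit 2 ≼ rk (s0 || s1)) ∷ [])
                (rk (s0 || s1 || s2 || s3) ≼ lit 2) (sub (s0 || s1 || s2) (s0 || s1 || s3) ∷
                mon (s0 || s1) ((s0 || s1 || s2) && (s0 || s1 || s3)) ∷ []) refl tt (x-line , exy , ex , tt))
              ex ex′ ey xx′ (simple (active x∉J) (active y∉J) (distinct x∈X y∉X)) (simple (active x′∉J)
                  (active y∉J) (distinct x′∈X y∉X))
        ... | no ¬exy with maximal-avoiding M x (⁅ y ⁆ ∪ ⁅ e ⁆) ∅ K
                (let exy = ≰⇒> ¬exy in (≤-by M (⁅ e ⁆ ∷ ⁅ x ⁆ ∷ ⁅ y ⁆ ∷ []) []
                  ((lit 1 ⊕ lit 2 ≼ rk (s0 || s1 || s2)) ∷ (rk s0 ≼ lit 1) ∷ (rk s2 ≼ lit 1) ∷ [])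
                  (lit 1 ⊕ rk (∅ᵉ || (s2 || s0)) ≼ rk (∅ᵉ || (s2 || s0) || s1)) (sub s0 s2 ∷ []) refl tt
                  (exy , Mat.r1 M e , Mat.r1 M y , tt)))
        ...   | B , _ , B⊆K , avoids , max with any? (λ g → T? (K g) ×-dec ¬? (T? (B g)))
        ...     | no none = ⊥-elim (<⇒≱ avoids
                  (≤-by M (K ∷ B ∷ ⁅ e ⁆ ∷ ⁅ x ⁆ ∷ ⁅ y ⁆ ∷ []) ((s0 , s1) ∷ [])
                    ((rk (s0 || s4 || s2 || s3) ≼ rk (s0 || s4 || s2)) ∷ [])
                    (rk (s1 || (s4 || s2) || s3) ≼ rk (s1 || (s4 || s2)))
                    (sub (s0 || s4 || s2 || s3) (s1 || (s4 || s2)) ∷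
                    mon (s0 || s4 || s2) ((s0 || s4 || s2 || s3) && (s1 || (s4 || s2))) ∷ []) refl
                    (K⊆B , tt) (y-spans , tt)))
          where
          K⊆B : K ⊆ B
          K⊆B i i∈K = decidable-stable (T? (B i)) (λ i∉B → none (i , i∈K , i∉B))
        ...     | yes (g , g∈K , g∉B) = lines {B} {x} {x′} {y} {w} {g} record
                  { x-line = x-line ; y-line = y-line ; ex = ex ; ex′ = ex′ ; xx′ = xx′ ; ey = ey ; ey′ = ew ; yy′ = yw
                  ; exy = exy ; exg = exg ; eyg = eyg ; plane = plane }
          where
          spans : r (B ∪ ⁅ g ⁆ ∪ (⁅ y ⁆ ∪ ⁅ e ⁆) ∪ ⁅ x ⁆) ≤ r (B ∪ ⁅ g ⁆ ∪ (⁅ y ⁆ ∪ ⁅ e ⁆))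
          spans = max g∈K g∉B
          g⊆K = ⁅⁆-⊆ K g∈K
          B⊆ : B ⊆ K
          B⊆ = ⊆-by (B ∷ K ∷ []) ((s0 , ∅ᵉ || s1) ∷ []) s0 s1 refl (B⊆K , tt)
          Be : 1 + r B ≤ r (B ∪ ⁅ e ⁆)
          Be = ≤-by M (B ∷ K ∷ ⁅ e ⁆ ∷ []) ((s0 , s1) ∷ []) ((lit 1 ⊕ rk s1 ≼ rk (s1 || s2)) ∷ [])
            (lit 1 ⊕ rk s0 ≼ rk (s0 || s2)) (sub s1 (s0 || s2) ∷ mon s0 (s1 && (s0 || s2)) ∷ []) refl
            (B⊆ , tt) (e-avoids , tt)
          x-avoids′ : r (B ∪ ⁅ g ⁆ ∪ ⁅ e ⁆) < r (B ∪ ⁅ g ⁆ ∪ ⁅ e ⁆ ∪ ⁅ x ⁆)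
          x-avoids′ = ≤-by M (B ∷ K ∷ ⁅ e ⁆ ∷ ⁅ g ⁆ ∷ ⁅ x ⁆ ∷ []) ((s0 , s1) ∷ (s3 , s1) ∷ [])
            ((lit 1 ⊕ rk (s1 || s2) ≼ rk (s1 || s2 || s4)) ∷ [])
            (lit 1 ⊕ rk (s0 || s3 || s2) ≼ rk (s0 || s3 || s2 || s4))
            (sub (s1 || s2) (s0 || s3 || s2 || s4) ∷
            mon (s0 || s3 || s2) ((s1 || s2) && (s0 || s3 || s2 || s4)) ∷ []) refl (B⊆ , g⊆K , tt)
            (x-avoids , tt)
          y-free : 1 + r (B ∪ ⁅ e ⁆) ≤ r (B ∪ ⁅ e ⁆ ∪ ⁅ y ⁆)
          y-free = ≤-by M (B ∷ K ∷ ⁅ e ⁆ ∷ ⁅ x ⁆ ∷ ⁅ y ⁆ ∷ []) ((s0 , s1) ∷ [])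
            ((lit 1 ⊕ rk (s1 || s2) ≼ rk (s1 || s2 || s3)) ∷
            (rk (s1 || s4 || s2 || s3) ≼ rk (s1 || s4 || s2)) ∷ [])
            (lit 1 ⊕ rk (s0 || s2) ≼ rk (s0 || s2 || s4)) (sub (s1 || s2) (s0 || s2 || s4) ∷
            mon (s1 || s2 || s3) (s1 || s4 || s2 || s3) ∷ mon (s0 || s2) ((s1 || s2) && (s0 || s2 || s4)) ∷
            []) refl (B⊆ , tt) (x-avoids , y-spans , tt)
          exy : 3 + r B ≤ r (B ∪ ⁅ e ⁆ ∪ ⁅ x ⁆ ∪ ⁅ y ⁆)
          exy = ≤-by M (B ∷ ⁅ e ⁆ ∷ ⁅ x ⁆ ∷ ⁅ y ⁆ ∷ []) [] ((lit 1 ⊕ rk s0 ≼ rk (s0 || s1)) ∷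
            (lit 1 ⊕ rk (s0 || s1) ≼ rk (s0 || s1 || s3)) ∷
            (lit 1 ⊕ rk (s0 || (s3 || s1)) ≼ rk (s0 || (s3 || s1) || s2)) ∷ [])
            (lit 3 ⊕ rk s0 ≼ rk (s0 || s1 || s2 || s3)) [] refl tt (Be , y-free , avoids , tt)
          g-free : 1 + r (B ∪ ⁅ e ⁆ ∪ ⁅ y ⁆) ≤ r (B ∪ ⁅ e ⁆ ∪ ⁅ y ⁆ ∪ ⁅ g ⁆)
          g-free = ≤-by M (B ∷ ⁅ e ⁆ ∷ ⁅ x ⁆ ∷ ⁅ y ⁆ ∷ ⁅ g ⁆ ∷ []) []
            ((rk (s0 || s4 || (s3 || s1) || s2) ≼ rk (s0 || s4 || (s3 || s1))) ∷
            (lit 1 ⊕ rk (s0 || (s3 || s1)) ≼ rk (s0 || (s3 || s1) || s2)) ∷ [])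
            (lit 1 ⊕ rk (s0 || s1 || s3) ≼ rk (s0 || s1 || s3 || s4))
            (mon (s0 || (s3 || s1) || s2) (s0 || s4 || (s3 || s1) || s2) ∷ []) refl tt (spans , avoids , tt)
          eyg : 3 + r B ≤ r (B ∪ ⁅ e ⁆ ∪ ⁅ y ⁆ ∪ ⁅ g ⁆)
          eyg = ≤-trans (s≤s (s≤s Be)) (≤-trans (s≤s y-free) g-free)
          exg : 3 + r B ≤ r (B ∪ ⁅ e ⁆ ∪ ⁅ x ⁆ ∪ ⁅ g ⁆)
          exg = ≤-by M (B ∷ ⁅ e ⁆ ∷ ⁅ x ⁆ ∷ ⁅ y ⁆ ∷ ⁅ g ⁆ ∷ []) [] ((lit 1 ⊕ rk s0 ≼ rk (s0 || s1)) ∷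
            (lit 1 ⊕ rk (s0 || s1 || s3) ≼ rk (s0 || s1 || s3 || s4)) ∷
            (lit 1 ⊕ rk (s0 || s4 || s1) ≼ rk (s0 || s4 || s1 || s2)) ∷ [])
            (lit 3 ⊕ rk s0 ≼ rk (s0 || s1 || s2 || s4))
            (mon (s0 || s1) ((s0 || s1 || s3) && (s0 || s4 || s1)) ∷ sub (s0 || s1 || s3) (s0 || s4 || s1) ∷
            []) refl tt (Be , g-free , x-avoids′ , tt)
          plane : r (B ∪ ⁅ e ⁆ ∪ ⁅ x ⁆ ∪ ⁅ y ⁆ ∪ ⁅ g ⁆) ≤ 3 + r B
          plane = ≤-by M (B ∷ ⁅ e ⁆ ∷ ⁅ x ⁆ ∷ ⁅ y ⁆ ∷ ⁅ g ⁆ ∷ []) []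
            ((rk (s0 || s4 || (s3 || s1) || s2) ≼ rk (s0 || s4 || (s3 || s1))) ∷ (rk s1 ≼ lit 1) ∷
            (rk s3 ≼ lit 1) ∷ (rk s4 ≼ lit 1) ∷ []) (rk (s0 || s1 || s2 || s3 || s4) ≼ lit 3 ⊕ rk s0)
            (sub s1 s0 ∷ sub s3 s4 ∷ sub (s1 || s0) (s3 || s4) ∷ []) refl tt
            (spans , Mat.r1 M e , Mat.r1 M y , Mat.r1 M g , tt)

      -- `K` is kept as long as the elements still outside suffice to span `x` with it; once they do
      -- not, `z` was essential and joins `K`.
      extend : ∀ {X} z → State x X → ⁅ x ⁆ ⊆ X → ⁅ z ⁆ ⊆ ∁ X → L (X ∪ ⁅ z ⁆) →
               2 + r 𝟙 ≤ r (X ∪ ⁅ z ⁆ ∪ ⁅ e ⁆) + r (∁ (X ∪ ⁅ z ⁆) ∪ ⁅ e ⁆) → State x (X ∪ ⁅ z ⁆)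
      extend {X} z s x∈X z∉X l wide′ with r (K ∪ ∁ (X ∪ ⁅ z ⁆) ∪ ⁅ e ⁆ ∪ ⁅ x ⁆) ≤? r (K ∪ ∁ (X ∪ ⁅ z ⁆) ∪ ⁅ e ⁆)
        where open State s
      ... | yes spans = record
        { X⁻ = X ; K = K ; w = z ; X⊆ = ⊆-refl _ ; X⁻⊆ = ⊆-by (X ∷ ⁅ z ⁆ ∷ []) [] s0 (s0 || s1) refl tt ; w∈X
            = ⊆-by (X ∷ ⁅ z ⁆ ∷ []) [] s1 (s0 || s1) refl tt
        ; w∉X⁻ = z∉X ; J⊆X⁻ = ⊆-trans J⊆X⁻ X⁻⊆ ; K⊆X = ⊆-by (X ∷ K ∷ ⁅ z ⁆ ∷ []) ((s1 , s0) ∷ []) s1 (s0 ||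
            s2) refl (K⊆X , tt)
        ; narrow⁻ = narrow ; narrow = l ; wide = wide′ ; e-avoids = e-avoids ; x-avoids = x-avoids ; x-spans = spans }
        where open State s
      ... | no ¬spans = record
        { X⁻ = X ; K = K ∪ ⁅ z ⁆ ; w = z ; X⊆ = ⊆-refl _ ; X⁻⊆ = ⊆-by (X ∷ ⁅ z ⁆ ∷ []) [] s0 (s0 || s1) refl
            tt ; w∈X = ⊆-by (X ∷ ⁅ z ⁆ ∷ []) [] s1 (s0 || s1) refl tt
        ; w∉X⁻ = z∉X ; J⊆X⁻ = ⊆-trans J⊆X⁻ X⁻⊆ ; K⊆X = ⊆-by (X ∷ K ∷ ⁅ z ⁆ ∷ []) ((s1 , s0) ∷ []) (s1 || s2)
            (s0 || s2) refl (K⊆X , tt)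
        ; narrow⁻ = narrow ; narrow = l ; wide = wide′
        ; e-avoids = ≤-by M (X ∷ K ∷ ⁅ z ⁆ ∷ ⁅ e ⁆ ∷ ⁅ x ⁆ ∷ []) ((s2 , ~ s0) ∷ [])
          ((lit 1 ⊕ rk (s1 || ~ (s0 || s2) || s3) ≼ rk (s1 || ~ (s0 || s2) || s3 || s4)) ∷
          (rk (s1 || ~ s0 || s3 || s4) ≼ rk (s1 || ~ s0 || s3)) ∷ (lit 1 ⊕ rk s1 ≼ rk (s1 || s3)) ∷
          (rk s2 ≼ lit 1) ∷ []) (lit 1 ⊕ rk (s1 || s2) ≼ rk (s1 || s2 || s3))
          (sub (s1 || ~ (s0 || s2) || s3) (s1 || s2 || s3) ∷
          mon (s1 || ~ (s0 || s2) || s3 || s4) (s1 || ~ s0 || s3 || s4) ∷ sub s1 s2 ∷ []) refl (z∉X , tt)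
          (free , x-spans , e-avoids , Mat.r1 M z , tt)
        -- The complement loses rank when `z` leaves it, even with `e` adjoined. As λ in M / e stays
        -- at 1, `X` and `e` do not span `z`. If `K`, `z` and `e` spanned `x`, exchange would put
        -- `z` into the span of `X` and `e`.
        ; x-avoids = ≤-by M (X ∷ K ∷ ⁅ z ⁆ ∷ ⁅ e ⁆ ∷ ⁅ x ⁆ ∷ []) ((s2 , ~ s0) ∷ (s4 , s0) ∷ (s1 , s0) ∷ [])
          ((lit 1 ⊕ rk (s1 || ~ (s0 || s2) || s3) ≼ rk (s1 || ~ (s0 || s2) || s3 || s4)) ∷
          (rk (s1 || ~ s0 || s3 || s4) ≼ rk (s1 || ~ s0 || s3)) ∷
          (lit 1 ⊕ rk (s1 || s3) ≼ rk (s1 || s3 || s4)) ∷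
          (lit 2 ⊕ rk 𝟙ᵉ ≼ rk (s0 || s2 || s3) ⊕ rk (~ (s0 || s2) || s3)) ∷
          (rk (s0 || s3) ⊕ rk (~ s0 || s3) ≼ lit 2 ⊕ rk 𝟙ᵉ) ∷ (rk s2 ≼ lit 1) ∷ [])
          (lit 1 ⊕ rk (s1 || s2 || s3) ≼ rk (s1 || s2 || s3 || s4))
          (sub (s1 || ~ (s0 || s2) || s3) (~ s0 || s3) ∷
          mon (s1 || ~ (s0 || s2) || s3 || s4) (s1 || ~ s0 || s3 || s4) ∷ sub (s1 || s3) s2 ∷
          sub (s0 || s3) (s1 || s2 || s3 || s4) ∷ []) refl (z∉X , x∈X , K⊆X , tt)
          (free , x-spans , x-avoids , wide′ , narrow , Mat.r1 M z , tt)
        ; x-spans = (≤-by M (X ∷ K ∷ ⁅ z ⁆ ∷ ⁅ e ⁆ ∷ ⁅ x ⁆ ∷ []) ((s2 , ~ s0) ∷ [])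
          ((rk (s1 || ~ s0 || s3 || s4) ≼ rk (s1 || ~ s0 || s3)) ∷ [])
          (rk (s1 || s2 || ~ (s0 || s2) || s3 || s4) ≼ rk (s1 || s2 || ~ (s0 || s2) || s3)) [] refl
          (z∉X , tt) (x-spans , tt)) }
        where
        open State s
        free = ≰⇒> ¬spans

      -- Some step must complete the component: at `𝟙` the connectivity in M / e is 0, against
      -- `wide`.
      walk₂ : ∀ {X} → State x X → ⁅ x ⁆ ⊆ X → ⁅ x′ ⁆ ⊆ X → Path L X 𝟙 → Dense
      walk₂ {X} s x∈X x′∈X (done (_ , 𝟙⊆X)) = ⊥-elim (1≰0 (≤-by M (X ∷ ⁅ e ⁆ ∷ []) ((𝟙ᵉ , s0) ∷ [])
        ((lit 2 ⊕ rk 𝟙ᵉ ≼ rk (s0 || s1) ⊕ rk (~ s0 || s1)) ∷ (rk s1 ≼ lit 1) ∷ []) (lit 1 ≼ lit 0) [] refl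
        (𝟙⊆X , tt) (wide , Mat.r1 M e , tt)))
        where open State s
      walk₂ {X} s x∈X x′∈X (add z l p) with T? (X z) | 2 + r 𝟙 ≤? r (X ∪ ⁅ z ⁆ ∪ ⁅ e ⁆) + r (∁ (X ∪ ⁅ z ⁆) ∪ ⁅ e ⁆)
      ... | no z∉X  | yes wide = walk₂ (extend z s x∈X (⁅⁆-⊆∁ X z∉X) l wide) (⊆-by (X ∷ ⁅ x ⁆ ∷ ⁅ z ⁆ ∷ [])
          ((s1 , s0) ∷ []) s1 (s0 || s2) refl (x∈X , tt)) (⊆-by (X ∷ ⁅ x′ ⁆ ∷ ⁅ z ⁆ ∷ []) ((s1 , s0) ∷ []) s1
          (s0 || s2) refl (x′∈X , tt)) p
      ... | no z∉X  | no ¬wide = finish z s x∈X x′∈X (⁅⁆-⊆∁ X z∉X) (≤-pred (≰⇒> ¬wide))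
      ... | yes z∈X | _        = walk₂ (record
            { X⁻ = X⁻ ; K = K ; w = w ; w∉X⁻ = w∉X⁻ ; J⊆X⁻ = J⊆X⁻ ; narrow⁻ = narrow⁻ ; narrow = l ; e-avoids
                = e-avoids ; x-avoids = x-avoids
            ; X⊆ = ⊆-by (X ∷ X⁻ ∷ ⁅ z ⁆ ∷ ⁅ w ⁆ ∷ []) ((s2 , s0) ∷ (s0 , s1 || s3) ∷ []) (s0 || s2) (s1 ||
                s3) refl (z∈ , X⊆ , tt)
            ; X⁻⊆ = ⊆-by (X ∷ X⁻ ∷ ⁅ z ⁆ ∷ []) ((s1 , s0) ∷ []) s1 (s0 || s2) refl (X⁻⊆ , tt)
            ; w∈X = ⊆-by (X ∷ ⁅ z ⁆ ∷ ⁅ w ⁆ ∷ []) ((s2 , s0) ∷ []) s2 (s0 || s1) refl (w∈X , tt)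
            ; K⊆X = ⊆-by (X ∷ K ∷ ⁅ z ⁆ ∷ []) ((s1 , s0) ∷ []) s1 (s0 || s2) refl (K⊆X , tt)
            ; wide = ≤-by M (X ∷ ⁅ z ⁆ ∷ ⁅ e ⁆ ∷ []) ((s1 , s0) ∷ [])
              ((lit 2 ⊕ rk 𝟙ᵉ ≼ rk (s0 || s2) ⊕ rk (~ s0 || s2)) ∷ [])
              (lit 2 ⊕ rk 𝟙ᵉ ≼ rk (s0 || s1 || s2) ⊕ rk (~ (s0 || s1) || s2)) [] refl (z∈ , tt) (wide , tt)
            ; x-spans = (≤-by M (X ∷ K ∷ ⁅ z ⁆ ∷ ⁅ e ⁆ ∷ ⁅ x ⁆ ∷ []) ((s2 , s0) ∷ [])
              ((rk (s1 || ~ s0 || s3 || s4) ≼ rk (s1 || ~ s0 || s3)) ∷ [])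
              (rk (s1 || ~ (s0 || s2) || s3 || s4) ≼ rk (s1 || ~ (s0 || s2) || s3)) [] refl (z∈ , tt)
              (x-spans , tt)) })
            (⊆-by (X ∷ ⁅ x ⁆ ∷ ⁅ z ⁆ ∷ []) ((s1 , s0) ∷ []) s1 (s0 || s2) refl (x∈X , tt)) (⊆-by (X ∷ ⁅ x′ ⁆
                ∷ ⁅ z ⁆ ∷ []) ((s1 , s0) ∷ []) s1 (s0 || s2) refl (x′∈X , tt)) p
        where
        open State s
        z∈ = ⁅⁆-⊆ X z∈X

    private
      -- Once the inactive elements are split off, the first two new elements have connectivity at
      -- most 1 in M / e; as they are not in series, they are collinear with `e`. A single new
      -- element would be in series with `e`.
      walk₁ : ∀ {X x} → ⁅ x ⁆ ⊆ ∁ J → X ≐ J ∪ ⁅ x ⁆ → L X → Path L X 𝟙 → Dense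
      walk₁ {X} {x} x∉J (X⊆ , _) _ (done (_ , 𝟙⊆X)) = ⊥-elim
        (1≰0 (≤-by M (I ∷ X ∷ ⁅ x ⁆ ∷ ⁅ e ⁆ ∷ []) ((s1 , s0 || s3 || s2) ∷ (𝟙ᵉ , s1) ∷ (s2 , ~ (s0 || s3)) ∷
          (s3 , ~ s0) ∷ []) ((rk s0 ⊕ rk (~ s0) ≼ rk 𝟙ᵉ) ∷ (rk 𝟙ᵉ ≼ rk (~ (s3 || s2))) ∷ (lit 1 ≼ rk s3) ∷
          []) (lit 1 ≼ lit 0) (mon s3 (~ s0) ∷ []) refl (X⊆ , 𝟙⊆X , x∉J , e∉I , tt)
          (I-sep , cos , e-rank , tt)))
        where cos = cosimple e-active (active x∉J) (e≢ x∉J)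
      walk₁ {X} {x} x∉J (X⊆ , ⊆X) lX (add z l p) with T? ((J ∪ ⁅ x ⁆) z)
      ... | yes z∈ = walk₁ x∉J
            (≐-by (X ∷ ⁅ x ⁆ ∷ ⁅ z ⁆ ∷ J ∷ []) ((s0 , s3 || s1) ∷ (s2 , s3 || s1) ∷ (s3 || s1 , s0) ∷ []) (s0
                || s2) (s3 || s1) refl (X⊆ , z⊆ , ⊆X , tt)) l p
        where z⊆ = ⁅⁆-⊆ (J ∪ ⁅ x ⁆) z∈
      ... | no z∉ = walk₂ x∉J z∉J x≢z line (record
            { X⁻ = X ; K = ∅ ; w = z ; X⊆ = ⊆-refl _ ; X⁻⊆ = ⊆-by (X ∷ ⁅ z ⁆ ∷ []) [] s0 (s0 || s1) refl tt ;
                w∈X = ⊆-by (X ∷ ⁅ z ⁆ ∷ []) [] s1 (s0 || s1) refl tt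
            ; w∉X⁻ = ⊆-by (X ∷ J ∷ ⁅ x ⁆ ∷ ⁅ z ⁆ ∷ []) ((s0 , s1 || s2) ∷ (s3 , ~ (s1 || s2)) ∷ []) s3 (~ s0)
                refl (X⊆ , z⊆ , tt)
            ; J⊆X⁻ = ⊆-by (X ∷ J ∷ ⁅ x ⁆ ∷ []) ((s1 || s2 , s0) ∷ []) s1 s0 refl (⊆X , tt)
            ; K⊆X = ∅⊆ _ ; narrow⁻ = lX ; narrow = l ; wide = wide
            ; e-avoids = ≤-by M (⁅ e ⁆ ∷ []) [] ((lit 1 ≼ rk s0) ∷ []) (lit 1 ⊕ rk ∅ᵉ ≼ rk (∅ᵉ || s0)) []
              refl tt (e-rank , tt)
            ; x-avoids = ≤-by M (⁅ e ⁆ ∷ ⁅ x ⁆ ∷ []) [] ((lit 2 ≼ rk (s0 || s1)) ∷ (rk s0 ≼ lit 1) ∷ [])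
              (lit 1 ⊕ rk (∅ᵉ || s0) ≼ rk (∅ᵉ || s0 || s1)) [] refl tt (ex , Mat.r1 M e , tt)
            ; x-spans = spans })
            (⊆-by (X ∷ J ∷ ⁅ x ⁆ ∷ ⁅ z ⁆ ∷ []) ((s1 || s2 , s0) ∷ []) s2 (s0 || s3) refl (⊆X , tt)) (⊆-by (X
                ∷ ⁅ z ⁆ ∷ []) [] s1 (s0 || s1) refl tt) p
        where
        z⊆ = ⁅⁆-⊆∁ (J ∪ ⁅ x ⁆) z∉
        z∉J : ⁅ z ⁆ ⊆ ∁ J
        z∉J = ⊆-by (J ∷ ⁅ x ⁆ ∷ ⁅ z ⁆ ∷ []) ((s2 , ~ (s0 || s1)) ∷ []) s2 (~ s0) refl (z⊆ , tt)
        x≢z : x ≢ z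
        x≢z = distinct (⊆-by (J ∷ ⁅ x ⁆ ∷ []) [] s1 (s0 || s1) refl tt) z⊆
        ex = simple e-active (active x∉J) (e≢ x∉J)
        cos = cosimple (active x∉J) (active z∉J) x≢z
        l′ : r (I ∪ ⁅ e ⁆ ∪ ⁅ x ⁆ ∪ ⁅ z ⁆) + r (∁ (I ∪ ⁅ x ⁆ ∪ ⁅ z ⁆)) ≤ 2 + r 𝟙
        l′ = ≤-by M (X ∷ I ∷ ⁅ e ⁆ ∷ ⁅ x ⁆ ∷ ⁅ z ⁆ ∷ []) ((s0 , s1 || s2 || s3) ∷ (s1 || s2 || s3 , s0) ∷
          (s4 , ~ (s1 || s2 || s3)) ∷ (s3 , ~ (s1 || s2)) ∷ (s2 , ~ s1) ∷ [])
          ((rk (s0 || s4 || s2) ⊕ rk (~ (s0 || s4) || s2) ≼ lit 2 ⊕ rk 𝟙ᵉ) ∷ [])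
          (rk (s1 || s2 || s3 || s4) ⊕ rk (~ (s1 || s3 || s4)) ≼ lit 2 ⊕ rk 𝟙ᵉ) [] refl
          (X⊆ , ⊆X , z⊆ , x∉J , e∉I , tt) (l , tt)
        line : r (⁅ e ⁆ ∪ ⁅ x ⁆ ∪ ⁅ z ⁆) ≤ 2
        line = ≤-by M (I ∷ ⁅ e ⁆ ∷ ⁅ x ⁆ ∷ ⁅ z ⁆ ∷ []) ((s3 , ~ (s0 || s1 || s2)) ∷ (s2 , ~ (s0 || s1)) ∷
          (s1 , ~ s0) ∷ []) ((rk (s0 || s1 || s2 || s3) ⊕ rk (~ (s0 || s2 || s3)) ≼ lit 2 ⊕ rk 𝟙ᵉ) ∷
          (rk s0 ⊕ rk (~ s0) ≼ rk 𝟙ᵉ) ∷ (rk 𝟙ᵉ ≼ rk (~ (s2 || s3))) ∷ []) (rk (s1 || s2 || s3) ≼ lit 2)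
          (sub (s0 || s1 || s2 || s3) (~ s0) ∷ sub (~ (s0 || s2 || s3)) s0 ∷ []) refl (z⊆ , x∉J , e∉I , tt)
          (l′ , I-sep , cos , tt)
        wide : 2 + r 𝟙 ≤ r (X ∪ ⁅ z ⁆ ∪ ⁅ e ⁆) + r (∁ (X ∪ ⁅ z ⁆) ∪ ⁅ e ⁆)
        wide = ≤-by M (X ∷ I ∷ ⁅ e ⁆ ∷ ⁅ x ⁆ ∷ ⁅ z ⁆ ∷ []) ((s0 , s1 || s2 || s3) ∷ (s1 || s2 || s3 , s0) ∷
          (s4 , ~ (s1 || s2 || s3)) ∷ (s3 , ~ (s1 || s2)) ∷ (s2 , ~ s1) ∷ []) ((rk s1 ⊕ rk (~ s1) ≼ rk 𝟙ᵉ) ∷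
          (rk 𝟙ᵉ ≼ rk (~ (s3 || s4))) ∷ (lit 2 ≼ rk (s2 || s3)) ∷ [])
          (lit 2 ⊕ rk 𝟙ᵉ ≼ rk (s0 || s4 || s2) ⊕ rk (~ (s0 || s4) || s2)) (sub s1 (~ (s0 || s4) || s2) ∷
          sub (~ s1) (s1 || (s2 || s3)) ∷ mon (s1 || (s2 || s3)) (s0 || s4 || s2) ∷ []) refl
          (X⊆ , ⊆X , z⊆ , x∉J , e∉I , tt) (I-sep , cos , ex , tt)
        spans : r (∅ ∪ ∁ (X ∪ ⁅ z ⁆) ∪ ⁅ e ⁆ ∪ ⁅ x ⁆) ≤ r (∅ ∪ ∁ (X ∪ ⁅ z ⁆) ∪ ⁅ e ⁆)
        spans = ≤-by M (X ∷ I ∷ ⁅ e ⁆ ∷ ⁅ x ⁆ ∷ ⁅ z ⁆ ∷ []) ((s0 , s1 || s2 || s3) ∷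
          (s1 || s2 || s3 , s0) ∷ (s4 , ~ (s1 || s2 || s3)) ∷ (s3 , ~ (s1 || s2)) ∷ (s2 , ~ s1) ∷ [])
          ((rk s1 ⊕ rk (~ s1) ≼ rk 𝟙ᵉ) ∷ (rk 𝟙ᵉ ≼ rk (~ (s3 || s4))) ∷ [])
          (rk (∅ᵉ || ~ (s0 || s4) || s2 || s3) ≼ rk (∅ᵉ || ~ (s0 || s4) || s2))
          (sub s1 (∅ᵉ || ~ (s0 || s4) || s2) ∷ mon (∅ᵉ || ~ (s0 || s4) || s2 || s3) (~ s1) ∷ []) refl
          (X⊆ , ⊆X , z⊆ , x∉J , e∉I , tt) (I-sep , cos , tt)

      walk₀ : ∀ {X} → X ≐ J → Path L X 𝟙 → Dense
      walk₀ {X} (X⊆ , _) (done (_ , 𝟙⊆X)) = ⊥-elim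
        (1≰0 (≤-by M (I ∷ X ∷ ⁅ e ⁆ ∷ []) ((s1 , s0 || s2) ∷ (𝟙ᵉ , s1) ∷ (s2 , ~ s0) ∷ [])
          ((rk s0 ⊕ rk (~ s0) ≼ rk 𝟙ᵉ) ∷ (rk 𝟙ᵉ ≼ rk (~ s2)) ∷ (lit 1 ≼ rk s2) ∷ []) (lit 1 ≼ lit 0) [] refl
          (X⊆ , 𝟙⊆X , e∉I , tt) (I-sep , proj₂ e-active , e-rank , tt)))
      walk₀ {X} (X⊆ , ⊆X) (add z l p) with T? (J z)
      ... | yes z∈ = walk₀
            (≐-by (X ∷ ⁅ z ⁆ ∷ J ∷ []) ((s0 , s2) ∷ (s1 , s2) ∷ (s2 , s0) ∷ []) (s0 || s1) s2 refl (X⊆ , z⊆ ,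
                ⊆X , tt)) p
        where z⊆ = ⁅⁆-⊆ J z∈
      ... | no z∉ = walk₁ (⁅⁆-⊆∁ J z∉)
            (≐-by (X ∷ ⁅ z ⁆ ∷ J ∷ []) ((s0 , s2) ∷ (s2 , s0) ∷ []) (s0 || s1) (s2 || s1) refl (X⊆ , ⊆X , tt)) l p

    -- Adjoining `J` to every prefix puts `e` and the inactive elements in front. The inactive
    -- elements form a separator of `M`, so the bound on the prefixes survives.
    dense : Path (Narrow (contract M ⁅ e ⁆)) ∅ 𝟙 → Dense
    dense p = walk₀ (≐-by (J ∷ []) [] (∅ᵉ || s0) s0 refl tt)
      (path-congʳ L-resp (⊆𝟙 _ , (⊆-by (J ∷ []) [] 𝟙ᵉ (𝟙ᵉ || s0) refl tt))
        (map-path (_∪ J) L-resp (∪-congˡ J) to-L p))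
      where
      to-L : ∀ X z → Narrow (contract M ⁅ e ⁆) (X ∪ ⁅ z ⁆) → Path L (X ∪ J) (X ∪ ⁅ z ⁆ ∪ J)
      to-L X z h = one-step L-resp z
        (≐-by (X ∷ ⁅ z ⁆ ∷ J ∷ []) [] (s0 || s2 || s1) (s0 || s1 || s2) refl tt)
        (≤-by M (I ∷ (X ∪ ⁅ z ⁆) ∷ ⁅ e ⁆ ∷ []) [] ((rk s0 ⊕ rk (~ s0) ≼ rk 𝟙ᵉ) ∷
          (rk (s1 || s2) ⊕ rk (~ s1 || s2) ≼ lit 2 ⊕ rk 𝟙ᵉ) ∷ [])
          (rk (s1 || (s0 || s2) || s2) ⊕ rk (~ (s1 || (s0 || s2)) || s2) ≼ lit 2 ⊕ rk 𝟙ᵉ)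
          (sub s0 (s1 || s2) ∷ sub (~ s0) (s0 && (s1 || s2)) ∷ sub (~ s1 || s2) (~ s0 || (s1 || s2)) ∷ [])
          refl tt (I-sep , narrow⇒L (X ∪ ⁅ z ⁆) h , tt))

-- Minors and duality

Injective : ∀ {m n} → (Fin m → Fin n) → Set
Injective φ = ∀ i j → φ i ≡ φ j → i ≡ j

record Minor {n} (M : Mat n) (T₀ : Σ ℕ RankFn) : Set where
  constructor mk
  field
    C   : P n
    φ   : Fin (proj₁ T₀) → Fin n
    inj : Injective φ
    φ∉C : ∀ i → ¬ T (C (φ i))
    eq  : ∀ X → proj₂ T₀ X ≡ Mat.r (minor M C φ) (lookup X)

minor-elim : ∀ {n} (M : Mat n) T₀ → HasMinor (rankFn M) T₀ → Minor M T₀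
minor-elim M T₀ (C , φ , inj , φ∉C , eq) = mk (lookup C) φ inj
  (λ i t → φ∉C i (VecP.lookup⇒[]= (φ i) C (T⇒≡ t)))
  (λ X → trans (eq X) (cong (_∸ rankFn M C) (r-cong M
    (≐-trans (lookup-∪ (image φ X) C) (≗⇒≐ λ i → cong (_∨ lookup C i) (VecP.lookup∘tabulate _ i))))))

module _ {n : ℕ} (M : Mat n) (T₀ : Σ ℕ RankFn) (loopless : Loopless (proj₂ T₀)) where
  open Mat M

  private
    ρ = proj₂ T₀

  -- Outside `A` the restriction has only loops, so the loopless minor lives inside `A`.
  minor-restrict : ∀ A → HasMinor (rankFn (restrict M A)) T₀ → HasMinor (rankFn M) T₀
  minor-restrict A h = minor-intro M T₀ (C ∩ A) φ inj loopless λ X → trans (eq X)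
    (cong (_∸ r (C ∩ A)) (let I = img φ (lookup X) ; I⊆A = img⊆A X in
      (≤-antisym
          (≤-by M (I ∷ C ∷ A ∷ []) ((s0 , s2) ∷ []) [] (rk ((s0 || s1) && s2) ≼ rk (s0 || s1 && s2)) [] refl
        (I⊆A , tt) tt)
          (≤-by M (I ∷ C ∷ A ∷ []) ((s0 , s2) ∷ []) [] (rk (s0 || s1 && s2) ≼ rk ((s0 || s1) && s2)) [] refl
        (I⊆A , tt) tt))))
    where
    open Minor (minor-elim (restrict M A) T₀ h)
    φ∈A : ∀ i → T (A (φ i))
    φ∈A i = decidable-stable (T? (A (φ i))) λ φi∉A → <⇒≱ (≤-trans (loopless i) (≤-reflexive (eq Sub.⁅ i ⁆)))
      (m≤n+o⇒m∸n≤o _ (r (C ∩ A)) (≤-trans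
        (let I = img φ (lookup Sub.⁅ i ⁆) ; w = φ i ; I⊆ = ⊆-trans (img-mono φ (proj₁ (lookup-⁅⁆ i))) (img-⁅⁆ φ i) in
         (≤-by M (I ∷ C ∷ A ∷ ⁅ w ⁆ ∷ []) ((s0 , s3) ∷ (s3 , ~ s2) ∷ []) []
           (rk ((s0 || s1) && s2) ≼ rk (s1 && s2)) [] refl (I⊆ , ⁅⁆-⊆∁ A φi∉A , tt) tt)) (m≤m+n (r (C ∩ A)) 0)))
    img⊆A : ∀ X → img φ (lookup X) ⊆ A
    img⊆A X j t with ∈-img⁻ φ (lookup X) t
    ... | i , _ , refl = φ∈A i

  minor-contract : ∀ K → HasMinor (rankFn (contract M K)) T₀ → HasMinor (rankFn M) T₀
  minor-contract K h = minor-intro M T₀ (C ∪ K) φ inj loopless λ X → trans (eq X)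
    (trans (∸-cancel (≤-by M (C ∷ K ∷ []) [] [] (rk s1 ≼ rk (s0 || s1)) (mon s1 (s0 || s1) ∷ []) refl tt tt))
      (cong (_∸ r (C ∪ K)) (let I = img φ (lookup X) in (≤-antisym
          (≤-by M (I ∷ C ∷ K ∷ []) [] []
        (rk (s0 || s1 || s2) ≼ rk (s0 || (s1 || s2))) [] refl tt tt)
          (≤-by M (I ∷ C ∷ K ∷ []) [] []
        (rk (s0 || (s1 || s2)) ≼ rk (s0 || s1 || s2)) [] refl tt tt)))))
    where
    open Minor (minor-elim (contract M K) T₀ h)
    ∸-cancel : ∀ {a c k} → k ≤ c → (a ∸ k) ∸ (c ∸ k) ≡ a ∸ c
    ∸-cancel {a} {c} {k} k≤c = trans (∸-+-assoc a k (c ∸ k)) (cong (a ∸_) (m+[n∸m]≡n k≤c))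

  minor-cong : ∀ ρ′ → (∀ X → ρ′ X ≡ ρ X) → HasMinor (rankFn M) (proj₁ T₀ , ρ′) → HasMinor (rankFn M) T₀
  minor-cong ρ′ same (C , φ , inj , φ∉C , eq) = C , φ , inj , φ∉C , λ X → trans (sym (same X)) (eq X)

  -- Called for by M(K₄), whose dual agrees with it only after a permutation of the edges.
  minor-relabel : ∀ (ψ : Fin (proj₁ T₀) → Fin (proj₁ T₀)) ρ′ → Injective ψ → (∀ X → ρ′ (image ψ X) ≡ ρ X) →
                  HasMinor (rankFn M) (proj₁ T₀ , ρ′) → HasMinor (rankFn M) T₀
  minor-relabel ψ ρ′ ψ-inj same h = minor-intro M T₀ C (φ ∘ ψ) (λ i j → ψ-inj i j ∘ inj _ _) loopless λ X →
    trans (sym (same X)) (trans (eq (image ψ X)) (cong (_∸ r C) (r-cong M (∪-congˡ C (relabelled X)))))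
    where
    open Minor (minor-elim M (proj₁ T₀ , ρ′) h)
    image≐ : ∀ X → lookup (image ψ X) ≐ img ψ (lookup X)
    image≐ X = ≗⇒≐ (VecP.lookup∘tabulate _)
    relabelled : ∀ X → img φ (lookup (image ψ X)) ≐ img (φ ∘ ψ) (lookup X)
    relabelled X = to , from
      where
      to : img φ (lookup (image ψ X)) ⊆ img (φ ∘ ψ) (lookup X)
      to j t with ∈-img⁻ φ _ t
      ... | i , i∈ , refl with ∈-img⁻ ψ (lookup X) (proj₁ (image≐ X) i i∈)
      ...   | k , k∈ , refl = ∈-img⁺ (φ ∘ ψ) (lookup X) k∈
      from : img (φ ∘ ψ) (lookup X) ⊆ img φ (lookup (image ψ X))
      from j t with ∈-img⁻ (φ ∘ ψ) (lookup X) t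
      ... | i , i∈ , refl = ∈-img⁺ φ _ (proj₂ (image≐ X) (ψ i) (∈-img⁺ ψ (lookup X) i∈))

card-lookup : ∀ {m} (X : Subset m) → Sub.∣ X ∣ ≡ card (lookup X)
card-lookup []          = refl
card-lookup (true ∷ X)  = cong suc (card-lookup X)
card-lookup (false ∷ X) = card-lookup X

lookup-∁ : ∀ {m} (X : Subset m) → lookup (Sub.∁ X) ≐ ∁ (lookup X)
lookup-∁ X = ≗⇒≐ λ i → VecP.lookup-map i not X

lookup-⊤ : ∀ {m} → lookup (Sub.⊤ {m}) ≐ 𝟙
lookup-⊤ = ≗⇒≐ λ i → VecP.lookup-replicate i true

card-img : ∀ {m n} (φ : Fin m → Fin n) C → Injective φ → (∀ i → ¬ T (C (φ i))) →
           ∀ X → card (img φ X ∪ C) ≡ card X + card C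
card-img {m} φ C inj φ∉C = set-induction (λ S → card (img φ S ∪ C) ≡ card S + card C)
  (λ { {X} {Y} (p , q) h → trans (card-≐ (grow q , grow p)) (trans h (cong (_+ card C) (card-≐ (p , q)))) })
  (trans (card-≐ (∪-∅ , λ i t → ∨⁺ {img φ ∅ i} (inj₂ t))) (cong (_+ card C) (sym (card-∅ {m}))))
  insert
  where
  grow : ∀ {X Y} → X ⊆ Y → img φ X ∪ C ⊆ img φ Y ∪ C
  grow p = ∪-mono₂ (img-mono φ p) (⊆-refl C)
  ∪-∅ : img φ ∅ ∪ C ⊆ C
  ∪-∅ i t with ∨⁻ {img φ ∅ i} t
  ... | inj₁ p = ⊥-elim (img-∅ φ i p)
  ... | inj₂ p = p
  insert : ∀ S z → card (img φ S ∪ C) ≡ card S + card C → card (img φ (S ∪ ⁅ z ⁆) ∪ C) ≡ card (S ∪ ⁅ z ⁆) + card C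
  insert S z h with T? (S z)
  ... | yes z∈S = trans (card-≐ (grow ⊆S , grow S⊆)) (trans h (cong (_+ card C) (card-≐ (S⊆ , ⊆S))))
    where
    S⊆ = ⊆-by (S ∷ ⁅ z ⁆ ∷ []) [] s0 (s0 || s1) refl tt
    ⊆S = ⊆-by (S ∷ ⁅ z ⁆ ∷ []) ((s1 , s0) ∷ []) (s0 || s1) s0 refl (⁅⁆-⊆ S z∈S , tt)
  ... | no  z∉S = trans (card-≐ (to , from)) (trans (card-insert (img φ S ∪ C) (φ z) φz∉)
                    (trans (cong suc h) (cong (_+ card C) (sym (card-insert S z z∉S)))))
    where
    φz∉ : ¬ T ((img φ S ∪ C) (φ z))
    φz∉ t with ∨⁻ {img φ S (φ z)} t
    ... | inj₂ p = φ∉C z p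
    ... | inj₁ p with ∈-img⁻ φ S p
    ...   | i , i∈S , φi≡φz = z∉S (subst (T ∘ S) (inj i z φi≡φz) i∈S)
    to : img φ (S ∪ ⁅ z ⁆) ∪ C ⊆ img φ S ∪ C ∪ ⁅ φ z ⁆
    to = let I = img φ (S ∪ ⁅ z ⁆) ; J = img φ S ; w = φ z ; I⊆ = ⊆-trans (img-∪ φ S ⁅ z ⁆) (∪-mono₂ (⊆-refl (img φ S)) (img-⁅⁆ φ z)) in
      (⊆-by (I ∷ J ∷ C ∷ ⁅ w ⁆ ∷ []) ((s0 , s1 || s3) ∷ []) (s0 || s2) (s1 || s2 || s3) refl (I⊆ , tt))
    from : img φ S ∪ C ∪ ⁅ φ z ⁆ ⊆ img φ (S ∪ ⁅ z ⁆) ∪ C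
    from = let I = img φ (S ∪ ⁅ z ⁆) ; J = img φ S ; w = φ z ; J⊆ = img-mono φ {S} {S ∪ ⁅ z ⁆} (⊆-by (S ∷ ⁅ z ⁆ ∷ []) [] s0 (s0 || s1) refl tt)
               w⊆ = ⁅⁆-⊆ I (∈-img⁺ φ (S ∪ ⁅ z ⁆) (∨⁺ {S z} (inj₂ (∈-⁅⁆ z)))) in
      (⊆-by (I ∷ J ∷ C ∷ ⁅ w ⁆ ∷ []) ((s1 , s0) ∷ (s3 , s0) ∷ []) (s1 || s2 || s3) (s0 || s2) refl (J⊆ , w⊆ , tt))

module _ {n : ℕ} (M : Mat n) (m : ℕ) (ρ : RankFn m) (loopless : Loopless (dual ρ)) where
  open Mat M

  minor-dual : HasMinor (rankFn (dualMat M)) (m , ρ) → HasMinor (rankFn M) (m , dual ρ)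
  minor-dual h = minor-intro M (m , dual ρ) D φ inj loopless λ X → begin
    Sub.∣ X ∣ + ρ (Sub.∁ X) ∸ ρ Sub.⊤
      ≡⟨ sym ([m+n]∸[m+o]≡n∸o (r (∁ C)) _ _) ⟩
    (r (∁ C) + (Sub.∣ X ∣ + ρ (Sub.∁ X))) ∸ (r (∁ C) + ρ Sub.⊤)
      ≡⟨ cong₂ _∸_ (num X) den ⟩
    (card (𝟙 {m}) + r (img φ (lookup X) ∪ D)) ∸ (card (𝟙 {m}) + r D)
      ≡⟨ [m+n]∸[m+o]≡n∸o (card (𝟙 {m})) _ _ ⟩
    r (img φ (lookup X) ∪ D) ∸ r D ∎
    where
    open ≡-Reasoning
    open Minor (minor-elim (dualMat M) (m , ρ) h)
    -- Deletion and contraction exchange roles.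
    D = ∁ (img φ 𝟙 ∪ C)
    r* = Mat.r (dualMat M)

    -- The rank of the minor of the dual without truncated subtraction. Its values at the complement
    -- of a set and at the full set are what the dual rank is made of.
    rank-eq : ∀ Y → ρ Y + r (∁ C) ≡ card (lookup Y) + r (∁ (img φ (lookup Y) ∪ C))
    rank-eq Y = +-cancelˡ-≡ (card C) _ _ (begin
      card C + (ρ Y + r (∁ C))                          ≡⟨ shuffle (card C) (ρ Y) (r (∁ C)) ⟩
      ρ Y + (card C + r (∁ C))                          ≡⟨ cong (ρ Y +_) (sym (dual-rank M C)) ⟩
      ρ Y + (r* C + r 𝟙)                                ≡⟨ sym (+-assoc (ρ Y) _ _) ⟩
      ρ Y + r* C + r 𝟙                                  ≡⟨ cong (λ k → k + r* C + r 𝟙) (eq Y) ⟩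
      r* (img φ (lookup Y) ∪ C) ∸ r* C + r* C + r 𝟙     ≡⟨ cong (_+ r 𝟙) (m∸n+n≡m (Mat.mono (dualMat M) {C} (C⊆ Y))) ⟩
      r* (img φ (lookup Y) ∪ C) + r 𝟙                   ≡⟨ dual-rank M (img φ (lookup Y) ∪ C) ⟩
      card (img φ (lookup Y) ∪ C) + r (∁ (img φ (lookup Y) ∪ C))
        ≡⟨ cong (_+ r (∁ (img φ (lookup Y) ∪ C))) (trans (card-img φ C inj φ∉C (lookup Y)) (+-comm _ (card C))) ⟩
      card C + card (lookup Y) + r (∁ (img φ (lookup Y) ∪ C)) ≡⟨ +-assoc (card C) _ _ ⟩
      card C + (card (lookup Y) + r (∁ (img φ (lookup Y) ∪ C))) ∎)
      where
      shuffle : ∀ a b c → a + (b + c) ≡ b + (a + c)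
      shuffle = solve-∀
      C⊆ : ∀ Y → C ⊆ img φ (lookup Y) ∪ C
      C⊆ Y i t = ∨⁺ {img φ (lookup Y) i} (inj₂ t)

    den : r (∁ C) + ρ Sub.⊤ ≡ card (𝟙 {m}) + r D
    den = trans (+-comm (r (∁ C)) _) (trans (rank-eq Sub.⊤) (cong₂ _+_ (card-≐ {m} {lookup Sub.⊤} {𝟙} (lookup-⊤ {m}))
      (r-cong M (∁-cong (∪-mono₂ (img-mono φ {lookup Sub.⊤} {𝟙} (proj₁ lookup-⊤)) (⊆-refl C) , ∪-mono₂
          (img-mono φ {𝟙} {lookup Sub.⊤} (proj₂ lookup-⊤)) (⊆-refl C))))))

    complement : ∀ X → ∁ (img φ (lookup (Sub.∁ X)) ∪ C) ≐ img φ (lookup X) ∪ D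
    complement X = to , from
      where
      A = img φ (lookup X)
      B = img φ (lookup (Sub.∁ X))
      I = img φ 𝟙
      I⊆ : I ⊆ A ∪ B
      I⊆ j t with ∈-img⁻ φ 𝟙 t
      ... | i , _ , refl with T? (lookup X i)
      ...   | yes i∈ = ∨⁺ (inj₁ (∈-img⁺ φ (lookup X) i∈))
      ...   | no i∉  = ∨⁺ {A (φ i)} (inj₂ (∈-img⁺ φ (lookup (Sub.∁ X)) (proj₂ (lookup-∁ X) i (T-not i∉))))
      B⊆I : B ⊆ I
      B⊆I = img-mono φ (⊆𝟙 (lookup (Sub.∁ X)))
      A⊆∁C : A ⊆ ∁ C
      A⊆∁C j t with ∈-img⁻ φ (lookup X) t
      ... | i , _ , refl = T-not (φ∉C i)
      A⊆∁B : A ⊆ ∁ B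
      A⊆∁B j t with ∈-img⁻ φ (lookup X) t
      ... | i , i∈ , refl = T-not λ t′ → clash (∈-img⁻ φ (lookup (Sub.∁ X)) t′)
        where
        clash : ¬ (∃ λ k → T (lookup (Sub.∁ X) k) × φ k ≡ φ i)
        clash (k , k∈ , φk≡φi) = not-T (proj₁ (lookup-∁ X) k k∈) (subst (T ∘ lookup X) (sym (inj k i φk≡φi)) i∈)
      to : ∁ (B ∪ C) ⊆ A ∪ ∁ (I ∪ C)
      to = ⊆-by (A ∷ B ∷ I ∷ C ∷ []) ((s2 , s0 || s1) ∷ []) (~ (s1 || s3)) (s0 || ~ (s2 || s3)) refl (I⊆ , tt)
      from : A ∪ ∁ (I ∪ C) ⊆ ∁ (B ∪ C)
      from = ⊆-by (A ∷ B ∷ I ∷ C ∷ []) ((s0 , ~ s1) ∷ (s0 , ~ s3) ∷ (s1 , s2) ∷ []) (s0 || ~ (s2 || s3)) (~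
          (s1 || s3)) refl (A⊆∁B , A⊆∁C , B⊆I , tt)

    num : ∀ X → r (∁ C) + (Sub.∣ X ∣ + ρ (Sub.∁ X)) ≡ card (𝟙 {m}) + r (img φ (lookup X) ∪ D)
    num X = begin
      r (∁ C) + (Sub.∣ X ∣ + ρ (Sub.∁ X))      ≡⟨ shuffle (r (∁ C)) Sub.∣ X ∣ _ ⟩
      Sub.∣ X ∣ + (ρ (Sub.∁ X) + r (∁ C))      ≡⟨ cong (Sub.∣ X ∣ +_) (rank-eq (Sub.∁ X)) ⟩
      Sub.∣ X ∣ + (card (lookup (Sub.∁ X)) + r (∁ (img φ (lookup (Sub.∁ X)) ∪ C))) ≡⟨ sym (+-assoc Sub.∣ X ∣ _ _) ⟩
      Sub.∣ X ∣ + card (lookup (Sub.∁ X)) + r (∁ (img φ (lookup (Sub.∁ X)) ∪ C))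
        ≡⟨ cong₂ _+_ (trans (cong₂ _+_ (card-lookup X) (card-≐ (lookup-∁ X))) (card-∁ (lookup X))) (r-cong M
            (complement X)) ⟩
      card (𝟙 {m}) + r (img φ (lookup X) ∪ D) ∎
      where
      shuffle : ∀ a b c → a + (b + c) ≡ b + (c + a)
      shuffle = solve-∀

same-rank : ∀ {m} (ρ ρ′ : RankFn m) → allSubsets (λ X → ρ X ≡ᵇ ρ′ X) ≡ true → ∀ X → ρ X ≡ ρ′ X
same-rank ρ ρ′ ok X = ≡ᵇ⇒≡ (ρ X) (ρ′ X) (allSubsets-sound _ (≡⇒T ok) X)

opposite-injective : ∀ {n} → Injective (opposite {n})
opposite-injective i j eq = trans (sym (opposite-involutive i)) (trans (cong opposite eq) (opposite-involutive j))

HasMinor-≗ : ∀ {n} (R : RankFn n) m (ρ ρ′ : RankFn m) → (∀ X → ρ X ≡ ρ′ X) → HasMinor R (m , ρ) → HasMinor R (m , ρ′)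
HasMinor-≗ R m ρ ρ′ same (C , φ , inj , φ∉C , eq) = C , φ , inj , φ∉C , λ X → trans (sym (same X)) (eq X)

-- Opaque, since conversion checking would unfold these rank functions on symbolic
-- sets; they are compared by evaluation on all subsets instead.
opaque
  rU24 : RankFn 4
  rU24 = uniform 2 4

  rK4 rK23 rK23* : RankFn 6
  rK4   = cycleRank K4
  rK23  = cycleRank K23
  rK23* = dual (cycleRank K23)

opaque
  unfolding rU24

  rU24-def : ∀ X → uniform 2 4 X ≡ rU24 X
  rU24-def = same-rank (uniform 2 4) rU24 refl

  rK4-def : ∀ X → cycleRank K4 X ≡ rK4 X
  rK4-def = same-rank (cycleRank K4) rK4 refl

  rK23-def : ∀ X → cycleRank K23 X ≡ rK23 X
  rK23-def = same-rank (cycleRank K23) rK23 refl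

  rK23*-def : ∀ X → dual (cycleRank K23) X ≡ rK23* X
  rK23*-def = same-rank (dual (cycleRank K23)) rK23* refl

  dual-rU24 : ∀ X → dual rU24 X ≡ rU24 X
  dual-rU24 = same-rank (dual rU24) rU24 refl

  -- Taking complements of spanning trees of K₄ exchanges opposite edges, and in
  -- the edge order of K4 the edge opposite to i is 5 − i.
  dual-rK4 : ∀ X → dual rK4 (image opposite X) ≡ rK4 X
  dual-rK4 = same-rank (dual rK4 ∘ image opposite) rK4 refl

  dual-rK23 : ∀ X → dual rK23 X ≡ rK23* X
  dual-rK23 = same-rank (dual rK23) rK23* refl

  dual-rK23* : ∀ X → dual rK23* X ≡ rK23 X
  dual-rK23* = same-rank (dual rK23*) rK23 refl

  rU24-loopless : Loopless rU24
  rU24-loopless = toWitness {a? = all? λ i → 1 ≤? rU24 Sub.⁅ i ⁆} tt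

  rK4-loopless : Loopless rK4
  rK4-loopless = toWitness {a? = all? λ i → 1 ≤? rK4 Sub.⁅ i ⁆} tt

  dual-rK4-loopless : Loopless (dual rK4)
  dual-rK4-loopless = toWitness {a? = all? λ i → 1 ≤? dual rK4 Sub.⁅ i ⁆} tt

  rK23-loopless : Loopless rK23
  rK23-loopless = toWitness {a? = all? λ i → 1 ≤? rK23 Sub.⁅ i ⁆} tt

  rK23*-loopless : Loopless rK23*
  rK23*-loopless = toWitness {a? = all? λ i → 1 ≤? rK23* Sub.⁅ i ⁆} tt

-- The family of obstructions and its closure under duality

data Obstruction : Set where
  u24 k4 k23 k23* : Obstruction

size : Obstruction → ℕ
size u24 = 4
size _   = 6

rankOf : ∀ o → RankFn (size o)
rankOf u24  = rU24
rankOf k4   = rK4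
rankOf k23  = rK23
rankOf k23* = rK23*

loopless : ∀ o → Loopless (rankOf o)
loopless u24  = rU24-loopless
loopless k4   = rK4-loopless
loopless k23  = rK23-loopless
loopless k23* = rK23*-loopless

module _ {n : ℕ} (M : Mat n) where

  minor-dual-≗ : ∀ m (ρ ρ′ : RankFn m) → (∀ X → dual ρ X ≡ ρ′ X) → Loopless ρ′ →
                 HasMinor (rankFn (dualMat M)) (m , ρ) → HasMinor (rankFn M) (m , ρ′)
  minor-dual-≗ m ρ ρ′ same loopless h = minor-cong M (m , ρ′) loopless (dual ρ) same
    (minor-dual M m ρ (λ i → ≤-trans (loopless i) (≤-reflexive (sym (same Sub.⁅ i ⁆)))) h)

  minor-dual-relabel : ∀ m (ρ ρ′ : RankFn m) (ψ : Fin m → Fin m) → Injective ψ → (∀ X → dual ρ (image ψ X) ≡ ρ′ X) →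
                       Loopless (dual ρ) → Loopless ρ′ →
                       HasMinor (rankFn (dualMat M)) (m , ρ) → HasMinor (rankFn M) (m , ρ′)
  minor-dual-relabel m ρ ρ′ ψ ψ-inj same loopless loopless′ h =
    minor-relabel M (m , ρ′) loopless′ ψ (dual ρ) ψ-inj same (minor-dual M m ρ loopless h)

_* : Obstruction → Obstruction
u24 *  = u24
k4 *   = k4
k23 *  = k23*
k23* * = k23

minor-dual* : ∀ {n} (M : Mat n) o → HasMinor (rankFn (dualMat M)) (size o , rankOf o) → HasMinor (rankFn M)
    (size (o *) , rankOf (o *))
minor-dual* M u24  = minor-dual-≗ M 4 rU24 rU24 dual-rU24 rU24-loopless
minor-dual* M k4   = minor-dual-relabel M 6 rK4 rK4 opposite opposite-injective dual-rK4 dual-rK4-loopless rK4-loopless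
minor-dual* M k23  = minor-dual-≗ M 6 rK23 rK23* dual-rK23 rK23*-loopless
minor-dual* M k23* = minor-dual-≗ M 6 rK23* rK23 dual-rK23* rK23-loopless

Free : ∀ {n} → Mat n → Set
Free M = ∀ o → ¬ HasMinor (rankFn M) (size o , rankOf o)

module _ {n : ℕ} (M : Mat n) (free : Free M) where

  free-restrict : ∀ A → Free (restrict M A)
  free-restrict A o h = free o (minor-restrict M (size o , rankOf o) (loopless o) A h)

  free-contract : ∀ K → Free (contract M K)
  free-contract K o h = free o (minor-contract M (size o , rankOf o) (loopless o) K h)

  free-dual : Free (dualMat M)
  free-dual o h = free (o *) (minor-dual* M o h)

-- These are the transparent rank functions in which the theorem is stated; the arguments use the
-- opaque `rankOf`, and the two are exchanged pointwise.
HasObstruction : ∀ {n} → RankFn n → Obstruction → Set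
HasObstruction R u24  = HasMinor R U24
HasObstruction R k4   = HasMinor R MK4
HasObstruction R k23  = HasMinor R MK23
HasObstruction R k23* = HasMinor R MK23*

to-obstruction : ∀ {n} (R : RankFn n) o → HasObstruction R o → HasMinor R (size o , rankOf o)
to-obstruction R u24  = HasMinor-≗ R 4 (uniform 2 4) rU24 rU24-def
to-obstruction R k4   = HasMinor-≗ R 6 (cycleRank K4) rK4 rK4-def
to-obstruction R k23  = HasMinor-≗ R 6 (cycleRank K23) rK23 rK23-def
to-obstruction R k23* = HasMinor-≗ R 6 (dual (cycleRank K23)) rK23* rK23*-def

from-obstruction : ∀ {n} (R : RankFn n) o → HasMinor R (size o , rankOf o) → HasObstruction R o
from-obstruction R u24  = HasMinor-≗ R 4 rU24 (uniform 2 4) (sym ∘ rU24-def)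
from-obstruction R k4   = HasMinor-≗ R 6 rK4 (cycleRank K4) (sym ∘ rK4-def)
from-obstruction R k23  = HasMinor-≗ R 6 rK23 (cycleRank K23) (sym ∘ rK23-def)
from-obstruction R k23* = HasMinor-≗ R 6 rK23* (dual (cycleRank K23)) (sym ∘ rK23*-def)

-- Construction of narrow orderings

actives : ∀ {n} → Mat n → P n
actives M x = ⌊ Active? M x ⌋

card-< : ∀ {n} {X Y : P n} {y} → X ⊆ Y → T (Y y) → ¬ T (X y) → card X < card Y
card-< {X = X} {Y} {y} X⊆Y y∈Y y∉X = ≤-trans (≤-reflexive (sym (card-insert X y y∉X)))
  (card-mono (let p = ⁅⁆-⊆ Y y∈Y in (⊆-by (X ∷ Y ∷ ⁅ y ⁆ ∷ []) ((s0 , s1) ∷ (s2 , s1) ∷ []) (s0 || s2) s1 refl (X⊆Y , p , tt))))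

actives-< : ∀ {n} (M N : Mat n) {y} → (∀ {x} → Active N x → Active M x) → Active M y → ¬ Active N y →
            card (actives N) < card (actives M)
actives-< M N {y} shrink active inactive = card-< {X = actives N} {actives M} {y} (λ x t → fromWitness {a? =
    Active? M x} (shrink (toWitness {a? = Active? N x} t)))
  (fromWitness {a? = Active? M y} active) (inactive ∘ toWitness {a? = Active? N y})

module _ {n : ℕ} (M : Mat n) where
  open Mat M
  private
    M* = dualMat M
    r* = Mat.r M*

  restrict-inactive : ∀ A {x} → ¬ T (A x) → ¬ Active (restrict M A) x
  restrict-inactive A {x} x∉A (l , _) = 1≰0 (≤-by M (A ∷ ⁅ x ⁆ ∷ []) ((s1 , ~ s0) ∷ [])
    ((lit 1 ≼ rk (s1 && s0)) ∷ []) (lit 1 ≼ lit 0) [] refl (⁅⁆-⊆∁ A x∉A , tt) (l , tt))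

  restrict-active : ∀ A {x} → Active (restrict M A) x → Active M x
  restrict-active A {x} (l , c) with T? (A x)
  ... | no x∉A  = ⊥-elim (restrict-inactive A x∉A (l , c))
  ... | yes x∈A = (≤-by M (A ∷ ⁅ x ⁆ ∷ []) [] ((lit 1 ≼ rk (s1 && s0)) ∷ []) (lit 1 ≼ rk s1)
    (mon (s1 && s0) s1 ∷ []) refl tt (l , tt)) ,
                  (≤-by M (A ∷ ⁅ x ⁆ ∷ []) ((s1 , s0) ∷ []) ((rk (𝟙ᵉ && s0) ≼ rk (~ s1 && s0)) ∷ [])
                    (rk 𝟙ᵉ ≼ rk (~ s1)) (sub (𝟙ᵉ && s0) (~ s1) ∷ []) refl (⁅⁆-⊆ A x∈A , tt) (c , tt))

  contract-inactive : ∀ e → ¬ Active (contract M ⁅ e ⁆) e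
  contract-inactive e (l , _) = <⇒≱ l (m≤n+o⇒m∸n≤o _ (r ⁅ e ⁆) (≤-trans (≤-by M (⁅ e ⁆ ∷ []) [] []
    (rk (s0 || s0) ≼ rk s0) [] refl tt tt) (m≤m+n (r ⁅ e ⁆) 0)))

  contract-active : ∀ e {x} → Active (contract M ⁅ e ⁆) x → Active M x
  contract-active e {x} (l , c) with x ≟ e
  ... | yes refl = ⊥-elim (contract-inactive e (l , c))
  ... | no x≢e =
    ≤-trans l (m≤n+o⇒m∸n≤o _ (r ⁅ e ⁆) (≤-by M (⁅ x ⁆ ∷ ⁅ e ⁆ ∷ []) [] [] (rk (s0 || s1) ≼ rk s1 ⊕ rk s0)
      (sub s0 s1 ∷ []) refl tt tt)) ,
    ≤-trans (≤-by M (⁅ e ⁆ ∷ []) [] [] (rk 𝟙ᵉ ≼ rk (𝟙ᵉ || s0)) [] refl tt tt) (≤-trans (∸-cancelʳ (r ⁅ e ⁆)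
        (≤-by M (⁅ e ⁆ ∷ [])
      [] [] (rk s0 ≼ rk (𝟙ᵉ || s0)) (mon s0 (𝟙ᵉ || s0) ∷ []) refl tt tt) (≤-by M (⁅ x ⁆ ∷ ⁅ e ⁆ ∷ []) [] []
        (rk s1 ≼ rk (~ s0 || s1)) (mon s1 (~ s0 || s1) ∷ []) refl tt tt) c)
      (≤-by M (⁅ x ⁆ ∷ ⁅ e ⁆ ∷ []) ((s1 , ~ s0) ∷ []) [] (rk (~ s0 || s1) ≼ rk (~ s0)) [] refl
        (≢-⊆∁ (x≢e ∘ sym) , tt) tt))
    where
    ∸-cancelʳ : ∀ {a b} k → k ≤ a → k ≤ b → a ∸ k ≤ b ∸ k → a ≤ b
    ∸-cancelʳ k k≤a k≤b h = ≤-trans (≤-reflexive (sym (m∸n+n≡m k≤a))) (≤-trans (+-monoˡ-≤ k h) (≤-reflexive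
        (m∸n+n≡m k≤b)))

  -- λ is self-dual: in the sum of the two dual ranks the cardinalities add up to a constant. Each
  -- side carries the total rank of the other matroid, which avoids subtraction.
  dual-λ : ∀ X → r* X + r* (∁ X) + r 𝟙 ≡ r X + r (∁ X) + r* 𝟙
  dual-λ X = +-cancelʳ-≡ (r 𝟙) _ _ (trans (shuffle (r* X) (r* (∁ X)) (r 𝟙)) (trans
    (cong₂ _+_ (dual-rank M X) (dual-rank M (∁ X))) (trans (shuffle′ (card X) (r (∁ X)) (card (∁ X)) (r (∁ (∁
        X)))) (trans
    (cong₂ _+_ (cong₂ _+_ (r-cong M (≐-by (X ∷ []) [] (~ (~ s0)) s0 refl tt)) refl) (trans (card-∁ X) r*𝟙))
    (sym (+-assoc (r X + r (∁ X)) _ _))))))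
    where
    shuffle : ∀ a b c → a + b + c + c ≡ (a + c) + (b + c)
    shuffle = solve-∀
    shuffle′ : ∀ a b c d → (a + b) + (c + d) ≡ (d + b) + (a + c)
    shuffle′ = solve-∀
    r*𝟙 : card (𝟙 {n}) ≡ r* 𝟙 + r 𝟙
    r*𝟙 = sym (trans (dual-rank M 𝟙) (trans (cong (card (𝟙 {n}) +_) (≤-antisym
        (≤-by M [] [] [] (rk (~ 𝟙ᵉ) ≼ lit 0) []
      refl tt tt)
        (≤-by M [] [] [] (lit 0 ≼ rk (~ 𝟙ᵉ)) []
      refl tt tt))) (+-identityʳ _)))

  dual-λ-≤ : ∀ k X → r* X + r* (∁ X) ≤ k + r* 𝟙 → r X + r (∁ X) ≤ k + r 𝟙
  dual-λ-≤ k X h = +-cancelʳ-≤ (r* 𝟙) _ _ (≤-trans (≤-reflexive (sym (dual-λ X)))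
    (≤-trans (+-monoˡ-≤ (r 𝟙) h) (≤-reflexive (shuffle k (r* 𝟙) (r 𝟙)))))
    where
    shuffle : ∀ a b c → a + b + c ≡ a + c + b
    shuffle = solve-∀

  dual-active : ∀ {x} → Active M x → Active M* x
  dual-active {x} (l , c) =
    +-cancelʳ-≤ (r 𝟙) _ _ (≤-trans (s≤s c) (≤-reflexive (trans (cong (_+ r (∁ ⁅ x ⁆)) (sym (card-⁅⁆ x))) (sym
        (dual-rank M ⁅ x ⁆))))) ,
    +-cancelʳ-≤ (r 𝟙) _ _ (≤-trans (≤-reflexive (dual-rank M 𝟙)) (≤-trans (+-mono-≤ (≤-reflexive (sym (card-∁
        ⁅ x ⁆))) (≤-by M []
      [] [] (rk (~ 𝟙ᵉ) ≼ lit 0) [] refl tt tt))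
      (≤-trans (≤-reflexive (trans (+-identityʳ _) (trans (cong (_+ card (∁ ⁅ x ⁆)) (card-⁅⁆ x)) (+-comm 1 _))))
        (≤-trans (+-monoʳ-≤ (card (∁ ⁅ x ⁆)) (≤-trans l (≤-by M (⁅ x ⁆ ∷ []) [] [] (rk s0 ≼ rk (~ (~ s0)))
          [] refl tt tt))) (≤-reflexive (sym (dual-rank M (∁ ⁅ x ⁆))))))))

  active-dual : ∀ {x} → Active M* x → Active M x
  active-dual {x} (l , c) =
    +-cancelˡ-≤ (card (∁ ⁅ x ⁆)) _ _ (≤-trans (≤-reflexive (trans (+-comm _ 1) (trans (cong (_+ card (∁ ⁅ x
        ⁆)) (sym (card-⁅⁆ x))) (card-∁ ⁅ x ⁆))))
      (≤-trans (≤-trans (m≤m+n (card (𝟙 {n})) _) (≤-reflexive (sym (dual-rank M 𝟙))))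
        (≤-trans (+-monoˡ-≤ (r 𝟙) c) (≤-trans (≤-reflexive (dual-rank M (∁ ⁅ x ⁆))) (+-monoʳ-≤ (card (∁ ⁅ x
            ⁆)) (≤-by M (⁅ x ⁆ ∷ [])
          [] [] (rk (~ (~ s0)) ≼ rk s0) [] refl tt tt)))))) ,
    +-cancelˡ-≤ 1 _ _ (≤-trans (+-monoˡ-≤ (r 𝟙) l) (≤-reflexive (trans (dual-rank M ⁅ x ⁆) (cong (_+ r (∁ ⁅ x
        ⁆)) (card-⁅⁆ x)))))

  dual-parallel : ∀ {e f} → r (∁ (⁅ e ⁆ ∪ ⁅ f ⁆)) < r 𝟙 → r* (⁅ e ⁆ ∪ ⁅ f ⁆) ≤ 1
  dual-parallel {e} {f} h = +-cancelʳ-≤ (r 𝟙) _ _ (≤-trans (≤-reflexive (dual-rank M (⁅ e ⁆ ∪ ⁅ f ⁆)))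
    (≤-trans (+-monoˡ-≤ _ (≤-trans (≤-trans (m≤m+n _ _) (≤-reflexive (card-modular ⁅ e ⁆ ⁅ f ⁆)))
        (≤-reflexive (cong₂ _+_ (card-⁅⁆ e) (card-⁅⁆ f))))) (s≤s h)))

  dual-connected : Connected M → Connected M*
  dual-connected connected A sep a-u a-v = connected A (dual-λ-≤ 0 A sep) (active-dual a-u) (active-dual a-v)

  dual-path : Path (Narrow M*) ∅ 𝟙 → Path (Narrow M) ∅ 𝟙
  dual-path = map-path (λ X → X) (λ {X} {Y} → Narrow-resp M {X} {Y}) (λ eq → eq) (λ X z h → add z (dual-λ-≤ 1
      (X ∪ ⁅ z ⁆) h) (done ≐-refl))

  -- Existence statements over finite types, hence decidable by search. A separation is a `Subset n`
  -- for that reason, whereas `Connected` speaks of functions.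
  ParallelPair SeriesPair Separation : Set
  ParallelPair = ∃ λ e → ∃ λ f → Active M e × Active M f × e ≢ f × r (⁅ e ⁆ ∪ ⁅ f ⁆) ≤ 1
  SeriesPair   = ∃ λ e → ∃ λ f → Active M e × Active M f × e ≢ f × r (∁ (⁅ e ⁆ ∪ ⁅ f ⁆)) < r 𝟙
  Separation   = ∃ λ (S : Subset n) → r (lookup S) + r (∁ (lookup S)) ≤ r 𝟙 ×
                   ∃ λ u → ∃ λ v → Active M u × Active M v × T (lookup S u) × ¬ T (lookup S v)

  parallelPair? : Dec ParallelPair
  parallelPair? = any? λ e → any? λ f → Active? M e ×-dec (Active? M f ×-dec (¬? (e ≟ f) ×-dec (_ ≤? 1)))

  seriesPair? : Dec SeriesPair
  seriesPair? = any? λ e → any? λ f → Active? M e ×-dec (Active? M f ×-dec (¬? (e ≟ f) ×-dec (_ <? r 𝟙)))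

  separation? : Dec Separation
  separation? = anySubset? λ S → (_ ≤? r 𝟙) ×-dec any? λ u → any? λ v → Active? M u ×-dec (Active? M v ×-dec
      (T? _ ×-dec ¬? (T? _)))

  no-separation⇒connected : ¬ Separation → Connected M
  no-separation⇒connected ¬s A sep {u} {v} a-u a-v u∈A = decidable-stable (T? (A v)) λ v∉A →
    ¬s (tabulate A , ≤-trans (≤-reflexive (cong₂ _+_ (r-cong M same) (r-cong M (∁-cong same)))) sep , u , v ,
        a-u , a-v , proj₂ same u u∈A , v∉A ∘ proj₁ same v)
    where
    same : lookup (tabulate A) ≐ A
    same = ≗⇒≐ (VecP.lookup∘tabulate A)

  no-active-path : ¬ (∃ λ x → Active M x) → Path (Narrow M) ∅ 𝟙
  no-active-path none = path-congʳ (λ {X} {Y} → Narrow-resp M {X} {Y}) (≐-by [] [] (∅ᵉ || 𝟙ᵉ) 𝟙ᵉ refl tt)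
    (any-order (λ {X} {Y} → Narrow-resp M {X} {Y}) ∅ 𝟙 λ S _ → m≤n⇒m≤1+n (inactive-separator M (∅ ∪ S) (λ {x}
        _ a → none (x , a))))

  no-dense : Free M → (simple : Simple M) (cosimple : Cosimple M) → ∀ {e} (e-active : Active M e) → ¬ Dense M
      simple cosimple e-active
  no-dense free simple cosimple e-active d = [ free u24 ∘ to-obstruction (rankFn M) u24 , free k4 ∘
      to-obstruction (rankFn M) k4 ]′ (dense-minor M simple cosimple e-active d)

  simple-from : ¬ ParallelPair → Simple M
  simple-from ¬p {x} {y} a-x a-y x≢y = ≰⇒> λ h → ¬p (x , y , a-x , a-y , x≢y , h)

  cosimple-from : ¬ SeriesPair → Cosimple M
  cosimple-from ¬s {x} {y} a-x a-y x≢y = ≮⇒≥ λ h → ¬s (x , y , a-x , a-y , x≢y , h)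

  parallel-step : Free M → Connected M → ∀ {e f} → Active M e → Active M f → e ≢ f → r (⁅ e ⁆ ∪ ⁅ f ⁆) ≤ 1 →
                  Path (Narrow (restrict M (∁ ⁅ e ⁆))) ∅ 𝟙 → Path (Narrow M) ∅ 𝟙
  parallel-step free connected {e} {f} a-e a-f e≢f e∥f p with parallel-path M connected e≢f a-f e∥f p
  ... | inj₁ q                   = q
  ... | inj₂ (X , Y , k , A , B) = ⊥-elim (free k23* (to-obstruction (rankFn M) k23* (clusters-K23* M
      connected e≢f a-e a-f e∥f k A B)))

-- The first cases build an ordering from smaller ones. In the last one the ordering of M / e is
-- used only to exhibit U₂,₄ or M(K₄), which contradicts `free`.
free-path : ∀ {n} (M : Mat n) → Acc _<_ (card (actives M)) → Free M → Path (Narrow M) ∅ 𝟙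
free-path M (acc rec) free with any? (Active? M)
... | no none = no-active-path M none
... | yes (e , a-e) with separation? M
...   | yes (S , sep , u , v , a-u , a-v , u∈S , v∉S) = path-separated M A sep
          (free-path (restrict M A) (rec (actives-< M (restrict M A) (restrict-active M A) a-v
              (restrict-inactive M A v∉S))) (free-restrict M free A))
          (free-path (restrict M B) (rec (actives-< M (restrict M B) (restrict-active M B) a-u
              (restrict-inactive M B (λ t → not-T t u∈S)))) (free-restrict M free B))
  where
  A = lookup S
  B = ∁ A
...   | no ¬sep with parallelPair? M | seriesPair? M
...     | yes (x , y , a-x , a-y , x≢y , x∥y) | _ = parallel-step M free (no-separation⇒connected M ¬sep) a-x
    a-y x≢y x∥y
            (free-path N (rec (actives-< M N (restrict-active M A) a-x (restrict-inactive M A (λ t → not-T t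
                (∈-⁅⁆ x))))) (free-restrict M free A))
  where
  A = ∁ ⁅ x ⁆
  N = restrict M A
...     | no _  | yes (x , y , a-x , a-y , x≢y , series) = dual-path M
            (parallel-step M* free* (dual-connected M (no-separation⇒connected M ¬sep)) (dual-active M a-x)
                (dual-active M a-y) x≢y (dual-parallel M {x} {y} series)
              (free-path N (rec (actives-< M N (λ a → active-dual M (restrict-active M* A a)) a-x
                  (restrict-inactive M* A (λ t → not-T t (∈-⁅⁆ x))))) (free-restrict M* free* A)))
  where
  M* = dualMat M
  free* = free-dual M free
  A = ∁ ⁅ x ⁆
  N = restrict M* A
...     | no ¬p | no ¬s = ⊥-elim (no-dense M free (simple-from M ¬p) (cosimple-from M ¬s) a-e
            (dense M (simple-from M ¬p) (cosimple-from M ¬s) a-e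
              (free-path N (rec (actives-< M N (contract-active M e) a-e (contract-inactive M e)))
                  (free-contract M free ⁅ e ⁆))))
  where
  N = contract M ⁅ e ⁆

-- Representability

module _ (F : Field) where
  open Field F using (Carrier; _≈_; 0#; 1#; 0≉1; zeroˡ; zeroʳ; -‿inverseˡ; -‿inverseʳ; distribʳ; setoid)
    renaming (_+_ to _⊞_; _*_ to _⊠_; -_ to ⊟_; refl to ≈-refl; sym to ≈-sym; trans to ≈-trans; reflexive to
        ≈-reflexive;
              +-assoc to ⊞-assoc; +-comm to ⊞-comm; +-cong to ⊞-cong; +-congˡ to ⊞-congˡ; +-congʳ to ⊞-congʳ;
              +-identityˡ to ⊞-identityˡ; +-identityʳ to ⊞-identityʳ; *-identityˡ to ⊠-identityˡ; *-comm to ⊠-comm;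
              *-cong to ⊠-cong; *-congˡ to ⊠-congˡ; *-congʳ to ⊠-congʳ)
  open import Relation.Binary.Reasoning.Setoid setoid

  ∑-cong : ∀ {n} {f g : Fin n → Carrier} → (∀ i → f i ≈ g i) → ∑ F f ≈ ∑ F g
  ∑-cong {zero}  eq = ≈-refl
  ∑-cong {suc n} eq = ⊞-cong (eq Fin.zero) (∑-cong (eq ∘ Fin.suc))

  ∑-zero : ∀ {n} {f : Fin n → Carrier} → (∀ i → f i ≈ 0#) → ∑ F f ≈ 0#
  ∑-zero {zero}  eq = ≈-refl
  ∑-zero {suc n} eq = ≈-trans (⊞-cong (eq Fin.zero) (∑-zero (eq ∘ Fin.suc))) (⊞-identityˡ 0#)

  set : ∀ {n} {A : Set} → Fin n → A → (Fin n → A) → Fin n → A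
  set e a f i = if ⁅ e ⁆ i then a else f i

  set-at : ∀ {n} {A : Set} (e : Fin n) (a : A) f → set e a f e ≡ a
  set-at e a f with e ≟ e
  ... | yes _   = refl
  ... | no  e≢e = ⊥-elim (e≢e refl)

  set-off : ∀ {n} {A : Set} {e i : Fin n} (a : A) f → e ≢ i → set e a f i ≡ f i
  set-off {e = e} {i} a f e≢i with e ≟ i
  ... | yes e≡i = ⊥-elim (e≢i e≡i)
  ... | no  _   = refl

  ∑-split : ∀ {n} (e : Fin n) (f : Fin n → Carrier) → ∑ F f ≈ f e ⊞ ∑ F (set e 0# f)
  ∑-split Fin.zero f = ⊞-congˡ (≈-sym (⊞-identityˡ _))
  ∑-split (Fin.suc e) f = begin
    f Fin.zero ⊞ ∑ F (f ∘ Fin.suc)                              ≈⟨ ⊞-congˡ (∑-split e (f ∘ Fin.suc)) ⟩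
    f Fin.zero ⊞ (f (Fin.suc e) ⊞ ∑ F (set e 0# (f ∘ Fin.suc)))   ≈⟨ ≈-sym (⊞-assoc _ _ _) ⟩
    f Fin.zero ⊞ f (Fin.suc e) ⊞ ∑ F (set e 0# (f ∘ Fin.suc))     ≈⟨ ⊞-congʳ (⊞-comm _ _) ⟩
    f (Fin.suc e) ⊞ f Fin.zero ⊞ ∑ F (set e 0# (f ∘ Fin.suc))     ≈⟨ ⊞-assoc _ _ _ ⟩
    f (Fin.suc e) ⊞ (f Fin.zero ⊞ ∑ F (set e 0# (f ∘ Fin.suc)))   ≈⟨ ⊞-congˡ (⊞-congˡ (∑-cong λ i →
        ≈-reflexive (cong (λ b → if b then 0# else f (Fin.suc i)) (sym (does-suc e i))))) ⟩
    f (Fin.suc e) ⊞ ∑ F (set (Fin.suc e) 0# f) ∎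

  ∑-single : ∀ {n} (e : Fin n) {f : Fin n → Carrier} → (∀ i → e ≢ i → f i ≈ 0#) → ∑ F f ≈ f e
  ∑-single e {f} off = ≈-trans (∑-split e f) (≈-trans (⊞-congˡ (∑-zero vanish)) (⊞-identityʳ (f e)))
    where
    vanish : ∀ i → set e 0# f i ≈ 0#
    vanish i with e ≟ i
    ... | yes _   = ≈-refl
    ... | no  e≢i = off i e≢i

  ∑-two : ∀ {n} {e g : Fin n} → e ≢ g → {f : Fin n → Carrier} → (∀ i → e ≢ i → g ≢ i → f i ≈ 0#) → ∑ F f ≈ f e ⊞ f g
  ∑-two {e = e} {g} e≢g {f} off = ≈-trans (∑-split e f) (⊞-congˡ (≈-trans (∑-single g vanish) (≈-reflexive
      (set-off 0# f e≢g))))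
    where
    vanish : ∀ i → g ≢ i → set e 0# f i ≈ 0#
    vanish i g≢i with e ≟ i
    ... | yes _   = ≈-refl
    ... | no  e≢i = off i e≢i g≢i

  module _ {n d : ℕ} (v : Fin n → Fin d → Carrier) where

    Relation : (Fin n → Carrier) → Set
    Relation c = ∀ k → ∑ F (λ i → c i ⊠ v i k) ≈ 0#

    Supported : P n → (Fin n → Carrier) → Set
    Supported X c = ∀ i → ¬ T (X i) → c i ≈ 0#

    Independent : P n → Set
    Independent X = ∀ c → Supported X c → Relation c → ∀ i → c i ≈ 0#

  independent-⊆ : ∀ {n d} {v : Fin n → Fin d → Carrier} {X Y : P n} → X ⊆ Y → Independent v Y → Independent v X
  independent-⊆ X⊆Y ind c supp rel = ind c (λ i i∉Y → supp i (i∉Y ∘ X⊆Y i)) rel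

  -- `card X ≤ r X` expresses independence in `M`, since the reverse inequality always holds.
  record Rep {n} (M : Mat n) : Set where
    field
      dim   : ℕ
      v     : Fin n → Fin dim → Carrier
      sound : ∀ X → card X ≤ Mat.r M X → Independent v X
      full  : ∀ X → Independent v X → card X ≤ Mat.r M X

  ⊠-zeroˡ : ∀ {a b} → a ≈ 0# → a ⊠ b ≈ 0#
  ⊠-zeroˡ {b = b} a≈0 = ≈-trans (⊠-congʳ a≈0) (zeroˡ b)

  ⊠-zeroʳ : ∀ {a b} → b ≈ 0# → a ⊠ b ≈ 0#
  ⊠-zeroʳ {a} b≈0 = ≈-trans (⊠-congˡ b≈0) (zeroʳ a)

  set-supported : ∀ {n} {X : P n} {e} {c : Fin n → Carrier} a → (∀ i → ¬ T (X i) → e ≢ i → c i ≈ 0#) → (¬ T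
      (X e) → a ≈ 0#) → ∀ i → ¬ T (X i) → set e a c i ≈ 0#
  set-supported {e = e} a supp at-e i i∉X with e ≟ i
  ... | yes refl = at-e i∉X
  ... | no  e≢i  = supp i i∉X e≢i

  -- With a the indicator of {e} this adds a coloop e, with a the indicator of {e,f}
  -- it puts e in series with f.
  module Extend {n d : ℕ} (v : Fin n → Fin d → Carrier) (e : Fin n) (a : Fin n → Carrier) (a-e : a e ≈ 1#) where

    v⁺ : Fin n → Fin (suc d) → Carrier
    v⁺ i Fin.zero    = a i
    v⁺ i (Fin.suc k) = if ⁅ e ⁆ i then 0# else v i k

    old-coordinates : (c c′ : Fin n → Carrier) → (∀ i → e ≢ i → c i ≈ c′ i) → c′ e ≈ 0# → ∀ k →
                      ∑ F (λ i → c i ⊠ v⁺ i (Fin.suc k)) ≈ ∑ F (λ i → c′ i ⊠ v i k)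
    old-coordinates c c′ same c′e≈0 k = ∑-cong term
      where
      term : ∀ i → c i ⊠ v⁺ i (Fin.suc k) ≈ c′ i ⊠ v i k
      term i with e ≟ i
      ... | yes refl = ≈-trans (zeroʳ _) (≈-sym (⊠-zeroˡ c′e≈0))
      ... | no  e≢i  = ⊠-congʳ (same i e≢i)

    module _ {X : P n} (e∈X : T (X e)) where

      -- `e` vanishes in the old coordinates, so these kill all other coefficients; the new
      -- coordinate is then left with that of `e`.
      extend-∈ : Independent v (X ∖ ⁅ e ⁆) → Independent v⁺ X
      extend-∈ ind c supp rel = all-zero
        where
        c′ = set e 0# c
        c′-zero : ∀ i → c′ i ≈ 0#
        c′-zero = ind c′ (set-supported 0# (λ i i∉ e≢i → supp i (λ i∈X → i∉ (∧⁺ (i∈X , T-not (e≢i ∘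
            toWitness))))) (λ _ → ≈-refl))
          (λ k → ≈-trans (≈-sym (old-coordinates c c′ (λ i e≢i → ≈-reflexive (sym (set-off 0# c e≢i)))
              (≈-reflexive (set-at e 0# c)) k)) (rel (Fin.suc k)))
        off-zero : ∀ i → e ≢ i → c i ≈ 0#
        off-zero i e≢i = ≈-trans (≈-reflexive (sym (set-off 0# c e≢i))) (c′-zero i)
        all-zero : ∀ i → c i ≈ 0#
        all-zero i with e ≟ i
        ... | no e≢i   = off-zero i e≢i
        ... | yes refl = begin
          c e           ≈⟨ ≈-sym (≈-trans (⊠-comm (c e) 1#) (⊠-identityˡ (c e))) ⟩
          c e ⊠ 1#      ≈⟨ ⊠-congˡ (≈-sym a-e) ⟩
          c e ⊠ a e     ≈⟨ ≈-sym (∑-single e (λ i e≢i → ⊠-zeroˡ (off-zero i e≢i))) ⟩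
          ∑ F (λ i → c i ⊠ a i) ≈⟨ rel Fin.zero ⟩
          0# ∎

      restrict-∈ : Independent v⁺ X → Independent v (X ∖ ⁅ e ⁆)
      restrict-∈ ind c supp rel = all-zero
        where
        ce≈0 : c e ≈ 0#
        ce≈0 = supp e (λ t → not-T (proj₂ (∧⁻ {X e} t)) (∈-⁅⁆ e))
        s = ∑ F (λ i → c i ⊠ a i)
        -- `e` is a unit vector in the new coordinate, so its coefficient can be chosen to cancel
        -- that coordinate without disturbing the others.
        c′ = set e (⊟ s) c
        zero-coordinate : ∑ F (λ i → c′ i ⊠ a i) ≈ 0#
        zero-coordinate = begin
          ∑ F (λ i → c′ i ⊠ a i)                                ≈⟨ ∑-split e _ ⟩
          c′ e ⊠ a e ⊞ ∑ F (set e 0# (λ i → c′ i ⊠ a i))        ≈⟨ ⊞-cong (⊠-cong (≈-reflexive (set-at e (⊟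
              s) c)) a-e) (∑-cong rest) ⟩
          ⊟ s ⊠ 1# ⊞ s                                          ≈⟨ ⊞-congʳ (≈-trans (⊠-comm _ _) (⊠-identityˡ _)) ⟩
          ⊟ s ⊞ s                                               ≈⟨ -‿inverseˡ s ⟩
          0# ∎
          where
          rest : ∀ i → set e 0# (λ i → c′ i ⊠ a i) i ≈ c i ⊠ a i
          rest i with e ≟ i
          ... | yes refl = ≈-sym (⊠-zeroˡ ce≈0)
          ... | no  _    = ≈-refl
        c′-zero : ∀ i → c′ i ≈ 0#
        c′-zero = ind c′ (set-supported (⊟ s) (λ i i∉X _ → supp i (λ t → i∉X (proj₁ (∧⁻ t)))) (λ e∉X → ⊥-elim
            (e∉X e∈X)))
          λ { Fin.zero → zero-coordinate ; (Fin.suc k) → ≈-trans (old-coordinates c′ c (λ i e≢i → ≈-reflexive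
              (set-off (⊟ s) c e≢i)) ce≈0 k) (rel k) }
        all-zero : ∀ i → c i ≈ 0#
        all-zero i with e ≟ i
        ... | yes refl = ce≈0
        ... | no e≢i   = ≈-trans (≈-reflexive (sym (set-off (⊟ s) c e≢i))) (c′-zero i)

    module _ {X : P n} (e∉X : ¬ T (X e)) where

      private
        unchanged : ∀ {c : Fin n → Carrier} → Supported v X c → ∀ k → ∑ F (λ i → c i ⊠ v⁺ i (Fin.suc k)) ≈ ∑
            F (λ i → c i ⊠ v i k)
        unchanged {c} supp = old-coordinates c c (λ _ _ → ≈-refl) (supp e e∉X)

      extend-∉ : Independent v X → Independent v⁺ X
      extend-∉ ind c supp rel = ind c supp (λ k → ≈-trans (≈-sym (unchanged supp k)) (rel (Fin.suc k)))

      restrict-∉ : (∀ i → T (X i) → a i ≈ 0#) → Independent v⁺ X → Independent v X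
      restrict-∉ a-zero ind c supp rel = ind c supp
        λ { Fin.zero → ∑-zero vanish ; (Fin.suc k) → ≈-trans (unchanged supp k) (rel k) }
        where
        vanish : ∀ i → c i ⊠ a i ≈ 0#
        vanish i with T? (X i)
        ... | yes i∈X = ⊠-zeroʳ (a-zero i i∈X)
        ... | no  i∉X = ⊠-zeroˡ (supp i i∉X)

      -- Within `X` only `f` is nonzero in the new coordinate, so a relation has coefficient zero at
      -- `f` and lives on the rest.
      extend-f : ∀ {f} → T (X f) → a f ≈ 1# → (∀ i → f ≢ i → T (X i) → a i ≈ 0#) → Independent v (X ∖ ⁅ f ⁆)
          → Independent v⁺ X
      extend-f {f} f∈X a-f a-zero ind c supp rel = ind c supp′ (λ k → ≈-trans (≈-sym (unchanged supp k)) (rel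
          (Fin.suc k)))
        where
        vanish : ∀ i → f ≢ i → c i ⊠ a i ≈ 0#
        vanish i f≢i with T? (X i)
        ... | yes i∈X = ⊠-zeroʳ (a-zero i f≢i i∈X)
        ... | no  i∉X = ⊠-zeroˡ (supp i i∉X)
        cf≈0 : c f ≈ 0#
        cf≈0 = begin
          c f           ≈⟨ ≈-sym (≈-trans (⊠-comm (c f) 1#) (⊠-identityˡ (c f))) ⟩
          c f ⊠ 1#      ≈⟨ ⊠-congˡ (≈-sym a-f) ⟩
          c f ⊠ a f     ≈⟨ ≈-sym (∑-single f vanish) ⟩
          ∑ F (λ i → c i ⊠ a i) ≈⟨ rel Fin.zero ⟩
          0# ∎
        supp′ : Supported v (X ∖ ⁅ f ⁆) c
        supp′ i i∉ with f ≟ i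
        ... | yes refl = cf≈0
        ... | no  f≢i  = supp i (λ i∈X → i∉ (∧⁺ (i∈X , tt)))

  module Parallel {n d : ℕ} (v : Fin n → Fin d → Carrier) {e f : Fin n} (e≢f : e ≢ f) where

    v∥ : Fin n → Fin d → Carrier
    v∥ = set e (v f) v

    v∥-at : ∀ k → v∥ e k ≡ v f k
    v∥-at k = cong (λ w → w k) (set-at e (v f) v)

    v∥-off : ∀ {i} k → e ≢ i → v∥ i k ≡ v i k
    v∥-off k e≢i = cong (λ w → w k) (set-off (v f) v e≢i)

    same-sum-∉ : (c : Fin n → Carrier) → c e ≈ 0# → ∀ k → ∑ F (λ i → c i ⊠ v∥ i k) ≈ ∑ F (λ i → c i ⊠ v i k)
    same-sum-∉ c ce≈0 k = ∑-cong term
      where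
      term : ∀ i → c i ⊠ v∥ i k ≈ c i ⊠ v i k
      term i with e ≟ i
      ... | yes refl = ≈-trans (⊠-zeroˡ ce≈0) (≈-sym (⊠-zeroˡ ce≈0))
      ... | no  _    = ≈-refl

    -- `e` carries the vector of `f`, so its coefficient may be moved to `f`.
    same-sum-∈ : (c c′ : Fin n → Carrier) → c f ≈ 0# → c′ e ≈ 0# → c′ f ≈ c e → (∀ i → e ≢ i → f ≢ i → c i ≈ c′ i) →
                 ∀ k → ∑ F (λ i → c i ⊠ v∥ i k) ≈ ∑ F (λ i → c′ i ⊠ v i k)
    same-sum-∈ c c′ cf≈0 c′e≈0 c′f≈ce same k = begin
      ∑ F (λ i → c i ⊠ v∥ i k)                                  ≈⟨ ∑-split e _ ⟩
      c e ⊠ v∥ e k ⊞ ∑ F (set e 0# (λ i → c i ⊠ v∥ i k))        ≈⟨ ⊞-cong (⊠-cong (≈-sym c′f≈ce) (≈-reflexive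
          (v∥-at k))) (∑-cong term) ⟩
      c′ f ⊠ v f k ⊞ ∑ F (set f 0# (λ i → c′ i ⊠ v i k))        ≈⟨ ≈-sym (∑-split f _) ⟩
      ∑ F (λ i → c′ i ⊠ v i k) ∎
      where
      term : ∀ i → set e 0# (λ i → c i ⊠ v∥ i k) i ≈ set f 0# (λ i → c′ i ⊠ v i k) i
      term i with e ≟ i | f ≟ i
      ... | yes e≡i  | yes f≡i  = ⊥-elim (e≢f (trans e≡i (sym f≡i)))
      ... | yes refl | no  _    = ≈-sym (⊠-zeroˡ c′e≈0)
      ... | no  _    | yes refl = ⊠-zeroˡ cf≈0
      ... | no  e≢i  | no  f≢i  = ⊠-congʳ (same i e≢i f≢i)

    module _ {X : P n} where

      parallel-∉ : ¬ T (X e) → Independent v X → Independent v∥ X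
      parallel-∉ e∉X ind c supp rel = ind c supp (λ k → ≈-trans (≈-sym (same-sum-∉ c (supp e e∉X) k)) (rel k))

      parallel-∉⁻ : ¬ T (X e) → Independent v∥ X → Independent v X
      parallel-∉⁻ e∉X ind c supp rel = ind c supp (λ k → ≈-trans (same-sum-∉ c (supp e e∉X) k) (rel k))

      private
        X′ = X ∖ ⁅ e ⁆ ∪ ⁅ f ⁆
        f∈X′ : T (X′ f)
        f∈X′ = ∨⁺ {(X ∖ ⁅ e ⁆) f} (inj₂ (∈-⁅⁆ f))
        ∈X′ : ∀ {i} → T (X i) → e ≢ i → T (X′ i)
        ∈X′ i∈X e≢i = ∨⁺ (inj₁ (∧⁺ (i∈X , T-not (e≢i ∘ toWitness))))
        e∉X′ : ¬ T (X′ e)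
        e∉X′ t with ∨⁻ {(X ∖ ⁅ e ⁆) e} t
        ... | inj₁ p = not-T (proj₂ (∧⁻ {X e} p)) (∈-⁅⁆ e)
        ... | inj₂ p = e≢f (sym (toWitness p))
        X′⊆ : ∀ {i} → f ≢ i → T (X′ i) → T (X i)
        X′⊆ {i} f≢i t with ∨⁻ {(X ∖ ⁅ e ⁆) i} t
        ... | inj₁ p = proj₁ (∧⁻ p)
        ... | inj₂ p = ⊥-elim (f≢i (toWitness p))

      parallel-∈ : ¬ T (X f) → Independent v X′ → Independent v∥ X
      parallel-∈ f∉X ind c supp rel = all-zero
        where
        c₁ = set f (c e) c
        c′ = set e 0# c₁
        c′f : c′ f ≡ c e
        c′f = trans (set-off 0# c₁ e≢f) (set-at f (c e) c)
        c′-off : ∀ {i} → e ≢ i → f ≢ i → c′ i ≡ c i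
        c′-off e≢i f≢i = trans (set-off 0# c₁ e≢i) (set-off (c e) c f≢i)
        supp′ : Supported v X′ c′
        supp′ i i∉ = by-cases (e ≟ i) (f ≟ i)
          where
          by-cases : Dec (e ≡ i) → Dec (f ≡ i) → c′ i ≈ 0#
          by-cases (yes refl) _          = ≈-reflexive (set-at e 0# c₁)
          by-cases (no _)     (yes refl) = ⊥-elim (i∉ f∈X′)
          by-cases (no e≢i)   (no f≢i)   = ≈-trans (≈-reflexive (c′-off e≢i f≢i)) (supp i (λ i∈X → i∉ (∈X′ i∈X e≢i)))
        c′-zero : ∀ i → c′ i ≈ 0#
        c′-zero = ind c′ supp′ (λ k → ≈-trans (≈-sym (same-sum-∈ c c′ (supp f f∉X) (≈-reflexive (set-at e 0#
            c₁)) (≈-reflexive c′f)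
          (λ i e≢i f≢i → ≈-reflexive (sym (c′-off e≢i f≢i))) k)) (rel k))
        all-zero : ∀ i → c i ≈ 0#
        all-zero i = by-cases (e ≟ i) (f ≟ i)
          where
          by-cases : Dec (e ≡ i) → Dec (f ≡ i) → c i ≈ 0#
          by-cases (yes refl) _          = ≈-trans (≈-reflexive (sym c′f)) (c′-zero f)
          by-cases (no _)     (yes refl) = supp f f∉X
          by-cases (no e≢i)   (no f≢i)   = ≈-trans (≈-reflexive (sym (c′-off e≢i f≢i))) (c′-zero i)

      parallel-∈⁻ : T (X e) → ¬ T (X f) → Independent v∥ X → Independent v X′
      parallel-∈⁻ e∈X f∉X ind c′ supp′ rel = all-zero
        where
        c₁ = set e (c′ f) c′
        c = set f 0# c₁
        ce : c e ≡ c′ f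
        ce = trans (set-off 0# c₁ (e≢f ∘ sym)) (set-at e (c′ f) c′)
        c-off : ∀ {i} → e ≢ i → f ≢ i → c i ≡ c′ i
        c-off e≢i f≢i = trans (set-off 0# c₁ f≢i) (set-off (c′ f) c′ e≢i)
        supp : Supported v X c
        supp i i∉ = by-cases (e ≟ i) (f ≟ i)
          where
          by-cases : Dec (e ≡ i) → Dec (f ≡ i) → c i ≈ 0#
          by-cases (yes refl) _          = ⊥-elim (i∉ e∈X)
          by-cases (no _)     (yes refl) = ≈-reflexive (set-at f 0# c₁)
          by-cases (no e≢i)   (no f≢i)   = ≈-trans (≈-reflexive (c-off e≢i f≢i)) (supp′ i (i∉ ∘ X′⊆ f≢i))
        c-zero : ∀ i → c i ≈ 0#
        c-zero = ind c supp (λ k → ≈-trans (same-sum-∈ c c′ (≈-reflexive (set-at f 0# c₁)) (supp′ e e∉X′)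
            (≈-reflexive (sym ce))
          (λ i e≢i f≢i → ≈-reflexive (c-off e≢i f≢i)) k) (rel k))
        all-zero : ∀ i → c′ i ≈ 0#
        all-zero i = by-cases (e ≟ i) (f ≟ i)
          where
          by-cases : Dec (e ≡ i) → Dec (f ≡ i) → c′ i ≈ 0#
          by-cases (yes refl) _          = supp′ e e∉X′
          by-cases (no _)     (yes refl) = ≈-trans (≈-reflexive (sym ce)) (c-zero e)
          by-cases (no e≢i)   (no f≢i)   = ≈-trans (≈-reflexive (sym (c-off e≢i f≢i))) (c-zero i)

      -- The relation has coefficients 1 at `e` and -1 at `f`.
      parallel-dependent : T (X e) → T (X f) → ¬ Independent v∥ X
      parallel-dependent e∈X f∈X ind = 0≉1 (≈-sym (≈-trans (≈-reflexive (sym (set-at e 1# c₁))) (ind c supp rel e)))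
        where
        c₀ c₁ c : Fin n → Carrier
        c₀ _ = 0#
        c₁ = set f (⊟ 1#) c₀
        c = set e 1# c₁
        supp : Supported v X c
        supp i i∉ = by-cases (e ≟ i) (f ≟ i)
          where
          by-cases : Dec (e ≡ i) → Dec (f ≡ i) → c i ≈ 0#
          by-cases (yes refl) _          = ⊥-elim (i∉ e∈X)
          by-cases (no _)     (yes refl) = ⊥-elim (i∉ f∈X)
          by-cases (no e≢i)   (no f≢i)   = ≈-reflexive (trans (set-off 1# c₁ e≢i) (set-off (⊟ 1#) c₀ f≢i))
        rel : ∀ k → ∑ F (λ i → c i ⊠ v∥ i k) ≈ 0#
        rel k = begin
          ∑ F (λ i → c i ⊠ v∥ i k)          ≈⟨ ∑-two e≢f (λ i e≢i f≢i → ⊠-zeroˡ (≈-reflexive (trans (set-off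
              1# c₁ e≢i) (set-off (⊟ 1#) c₀ f≢i)))) ⟩
          c e ⊠ v∥ e k ⊞ c f ⊠ v∥ f k       ≈⟨ ⊞-cong (⊠-cong (≈-reflexive (set-at e 1# c₁)) (≈-reflexive (v∥-at k)))
                                                 (⊠-cong (≈-reflexive (trans (set-off 1# c₁ e≢f) (set-at f (⊟
                                                     1#) c₀))) (≈-reflexive (v∥-off k e≢f))) ⟩
          1# ⊠ v f k ⊞ ⊟ 1# ⊠ v f k         ≈⟨ ≈-sym (distribʳ (v f k) 1# (⊟ 1#)) ⟩
          (1# ⊞ ⊟ 1#) ⊠ v f k               ≈⟨ ⊠-zeroˡ (-‿inverseʳ 1#) ⟩
          0# ∎

-- Representations of loops and of coloop, series and parallel extensions

card-remove : ∀ {n} (X : P n) e → T (X e) → card X ≡ suc (card (X ∖ ⁅ e ⁆))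
card-remove X e e∈X = trans (sym (card-∖ ⁅ e ⁆ X (⁅⁆-⊆ X e∈X))) (cong (_+ card (X ∖ ⁅ e ⁆)) (card-⁅⁆ e))

nonloops : ∀ {n} → Mat n → P n
nonloops M x = ⌊ 1 ≤? Mat.r M ⁅ x ⁆ ⌋

nonloops-< : ∀ {n} (M N : Mat n) {y} → (∀ x → Mat.r N ⁅ x ⁆ ≤ Mat.r M ⁅ x ⁆) → 1 ≤ Mat.r M ⁅ y ⁆ → Mat.r N ⁅ y ⁆ ≤ 0 →
             card (nonloops N) < card (nonloops M)
nonloops-< M N {y} below nonloop loop = card-< {X = nonloops N} {nonloops M} {y}
  (λ x t → fromWitness {a? = 1 ≤? Mat.r M ⁅ x ⁆} (≤-trans (toWitness {a? = 1 ≤? Mat.r N ⁅ x ⁆} t) (below x)))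
  (fromWitness {a? = 1 ≤? Mat.r M ⁅ y ⁆} nonloop) (λ t → <⇒≱ (toWitness {a? = 1 ≤? Mat.r N ⁅ y ⁆} t) loop)

module _ (F : Field) {n : ℕ} (M : Mat n) where
  open Mat M
  open Field F using (Carrier; _≈_; 0#; 1#; 0≉1) renaming (refl to ≈-refl; sym to ≈-sym; trans to ≈-trans;
      reflexive to ≈-reflexive)

  private
    e-set : (e : Fin n) → Fin n → Carrier
    e-set e = set F e 1# (λ _ → 0#)

  -- In dimension 0 every family of coefficients is a relation, so only the empty set is
  -- independent.
  rep-loops : (∀ x → r ⁅ x ⁆ ≤ 0) → Rep F M
  rep-loops loops = record { dim = 0 ; v = λ _ () ; sound = sound ; full = full }
    where
    r≤0 : ∀ X → r X ≤ 0
    r≤0 X = ≤-trans (≤-by M (X ∷ []) [] [] (rk s0 ≼ rk (∅ᵉ || s0)) [] refl tt tt) (≤-trans (closed-under M ∅ X λ {s} _ → let h = loops s in (≤-by M (⁅ s ⁆ ∷ [])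
      [] ((rk s0 ≼ lit 0) ∷ []) (rk (∅ᵉ || s0) ≼ rk ∅ᵉ) [] refl tt (h , tt))) (≤-reflexive r∅))
    sound : ∀ X → card X ≤ r X → Independent F {n} {0} (λ _ ()) X
    sound X h c supp rel i = supp i λ i∈X → <⇒≱ (≤-trans (s≤s z≤n) (≤-reflexive (sym (card-remove X i i∈X))))
        (≤-trans h (r≤0 X))
    full : ∀ X → Independent F {n} {0} (λ _ ()) X → card X ≤ r X
    full X ind = ≤-trans (card-mono {X = X} {∅} empty) (≤-trans (≤-reflexive (card-∅ {n})) z≤n)
      where
      empty : X ⊆ ∅
      empty i i∈X = 0≉1 (≈-sym (≈-trans (≈-reflexive (sym (set-at F i 1# (λ _ → 0#)))) (ind (e-set i) supp (λ ()) i)))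
        where
        supp : ∀ j → ¬ T (X j) → e-set i j ≈ 0#
        supp j j∉X = ≈-reflexive (set-off F 1# (λ _ → 0#) (λ { refl → j∉X i∈X }))

  rep-coloop : ∀ e → r (∁ ⁅ e ⁆) < r 𝟙 → Rep F (restrict M (∁ ⁅ e ⁆)) → Rep F M
  rep-coloop e coloop R = record { v = v⁺ ; sound = sound⁺ ; full = full⁺ }
    where
    open Rep R
    open Extend F v e (e-set e) (≈-reflexive (set-at F e 1# (λ _ → 0#)))
    sound⁺ : ∀ X → card X ≤ r X → Independent F v⁺ X
    sound⁺ X h with T? (X e)
    ... | yes e∈X = extend-∈ e∈X (sound (X ∖ ⁅ e ⁆) (≤-pred (≤-trans (≤-reflexive (sym (card-remove X e e∈X)))
            (≤-trans h (≤-by M (X ∷ ⁅ e ⁆ ∷ []) [] ((rk s1 ≼ lit 1) ∷ [])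
              (rk s0 ≼ lit 1 ⊕ rk (s0 && ~ s1 && ~ s1)) (sub s1 (s0 && ~ s1 && ~ s1) ∷ mon s0 (s1 || s0) ∷
              []) refl tt (Mat.r1 M e , tt))))))
    ... | no e∉X  = extend-∉ e∉X (sound X (≤-trans h (≤-by M (X ∷ ⁅ e ⁆ ∷ []) ((s1 , ~ s0) ∷ []) []
      (rk s0 ≼ rk (s0 && ~ s1)) [] refl (⁅⁆-⊆∁ X e∉X , tt) tt)))
    full⁺ : ∀ X → Independent F v⁺ X → card X ≤ r X
    full⁺ X ind with T? (X e)
    ... | yes e∈X = ≤-trans (≤-reflexive (card-remove X e e∈X)) (≤-trans (s≤s (full (X ∖ ⁅ e ⁆) (restrict-∈ e∈X ind)))
            (≤-by M (X ∷ ⁅ e ⁆ ∷ []) ((s1 , s0) ∷ []) ((lit 1 ⊕ rk (~ s1) ≼ rk 𝟙ᵉ) ∷ [])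
              (lit 1 ⊕ rk (s0 && ~ s1 && ~ s1) ≼ rk s0) (sub (~ s1) s0 ∷ []) refl (⁅⁆-⊆ X e∈X , tt)
              (coloop , tt)))
    ... | no e∉X  = ≤-trans (full X (restrict-∉ e∉X (λ i i∈X → ≈-reflexive (set-off F 1# (λ _ → 0#) (λ { refl
        → e∉X i∈X }))) ind))
            (≤-by M (X ∷ ⁅ e ⁆ ∷ []) [] [] (rk (s0 && ~ s1) ≼ rk s0) (mon (s0 && ~ s1) s0 ∷ []) refl tt tt)

  -- Independence is reduced to M / e in three cases. If `X` contains `e`, drop it. If it contains
  -- only `f`, drop `f`, because replacing `f` by its series partner `e` keeps the rank. If it
  -- contains neither, it does not span `e`, and contracting `e` leaves its rank unchanged.
  rep-series : ∀ {e f} → Active M e → Active M f → e ≢ f → r (∁ (⁅ e ⁆ ∪ ⁅ f ⁆)) < r 𝟙 → Rep F (contract M ⁅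
      e ⁆) → Rep F M
  rep-series {e} {f} (e-rank , e-spanned) (f-rank , f-spanned) e≢f series R = record { v = v⁺ ; sound =
      sound⁺ ; full = full⁺ }
    where
    open Rep R
    a₀ a₁ a : Fin n → Carrier
    a₀ _ = 0#
    a₁ = set F f 1# a₀
    a = set F e 1# a₁
    open Extend F v e a (≈-reflexive (set-at F e 1# a₁))
    f≠e = ≢-⊆∁ (e≢f ∘ sym)
    a-off : ∀ {i} → e ≢ i → f ≢ i → a i ≈ 0#
    a-off e≢i f≢i = ≈-reflexive (trans (set-off F 1# a₁ e≢i) (set-off F 1# a₀ f≢i))
    a-f : a f ≈ 1#
    a-f = ≈-reflexive (trans (set-off F 1# a₁ e≢f) (set-at F f 1# a₀))
    intro : ∀ Y → card Y + r ⁅ e ⁆ ≤ r (Y ∪ ⁅ e ⁆) → Independent F v Y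
    intro Y h = sound Y (m+n≤o⇒m≤o∸n (card Y) h)
    elim : ∀ Y → Independent F v Y → card Y + r ⁅ e ⁆ ≤ r (Y ∪ ⁅ e ⁆)
    elim Y ind = ≤-trans (+-monoˡ-≤ (r ⁅ e ⁆) (full Y ind)) (≤-reflexive (m∸n+n≡m (≤-by M (Y ∷ ⁅ e ⁆ ∷ [])
      [] [] (rk s1 ≼ rk (s0 || s1)) (mon s1 (s0 || s1) ∷ []) refl tt tt)))
    intro-∖ : ∀ {X} x → T (X x) → card X ≤ r X → r X ≤ r (X ∖ ⁅ x ⁆ ∪ ⁅ e ⁆) → Independent F v (X ∖ ⁅ x ⁆)
    intro-∖ {X} x x∈X h le = intro (X ∖ ⁅ x ⁆) (≤-trans (+-monoʳ-≤ (card (X ∖ ⁅ x ⁆)) (r1 e))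
      (≤-trans (≤-reflexive (trans (+-comm (card (X ∖ ⁅ x ⁆)) 1) (sym (card-remove X x x∈X)))) (≤-trans h le)))
    elim-∖ : ∀ {X} x → T (X x) → Independent F v (X ∖ ⁅ x ⁆) → r (X ∖ ⁅ x ⁆ ∪ ⁅ e ⁆) ≤ r X → card X ≤ r X
    elim-∖ {X} x x∈X ind le = ≤-trans (≤-reflexive (trans (card-remove X x x∈X) (+-comm 1 _)))
      (≤-trans (+-monoʳ-≤ (card (X ∖ ⁅ x ⁆)) e-rank) (≤-trans (elim (X ∖ ⁅ x ⁆) ind) le))
    sound⁺ : ∀ X → card X ≤ r X → Independent F v⁺ X
    sound⁺ X h with T? (X e) | T? (X f)
    ... | yes e∈X | _       = extend-∈ e∈X (intro-∖ e e∈X h (≤-by M (X ∷ ⁅ e ⁆ ∷ []) [] []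
      (rk s0 ≼ rk (s0 && ~ s1 || s1)) (mon s0 (s0 && ~ s1 || s1) ∷ []) refl tt tt))
    ... | no e∉X  | yes f∈X = extend-f e∉X f∈X a-f (λ i f≢i i∈X → a-off (λ { refl → e∉X i∈X }) f≢i)
            (intro-∖ f f∈X h (≤-by M (X ∷ ⁅ e ⁆ ∷ ⁅ f ⁆ ∷ []) ((s1 , ~ s0) ∷ (s2 , ~ s1) ∷ [])
              ((lit 1 ⊕ rk (~ (s1 || s2)) ≼ rk 𝟙ᵉ) ∷ (rk 𝟙ᵉ ≼ rk (~ s2)) ∷ (rk s2 ≼ lit 1) ∷ [])
              (rk s0 ≼ rk (s0 && ~ s2 || s1)) (sub (~ (s1 || s2)) (s0 && ~ s2 || s1) ∷
              sub s2 (~ (s1 || s2) && s0) ∷ mon s0 (s2 || s0) ∷ []) refl (⁅⁆-⊆∁ X e∉X , f≠e , tt)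
              (series , f-spanned , Mat.r1 M f , tt)))
    ... | no e∉X  | no f∉X  = extend-∉ e∉X (intro X (≤-trans (+-mono-≤ h (r1 e))
            (≤-by M (X ∷ ⁅ e ⁆ ∷ ⁅ f ⁆ ∷ []) ((s1 , ~ s0) ∷ (s2 , ~ s0) ∷ (s2 , ~ s1) ∷ [])
              ((lit 1 ⊕ rk (~ (s1 || s2)) ≼ rk 𝟙ᵉ) ∷ (rk 𝟙ᵉ ≼ rk (~ s2)) ∷ [])
              (rk s0 ⊕ lit 1 ≼ rk (s0 || s1)) (sub (~ (s1 || s2)) (s0 || s1) ∷ []) refl
              (⁅⁆-⊆∁ X e∉X , ⁅⁆-⊆∁ X f∉X , f≠e , tt) (series , f-spanned , tt))))
    full⁺ : ∀ X → Independent F v⁺ X → card X ≤ r X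
    full⁺ X ind with T? (X e) | T? (X f)
    ... | yes e∈X | _       = elim-∖ e e∈X (restrict-∈ e∈X ind) (≤-by M (X ∷ ⁅ e ⁆ ∷ []) ((s1 , s0) ∷ []) []
      (rk (s0 && ~ s1 || s1) ≼ rk s0) [] refl (⁅⁆-⊆ X e∈X , tt) tt)
    ... | no e∉X  | yes f∈X = elim-∖ f f∈X
            (restrict-∉ (λ e∈ → e∉X (proj₁ (∧⁻ e∈)))
              (λ i i∈ → a-off (λ { refl → e∉X (proj₁ (∧⁻ i∈)) }) (λ { refl → not-T (proj₂ (∧⁻ {X i} i∈)) (∈-⁅⁆ i) }))
              (independent-⊆ F {v = v⁺} (⊆-by (X ∷ ⁅ f ⁆ ∷ []) [] (s0 && ~ s1) s0 refl tt) ind))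
            (≤-by M (X ∷ ⁅ e ⁆ ∷ ⁅ f ⁆ ∷ []) ((s1 , ~ s0) ∷ (s2 , s0) ∷ [])
              ((lit 1 ⊕ rk (~ (s1 || s2)) ≼ rk 𝟙ᵉ) ∷ (rk 𝟙ᵉ ≼ rk (~ s1)) ∷ (rk s1 ≼ lit 1) ∷ [])
              (rk (s0 && ~ s2 || s1) ≼ rk s0) (sub (~ (s1 || s2)) s0 ∷
              sub s1 (~ (s1 || s2) && (s0 && ~ s2 || s1)) ∷ []) refl (⁅⁆-⊆∁ X e∉X , ⁅⁆-⊆ X f∈X , tt)
              (series , e-spanned , Mat.r1 M e , tt))
    ... | no e∉X  | no f∉X  = +-cancelʳ-≤ (r ⁅ e ⁆) _ _ (≤-trans
            (elim X (restrict-∉ e∉X (λ i i∈X → a-off (λ { refl → e∉X i∈X }) (λ { refl → f∉X i∈X })) ind))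
            (≤-by M (X ∷ ⁅ e ⁆ ∷ []) [] [] (rk (s0 || s1) ≼ rk s0 ⊕ rk s1) (sub s1 s0 ∷ []) refl tt tt))

  rep-parallel : ∀ {e f} → Active M e → Active M f → e ≢ f → r (⁅ e ⁆ ∪ ⁅ f ⁆) ≤ 1 → Rep F (restrict M (∁ ⁅ e
      ⁆)) → Rep F M
  rep-parallel {e} {f} (e-rank , _) (f-rank , _) e≢f e∥f R = record { v = v∥ ; sound = sound∥ ; full = full∥ }
    where
    open Rep R
    open Parallel F v e≢f
    f≠e = ≢-⊆∁ (e≢f ∘ sym)
    X∖e∌f : ∀ {X} → ¬ T (X f) → ¬ T ((X ∖ ⁅ e ⁆) f)
    X∖e∌f f∉X t = f∉X (proj₁ (∧⁻ t))
    card-swap : ∀ {X} → T (X e) → ¬ T (X f) → card (X ∖ ⁅ e ⁆ ∪ ⁅ f ⁆) ≡ card X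
    card-swap {X} e∈X f∉X = trans (card-insert (X ∖ ⁅ e ⁆) f (X∖e∌f {X} f∉X)) (sym (card-remove X e e∈X))
    sound∥ : ∀ X → card X ≤ r X → Independent F v∥ X
    sound∥ X h with T? (X e) | T? (X f)
    ... | no e∉X  | _       = parallel-∉ e∉X (sound X (≤-trans h (≤-by M (X ∷ ⁅ e ⁆ ∷ []) ((s1 , ~ s0) ∷ [])
      [] (rk s0 ≼ rk (s0 && ~ s1)) [] refl (⁅⁆-⊆∁ X e∉X , tt) tt)))
    ... | yes e∈X | no f∉X  = parallel-∈ f∉X (sound (X ∖ ⁅ e ⁆ ∪ ⁅ f ⁆) (≤-trans (≤-reflexive (card-swap e∈X
        f∉X)) (≤-trans h
            (≤-by M (X ∷ ⁅ e ⁆ ∷ ⁅ f ⁆ ∷ []) ((s2 , ~ s1) ∷ []) ((rk (s1 || s2) ≼ lit 1) ∷ (lit 1 ≼ rk s2) ∷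
              []) (rk s0 ≼ rk ((s0 && ~ s1 || s2) && ~ s1)) (sub (s1 || s2) ((s0 && ~ s1 || s2) && ~ s1) ∷
              mon s0 (s1 || s2 || s0) ∷ []) refl (f≠e , tt) (e∥f , f-rank , tt)))))
    ... | yes e∈X | yes f∈X = ⊥-elim (<⇒≱ (≤-reflexive (sym (card-remove X e e∈X))) (≤-trans h (≤-trans
            (≤-by M (X ∷ ⁅ e ⁆ ∷ ⁅ f ⁆ ∷ []) ((s2 , s0) ∷ (s2 , ~ s1) ∷ []) ((rk (s1 || s2) ≼ lit 1) ∷
              (lit 1 ≼ rk s2) ∷ []) (rk s0 ≼ rk (s0 && ~ s1)) (sub (s1 || s2) (s0 && ~ s1) ∷
              mon s0 (s1 || s2 || s0) ∷ []) refl (⁅⁆-⊆ X f∈X , f≠e , tt) (e∥f , f-rank , tt)) (r≤card (X ∖ ⁅ e ⁆)))))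
    full∥ : ∀ X → Independent F v∥ X → card X ≤ r X
    full∥ X ind with T? (X e) | T? (X f)
    ... | no e∉X  | _       = ≤-trans (full X (parallel-∉⁻ e∉X ind)) (≤-by M (X ∷ ⁅ e ⁆ ∷ []) [] []
      (rk (s0 && ~ s1) ≼ rk s0) (mon (s0 && ~ s1) s0 ∷ []) refl tt tt)
    ... | yes e∈X | no f∉X  = ≤-trans (≤-reflexive (sym (card-swap e∈X f∉X))) (≤-trans (full (X ∖ ⁅ e ⁆ ∪ ⁅ f
        ⁆) (parallel-∈⁻ e∈X f∉X ind))
            (≤-by M (X ∷ ⁅ e ⁆ ∷ ⁅ f ⁆ ∷ []) ((s1 , s0) ∷ []) ((rk (s1 || s2) ≼ lit 1) ∷ (lit 1 ≼ rk s1) ∷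
              []) (rk ((s0 && ~ s1 || s2) && ~ s1) ≼ rk s0) (sub (s1 || s2) s0 ∷ mon s1 ((s1 || s2) && s0) ∷
              mon ((s0 && ~ s1 || s2) && ~ s1) (s1 || s2 || (s0 && ~ s1 || s2) && ~ s1) ∷ []) refl
              (⁅⁆-⊆ X e∈X , tt) (e∥f , e-rank , tt)))
    ... | yes e∈X | yes f∈X = ⊥-elim (parallel-dependent e∈X f∈X ind)

-- Non-loops are counted because removing a coloop does not reduce the number of active elements.
-- When neither coloops nor parallel or series pairs are left, the ordering of M / y given by
-- `free-path` leads to a contradiction.
free-rep : ∀ (F : Field) {n} (M : Mat n) → Acc _<_ (card (nonloops M)) → Free M → Rep F M
free-rep F M (acc rec) free with any? (λ x → 1 ≤? Mat.r M ⁅ x ⁆)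
... | no none = rep-loops F M (λ x → ≤-pred (≰⇒> (λ h → none (x , h))))
... | yes (y , y-rank) with any? (λ e → (1 ≤? Mat.r M ⁅ e ⁆) ×-dec (Mat.r M (∁ ⁅ e ⁆) <? Mat.r M 𝟙))
...   | yes (e , e-rank , coloop) = rep-coloop F M e coloop
          (free-rep F N (rec (nonloops-< M N (λ x → (≤-by M (⁅ x ⁆ ∷ ⁅ e ⁆ ∷ []) [] []
            (rk (s0 && ~ s1) ≼ rk s0) (mon (s0 && ~ s1) s0 ∷ []) refl tt tt)) e-rank (≤-by M (⁅ e ⁆ ∷ []) []
              [] (rk (s0 && ~ s0) ≼ lit 0) [] refl tt tt))) (free-restrict M free (∁ ⁅ e ⁆)))
  where N = restrict M (∁ ⁅ e ⁆)
...   | no no-coloop with parallelPair? M | seriesPair? M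
...     | yes (e , f , a-e , a-f , e≢f , e∥f) | _ = rep-parallel F M a-e a-f e≢f e∥f
            (free-rep F N (rec (nonloops-< M N (λ x → (≤-by M (⁅ x ⁆ ∷ ⁅ e ⁆ ∷ []) [] []
              (rk (s0 && ~ s1) ≼ rk s0) (mon (s0 && ~ s1) s0 ∷ []) refl tt tt)) (proj₁ a-e) (≤-by M (⁅ e ⁆ ∷ [])
                [] [] (rk (s0 && ~ s0) ≼ lit 0) [] refl tt tt))) (free-restrict M free (∁ ⁅ e ⁆)))
  where N = restrict M (∁ ⁅ e ⁆)
...     | no _ | yes (e , f , a-e , a-f , e≢f , series) = rep-series F M a-e a-f e≢f series
            (free-rep F N (rec (nonloops-< M N
              (λ x → m≤n+o⇒m∸n≤o _ (Mat.r M ⁅ e ⁆) (≤-by M (⁅ x ⁆ ∷ ⁅ e ⁆ ∷ []) [] []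
                (rk (s0 || s1) ≼ rk s1 ⊕ rk s0) (sub s0 s1 ∷ []) refl tt tt)) (proj₁ a-e)
              (m≤n+o⇒m∸n≤o _ (Mat.r M ⁅ e ⁆) (≤-by M (⁅ e ⁆ ∷ []) [] [] (rk (s0 || s0) ≼ rk s0 ⊕ lit 0) []
                refl tt tt)))) (free-contract M free ⁅ e ⁆))
  where N = contract M ⁅ e ⁆
...     | no ¬p | no ¬s = ⊥-elim (no-dense M free (simple-from M ¬p) (cosimple-from M ¬s) y-active
            (dense M (simple-from M ¬p) (cosimple-from M ¬s) y-active
              (free-path N (<-wellFounded _) (free-contract M free ⁅ y ⁆))))
  where
  N = contract M ⁅ y ⁆
  y-active : Active M y
  y-active = y-rank , ≮⇒≥ (λ coloop → no-coloop (y , y-rank , coloop))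

-- Orderings as permutations

module _ {n : ℕ} (M : Matroid n) where
  open Matroid M

  private
    tabulate-⊆ : ∀ {X Y : P n} → X ⊆ Y → tabulate X Sub.⊆ tabulate Y
    tabulate-⊆ {X} {Y} p {i} i∈ = VecP.lookup⇒[]= i (tabulate Y) (trans (VecP.lookup∘tabulate Y i)
      (T⇒≡ (p i (≡⇒T (trans (sym (VecP.lookup∘tabulate X i)) (VecP.[]=⇒lookup i∈))))))

    tabulate-zip : ∀ {X Y : P n} (f : Bool → Bool → Bool) → tabulate (λ i → f (X i) (Y i)) ≡ Data.Vec.zipWith
        f (tabulate X) (tabulate Y)
    tabulate-zip {X} {Y} f = trans (VecP.tabulate-cong λ i → sym (trans (VecP.lookup-zipWith f i (tabulate X)
        (tabulate Y))
      (cong₂ f (VecP.lookup∘tabulate X i) (VecP.lookup∘tabulate Y i)))) (VecP.tabulate∘lookup _)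

  fromMatroid : Mat n
  fromMatroid = record
    { r      = λ X → rank (tabulate X)
    ; r≤card = λ X → ≤-trans (rank-≤ (tabulate X)) (≤-reflexive (trans (card-lookup (tabulate X)) (card-≐
        (≗⇒≐ (VecP.lookup∘tabulate X)))))
    ; mono   = λ p → rank-mono (tabulate-⊆ p)
    ; submod = λ X Y → ≤-trans (≤-reflexive (cong₂ _+_ (cong rank (tabulate-zip _∨_)) (cong rank
        (tabulate-zip _∧_)))) (rank-sub (tabulate X) (tabulate Y))
    }

  fromMatroid-rank : ∀ X → rankFn fromMatroid X ≡ rank X
  fromMatroid-rank X = cong rank (VecP.tabulate∘lookup X)

  rank-tabulate : ∀ X → rank X ≡ Mat.r fromMatroid (lookup X)
  rank-tabulate X = sym (fromMatroid-rank X)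

HasMinor-rank : ∀ {n} (R R′ : RankFn n) T₀ → (∀ X → R X ≡ R′ X) → HasMinor R T₀ → HasMinor R′ T₀
HasMinor-rank R R′ T₀ same (C , φ , inj , φ∉C , eq) = C , φ , inj , φ∉C , λ X → trans (eq X) (cong₂ _∸_ (same
    _) (same C))

module _ (F : Field) {n : ℕ} (M : Matroid n) where
  open Matroid M
  private N = fromMatroid M

  rep⇒representable : Rep F N → Representable F rank
  rep⇒representable R = dim , v , λ X → to X , from X
    where
    open Rep R
    ∈⇒T : ∀ {X : Subset n} {i} → i Sub.∈ X → T (lookup X i)
    ∈⇒T i∈X = ≡⇒T (VecP.[]=⇒lookup i∈X)
    T⇒∈ : ∀ {X : Subset n} {i} → T (lookup X i) → i Sub.∈ X
    T⇒∈ {X} {i} t = VecP.lookup⇒[]= i X (T⇒≡ t)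
    to : ∀ X → Indep rank X → LinIndep F v X
    to X indep c supp rel i _ = sound (lookup X)
      (≤-reflexive (trans (sym (card-lookup X)) (trans (sym indep) (rank-tabulate M X)))) c (λ j j∉X → supp j
          (j∉X ∘ ∈⇒T)) rel i
    from : ∀ X → LinIndep F v X → Indep rank X
    from X ind = ≤-antisym (rank-≤ X) (≤-trans (≤-reflexive (card-lookup X))
      (≤-trans (full (lookup X) independent) (≤-reflexive (fromMatroid-rank M X))))
      where
      independent : Independent F v (lookup X)
      independent c supp rel i with T? (lookup X i)
      ... | yes i∈X = ind c (λ j j∉X → supp j (j∉X ∘ T⇒∈)) rel i (T⇒∈ i∈X)
      ... | no  i∉X = supp i i∉X

setOf : ∀ {n} → List (Fin n) → P n
setOf []      = ∅
setOf (z ∷ l) = ⁅ z ⁆ ∪ setOf l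

-- `good` concerns the prefixes of length `suc i`, exactly those that `width` inspects.
record Order {n} (L : P n → Set) (X : P n) : Set where
  field
    list     : List (Fin n)
    unique   : Unique list
    fresh    : All (λ z → ¬ T (X z)) list
    complete : ∀ j → ¬ T (X j) → j ∈ list
    good     : ∀ i → i < length list → L (X ∪ setOf (take (suc i) list))

path⇒order : ∀ {n} {L : P n → Set} → Resp L → ∀ {X} → Path L X 𝟙 → Order L X
path⇒order resp (done (_ , 𝟙⊆X)) = record
  { list = [] ; unique = [] ; fresh = [] ; complete = λ j j∉X → ⊥-elim (j∉X (𝟙⊆X j tt)) ; good = λ _ () }
path⇒order {L = L} resp {X} (add z l p) with T? (X z) | path⇒order resp p
... | yes z∈X | o = record
  { list = list ; unique = unique
  ; fresh = All.map (λ j∉ j∈X → j∉ (∨⁺ (inj₁ j∈X))) fresh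
  ; complete = λ j j∉X → complete j (λ t → j∉X (X∪z⊆X j t))
  ; good = λ i i< → let U = setOf (take (suc i) list) in
      resp (≐-by (X ∷ U ∷ ⁅ z ⁆ ∷ []) ((s0 || s2 , s0) ∷ []) (s0 || s2 || s1) (s0 || s1) refl (X∪z⊆X , tt))
          (good i i<) }
  where
  open Order o
  X∪z⊆X : X ∪ ⁅ z ⁆ ⊆ X
  X∪z⊆X = ⊆-by (X ∷ ⁅ z ⁆ ∷ []) ((s1 , s0) ∷ []) (s0 || s1) s0 refl (⁅⁆-⊆ X z∈X , tt)
... | no z∉X | o = record
  { list = z ∷ list ; unique = All.map (λ j∉ z≡j → j∉ (∨⁺ {X _} (inj₂ (fromWitness z≡j)))) fresh ∷ unique
  ; fresh = z∉X ∷ All.map (λ j∉ j∈X → j∉ (∨⁺ (inj₁ j∈X))) fresh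
  ; complete = complete′ ; good = good′ }
  where
  open Order o
  complete′ : ∀ j → ¬ T (X j) → j ∈ z ∷ list
  complete′ j j∉X with z ≟ j
  ... | yes refl = here refl
  ... | no  z≢j  = there (complete j (λ t → [ j∉X , z≢j ∘ toWitness ]′ (∨⁻ {X j} t)))
  good′ : ∀ i → i < suc (length list) → L (X ∪ setOf (take (suc i) (z ∷ list)))
  good′ zero    _       = resp (≐-by (X ∷ ⁅ z ⁆ ∷ []) [] (s0 || s1) (s0 || (s1 || ∅ᵉ)) refl tt) l
  good′ (suc i) (s≤s i<) = let U = setOf (take (suc i) list) in
    resp (≐-by (X ∷ U ∷ ⁅ z ⁆ ∷ []) [] (s0 || s2 || s1) (s0 || (s2 || s1)) refl tt) (good i i<)

-- By uniqueness the index cannot point to a later copy of an element that is already in the prefix.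
index-take : ∀ {n} {l : List (Fin n)} → Unique l → ∀ {j} (j∈l : j ∈ l) i → (toℕ (index j∈l) <ᵇ i) ≡ setOf (take i l) j
index-take _              j∈l         zero    = refl
index-take {l = z ∷ l} _ (here refl) (suc i) = sym (T⇒≡ (∨⁺ {⁅ z ⁆ z} (inj₁ (∈-⁅⁆ z))))
index-take {l = z ∷ l} (z∉ ∷ u) {j} (there j∈l) (suc i) with z ≟ j
... | yes refl = ⊥-elim (AllP.All¬⇒¬Any z∉ j∈l)
... | no  _    = index-take u j∈l i

-- The length of the list equals `n` only propositionally. The second component records that
-- matching on this equation leaves positions unchanged.
toPermutation : ∀ {k n} → k ≡ n → (to : Fin k → Fin n) (from : Fin n → Fin k) → (∀ j → to (from j) ≡ j) → (∀
    i → from (to i) ≡ i) →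
                Σ (Permutation′ n) λ σ → ∀ j → toℕ (σ ⟨$⟩ˡ j) ≡ toℕ (from j)
toPermutation refl to from to-from from-to = permutation to from to-from from-to , λ j → refl

lookup-injective : ∀ {A : Set} {l : List A} → Unique l → ∀ {i j} → List.lookup l i ≡ List.lookup l j → i ≡ j
lookup-injective (_ ∷ _)  {Fin.zero}  {Fin.zero}  _  = refl
lookup-injective (z∉ ∷ _) {Fin.zero}  {Fin.suc j} eq = ⊥-elim (All.lookup z∉ (∈-lookup j) eq)
lookup-injective (z∉ ∷ _) {Fin.suc i} {Fin.zero}  eq = ⊥-elim (All.lookup z∉ (∈-lookup i) (sym eq))
lookup-injective (_ ∷ u)  {Fin.suc i} {Fin.suc j} eq = cong Fin.suc (lookup-injective u eq)

module _ {n : ℕ} {L : P n → Set} (resp : Resp L) (o : Order L ∅) where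
  open Order o

  private
    j∈ : ∀ j → j ∈ list
    j∈ j = complete j (λ ())
    to-from : ∀ j → List.lookup list (index (j∈ j)) ≡ j
    to-from j = sym (AnyP.lookup-index (j∈ j))
    -- The pigeonhole principle in both directions: positions inject into elements by uniqueness,
    -- elements into positions by completeness.
    len : length list ≡ n
    len = ≤-antisym (injective⇒≤ (lookup-injective unique))
      (injective⇒≤ (λ {i} {j} eq → trans (sym (to-from i)) (trans (cong (List.lookup list) eq) (to-from j))))
    permuted = toPermutation len (List.lookup list) (λ j → index (j∈ j)) to-from (λ i → lookup-injective
        unique (to-from (List.lookup list i)))

  order⇒permutation : Permutation′ n
  order⇒permutation = proj₁ permuted

  order-good : ∀ i → i < n → L (λ j → toℕ (order⇒permutation ⟨$⟩ˡ j) <ᵇ suc i)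
  order-good i i<n = resp (≗⇒≐ λ j → trans (sym (index-take unique (j∈ j) (suc i))) (cong (_<ᵇ suc i) (sym
      (proj₂ permuted j))))
    (good i (subst (i <_) (sym len) i<n))

fold-⊔-≤ : ∀ {k} l → (∀ {x} → x ∈ l → x ≤ k) → foldr _⊔_ 0 l ≤ k
fold-⊔-≤ []      h = z≤n
fold-⊔-≤ (x ∷ l) h = ⊔-lub (h (here refl)) (fold-⊔-≤ l (h ∘ there))

≤-fold-⊔ : ∀ {l x} → x ∈ l → x ≤ foldr _⊔_ 0 l
≤-fold-⊔ {x ∷ l} (here refl) = m≤m⊔n x _
≤-fold-⊔ {y ∷ l} (there x∈)  = ≤-trans (≤-fold-⊔ x∈) (m≤n⊔m y _)

module _ {n : ℕ} (M : Matroid n) where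
  open Matroid M
  private N = fromMatroid M

  position-set : Permutation′ n → ℕ → P n
  position-set σ i j = toℕ (σ ⟨$⟩ˡ j) <ᵇ i

  conn-prefix : ∀ σ i → conn rank (prefix σ i) ≡ (Mat.r N (position-set σ i) + Mat.r N (∁ (position-set σ
      i))) ∸ Mat.r N 𝟙
  conn-prefix σ i = cong₂ _∸_ (cong₂ _+_ refl (cong rank complement)) (cong rank full)
    where
    complement : Sub.∁ (prefix σ i) ≡ tabulate (∁ (position-set σ i))
    complement = sym (VecP.tabulate-∘ not (position-set σ i))
    full : Sub.⊤ ≡ tabulate 𝟙
    full = trans (sym (VecP.tabulate∘lookup Sub.⊤)) (VecP.tabulate-cong λ j → VecP.lookup-replicate j true)

  path⇒pathwidth : Path (Narrow N) ∅ 𝟙 → PathwidthAtMost 1 rank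
  path⇒pathwidth p = order⇒permutation resp o , fold-⊔-≤ _ bound
    where
    resp : Resp (Narrow N)
    resp {X} {Y} = Narrow-resp N {X} {Y}
    o = path⇒order resp p
    σ = order⇒permutation resp o
    bound : ∀ {x} → x ∈ map (λ i → conn rank (prefix σ (suc i))) (upTo n) → x ≤ 1
    bound x∈ with ∈-map⁻ _ x∈
    ... | i , i∈ , refl = ≤-trans (≤-reflexive (conn-prefix σ (suc i)))
      (m≤n+o⇒m∸n≤o _ (Mat.r N 𝟙) (≤-trans (order-good resp o i (∈-upTo⁻ i∈)) (≤-reflexive (+-comm 1 _))))

  pathwidth⇒narrow : ∀ σ → width rank σ ≤ 1 → ∀ i → i < n → Narrow N (position-set σ (suc i))
  pathwidth⇒narrow σ w i i<n = ≤-trans (m≤n+m∸n _ (Mat.r N 𝟙)) (≤-trans (+-monoʳ-≤ (Mat.r N 𝟙)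
      (≤-trans (≤-reflexive (sym (conn-prefix σ (suc i)))) (≤-trans (≤-fold-⊔ (∈-map⁺ _ (∈-upTo⁺ i<n))) w)))
          (≤-reflexive (+-comm (Mat.r N 𝟙) 1)))

-- Exclusion of the obstructions by a narrow ordering

intermediate-value : ∀ (f : ℕ → ℕ) k n → f 0 < k → k ≤ f n → (∀ i → f (suc i) ≤ suc (f i)) → ∃ λ i → i < n ×
    f (suc i) ≡ k
intermediate-value f k zero    f0<k k≤fn slow = ⊥-elim (<⇒≱ f0<k k≤fn)
intermediate-value f k (suc n) f0<k k≤fn slow with k ≤? f n
... | no  k≰fn = n , ≤-refl , ≤-antisym (≤-trans (slow n) (≰⇒> k≰fn)) k≤fn
... | yes k≤fn′ with intermediate-value f k n f0<k k≤fn′ slow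
...   | i , i<n , eq = i , m≤n⇒m≤1+n i<n , eq

card-𝟙 : ∀ m → card (𝟙 {m}) ≡ m
card-𝟙 zero    = refl
card-𝟙 (suc m) = cong suc (card-𝟙 m)

-- The number of elements of the minor in a prefix rises from 0 to `m` in steps of at most one. The
-- bound `k ≤ m` makes it reach `k`, and `1 ≤ k` makes this happen at a nonempty prefix, as `width`
-- requires.
Critical : ∀ {m} → RankFn m → ℕ → Set
Critical {m} ρ k = 1 ≤ k × k ≤ m × (∀ Y → Sub.∣ Y ∣ ≡ k → 2 + ρ Sub.⊤ ≤ ρ Y + ρ (Sub.∁ Y))

critical-by : ∀ {m} (ρ : RankFn m) k → allSubsets (λ Y → not (Sub.∣ Y ∣ ≡ᵇ k) ∨ (2 + ρ Sub.⊤ ≤ᵇ ρ Y + ρ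
    (Sub.∁ Y))) ≡ true →
              ∀ Y → Sub.∣ Y ∣ ≡ k → 2 + ρ Sub.⊤ ≤ ρ Y + ρ (Sub.∁ Y)
critical-by ρ k ok Y size with ∨⁻ {not (Sub.∣ Y ∣ ≡ᵇ k)} (allSubsets-sound _ (≡⇒T ok) Y)
... | inj₁ p = ⊥-elim (not-T p (≡⇒≡ᵇ Sub.∣ Y ∣ k size))
... | inj₂ p = ≤ᵇ⇒≤ _ _ p

opaque
  unfolding rU24

  rU24-critical : Critical rU24 2
  rU24-critical = s≤s z≤n , s≤s (s≤s z≤n) , critical-by rU24 2 refl

  rK4-critical : Critical rK4 3
  rK4-critical = s≤s z≤n , s≤s (s≤s (s≤s z≤n)) , critical-by rK4 3 refl

  rK23-critical : Critical rK23 3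
  rK23-critical = s≤s z≤n , s≤s (s≤s (s≤s z≤n)) , critical-by rK23 3 refl

  rK23*-critical : Critical rK23* 3
  rK23*-critical = s≤s z≤n , s≤s (s≤s (s≤s z≤n)) , critical-by rK23* 3 refl

critical : ∀ o → ∃ λ k → Critical (rankOf o) k
critical u24  = 2 , rU24-critical
critical k4   = 3 , rK4-critical
critical k23  = 3 , rK23-critical
critical k23* = 3 , rK23*-critical

-- Some prefix of the ordering meets the ground set of the minor in exactly k elements.
narrow-order⇒no-critical-minor : ∀ {n} (N : Mat n) (σ : Permutation′ n) →
  (∀ i → i < n → Narrow N (λ j → toℕ (σ ⟨$⟩ˡ j) <ᵇ suc i)) →
  ∀ {m ρ k} → Critical {m} ρ k → ¬ HasMinor (rankFn N) (m , ρ)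
narrow-order⇒no-critical-minor {n} N σ narrow {m} {ρ} {k} (1≤k , k≤m , crit) h = contradictory-prefix
  (intermediate-value (card ∘ below) k n (≤-trans (s≤s (≤-trans (card-mono {X = below 0} {∅} (λ _ ()))
      (≤-reflexive (card-∅ {m})))) 1≤k)
    (≤-trans k≤m (≤-trans (≤-reflexive (sym (card-𝟙 m))) (card-mono (λ a _ → <⇒<ᵇ (toℕ<n (σ ⟨$⟩ˡ φ a)))))) slow)
  where
  open Mat N
  open Minor (minor-elim N (m , ρ) h)
  below : ℕ → P m
  below i a = toℕ (σ ⟨$⟩ˡ φ a) <ᵇ i
  -- Both `σ` and `φ` are injective, so at most one element of the minor sits at position `i`.
  slow : ∀ i → card (below (suc i)) ≤ suc (card (below i))
  slow i with any? (λ a → toℕ (σ ⟨$⟩ˡ φ a) Data.Nat.≟ i)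
  ... | no none = m≤n⇒m≤1+n (card-mono λ a t → <⇒<ᵇ (≤∧≢⇒< (≤-pred (<ᵇ⇒< _ (suc i) t)) (λ eq → none (a , eq))))
  ... | yes (a , a-at) = ≤-trans (card-mono {Y = below i ∪ ⁅ a ⁆} ⊆insert)
    (≤-trans (m≤m+n _ (card (below i ∩ ⁅ a ⁆))) (≤-reflexive (trans (card-modular (below i) ⁅ a ⁆) (trans
        (cong (card (below i) +_) (card-⁅⁆ a)) (+-comm _ 1)))))
    where
    same : ∀ b → toℕ (σ ⟨$⟩ˡ φ b) ≡ i → a ≡ b
    same b b-at = inj a b (trans (sym (inverseʳ σ)) (trans (cong (σ ⟨$⟩ʳ_) (toℕ-injective (trans a-at (sym
        b-at)))) (inverseʳ σ)))
    ⊆insert : below (suc i) ⊆ below i ∪ ⁅ a ⁆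
    ⊆insert b t with toℕ (σ ⟨$⟩ˡ φ b) Data.Nat.≟ i
    ... | yes b-at = ∨⁺ {below i b} (inj₂ (fromWitness (same b b-at)))
    ... | no  b≢   = ∨⁺ (inj₁ (<⇒<ᵇ (≤∧≢⇒< (≤-pred (<ᵇ⇒< _ (suc i) t)) b≢)))

  contradictory-prefix : ¬ (∃ λ i → i < n × card (below (suc i)) ≡ k)
  contradictory-prefix (i , i<n , eq-k) = let nX = narrow i i<n in
    -- λ is at least 2 at `A` in the minor and at most 1 at `X` in `N`. The certificate shows that λ
    -- does not grow in a minor, although `C` may lie on both sides of `X`.
    (1≰0 (≤-by N (X ∷ I ∷ A ∷ B ∷ C ∷ []) ((s2 , s0) ∷ (s3 , ~ s0) ∷ (s2 , s1) ∷ (s3 , s1) ∷ [])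
      ((lit 2 ⊕ (rk (s1 || s4) ⊕ rk s4) ≼ rk (s2 || s4) ⊕ rk (s3 || s4)) ∷
      (rk s0 ⊕ rk (~ s0) ≼ lit 1 ⊕ rk 𝟙ᵉ) ∷ []) (lit 1 ≼ lit 0) (mon (s2 || s3 || s4) (s1 || s4) ∷
      sub s4 (s2 || s0 && s4) ∷ sub s0 (s2 || s3 || s4) ∷ sub (~ s0) (s0 || s3 || s4) ∷
      sub (s3 || ~ s0 && s4) (s0 && s4) ∷ []) refl (A⊆ , B⊆ , A⊆I , B⊆I , tt) (wide , nX , tt)))
    where
    Y : Subset m
    Y = tabulate (below (suc i))
    X A B I : P n
    X j = toℕ (σ ⟨$⟩ˡ j) <ᵇ suc i
    A = img φ (lookup Y)
    B = img φ (lookup (Sub.∁ Y))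
    I = img φ (lookup Sub.⊤)
    Y≐ : lookup Y ≐ below (suc i)
    Y≐ = ≗⇒≐ (VecP.lookup∘tabulate _)
    A⊆ : A ⊆ X
    A⊆ j t with ∈-img⁻ φ (lookup Y) t
    ... | a , a∈ , refl = proj₁ Y≐ a a∈
    B⊆ : B ⊆ ∁ X
    B⊆ j t with ∈-img⁻ φ (lookup (Sub.∁ Y)) t
    ... | a , a∈ , refl = T-not λ a∈X → not-T (proj₁ (lookup-∁ Y) a a∈) (proj₂ Y≐ a a∈X)
    in-I : ∀ Z → img φ (lookup Z) ⊆ I
    in-I Z = img-mono φ (λ i _ → proj₂ (lookup-⊤ {m}) i tt)
    A⊆I : A ⊆ I
    A⊆I = in-I Y
    B⊆I : B ⊆ I
    B⊆I = in-I (Sub.∁ Y)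
    C≤ : ∀ Z → r C ≤ r (Z ∪ C)
    C≤ Z = ≤-by N (Z ∷ C ∷ []) [] [] (rk s1 ≼ rk (s0 || s1)) (mon s1 (s0 || s1) ∷ []) refl tt tt
    wide : 2 + (r (I ∪ C) + r C) ≤ r (A ∪ C) + r (B ∪ C)
    wide = ∸-wide (C≤ A) (C≤ B) (C≤ I) (≤-trans (≤-reflexive (cong (2 +_) (sym (eq Sub.⊤))))
      (≤-trans (crit Y (trans (card-lookup Y) (trans (card-≐ Y≐) eq-k))) (≤-reflexive (cong₂ _+_ (eq Y) (eq
          (Sub.∁ Y))))))
      where
      ∸-wide : ∀ {a b t c} → c ≤ a → c ≤ b → c ≤ t → 2 + (t ∸ c) ≤ (a ∸ c) + (b ∸ c) → 2 + (t + c) ≤ a + b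
      ∸-wide {t = t} {c} ca cb ct le = ≤-trans
        (≤-reflexive (cong (2 +_) (trans (cong (_+ c) (sym (m∸n+n≡m ct))) (+-assoc (t ∸ c) c c))))
        (≤-trans (+-monoˡ-≤ (c + c) le) (≤-reflexive (∸-sum ca cb)))

-- The two directions of the equivalence

module _ {n : ℕ} (M : Matroid n) where
  open Matroid M
  private N = fromMatroid M

  InP1⇒free : ∀ F → InP1 F M → ∀ o → ¬ HasMinor rank (size o , rankOf o)
  InP1⇒free F (_ , σ , w) o h = narrow-order⇒no-critical-minor N σ (pathwidth⇒narrow M σ w) (proj₂ (critical o))
    (HasMinor-rank rank (rankFn N) (size o , rankOf o) (λ X → sym (fromMatroid-rank M X)) h)

  free⇒InP1 : ∀ F → (∀ o → ¬ HasMinor rank (size o , rankOf o)) → InP1 F M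
  free⇒InP1 F none = rep⇒representable F M (free-rep F N (<-wellFounded _) free) , path⇒pathwidth M
      (free-path N (<-wellFounded _) free)
    where
    free : Free N
    free o h = none o (HasMinor-rank (rankFn N) rank (size o , rankOf o) (fromMatroid-rank M) h)

theorem4p2 : (q : ℕ) (F : Field) → HasOrder F q →
    ∀ {n} (M : Matroid n) →
    InP1 F M ⇔
    (¬ HasMinor (Matroid.rank M) U24 × ¬ HasMinor (Matroid.rank M) MK4 ×
    ¬ HasMinor (Matroid.rank M) MK23 × ¬ HasMinor (Matroid.rank M) MK23*)
theorem4p2 q F _ M = mk⇔
  (λ p → let none : ∀ o → ¬ HasObstruction rank o
             none o h = InP1⇒free M F p o (to-obstruction rank o h)
         in none u24 , none k4 , none k23 , none k23*)
  (λ { (no-u24 , no-k4 , no-k23 , no-k23*) → free⇒InP1 M F λ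
     { u24 → no-u24 ∘ from-obstruction rank u24 ; k4 → no-k4 ∘ from-obstruction rank k4
     ; k23 → no-k23 ∘ from-obstruction rank k23 ; k23* → no-k23* ∘ from-obstruction rank k23* } })
  where open Matroid M
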